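{- There exists an algorithm that, given an instance $(Q,A,b)$ of Integer Quadratic Programming, runs in time $f(n,\alpha)\,L^{O(1)}$ for some computable function $f$, and determines whether the instance is infeasible, feasible and unbounded, or feasible and bounded. If the instance is feasible and bounded, the algorithm outputs an optimal solution.
   Context: Integer Quadratic Programming: the input is an $n\times n$ integer symmetric matrix $Q$, an $m\times n$ integer matrix $A$ and an $m$-dimensional integer vector $b$; the task is to minimize $x^TQx$ subject to $Ax\le b$, $x\in\mathbb{Z}^n$. A vector $x\in\mathbb{Z}^n$ with $Ax\le b$ is feasible; the instance is infeasible if no feasible vector exists, unbounded if for every integer $\beta$ there is a feasible $x$ with $x^TQx\le\beta$, and bounded otherwise. $\alpha$ denotes the maximum absolute value of an entry of $Q$ and $A$, and $L$ is the total number of bits in the encoding of the input. -}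

module Defs where

import Algebra.Properties.CommutativeMonoid.Sum
open import Data.Fin.Base using (Fin; toℕ)
open import Data.Integer.Base as ℤ using (ℤ; +_; -[1+_]; 0ℤ; ∣_∣)
open import Data.Integer.Properties as ℤ using (+-0-commutativeMonoid)
open import Data.List.Base as List using (List; []; _∷_; _++_)
open import Data.List.Extrema.Nat using (max)
open import Data.Nat.Base as ℕ using (ℕ; zero; suc)
import Data.Nat.ListAction as ListAction
open import Data.Nat.Logarithm using (⌈log₂_⌉)
open import Data.Product.Base using (∃; ∃-syntax; _×_)
open import Data.Sum.Base using (_⊎_)
open import Data.Vec.Functional using (Vector)
open import Relation.Binary.PropositionalEquality.Core using (_≡_)
open import Relation.Nullary.Decidable.Core using (yes; no)
open import Relation.Nullary.Negation.Core using (¬_)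

open Algebra.Properties.CommutativeMonoid.Sum +-0-commutativeMonoid using (sum)

Matrix : ℕ → ℕ → Set
Matrix m n = Fin m → Fin n → ℤ

entries : ∀ {m n} → Matrix m n → List ℤ
entries M = List.concat (List.tabulate λ i → List.tabulate (M i))

record Instance : Set where
  field
    n m       : ℕ
    Q         : Matrix n n
    A         : Matrix m n
    b         : Vector ℤ m
    symmetric : ∀ i j → Q i j ≡ Q j i

module _ (I : Instance) where
  open Instance I

  objective : Vector ℤ n → ℤ
  objective x = sum λ i → sum λ j → x i ℤ.* Q i j ℤ.* x j

  Feasible : Vector ℤ n → Set
  Feasible x = ∀ i → sum (λ j → A i j ℤ.* x j) ℤ.≤ b i

  Infeasible : Set
  Infeasible = ¬ ∃ Feasible

  Unbounded : Set
  Unbounded = ∀ (β : ℤ) → ∃[ x ] Feasible x × objective x ℤ.≤ β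

  Bounded : Set
  Bounded = ¬ Infeasible × ¬ Unbounded

  Optimal : Vector ℤ n → Set
  Optimal x = Feasible x × (∀ y → Feasible y → objective x ℤ.≤ objective y)

  -- α; it is 0 when Q and A have no entries, i.e. when n = 0.
  maxCoefficient : ℕ
  maxCoefficient = max 0 (List.map ∣_∣ (entries Q ++ entries A))

  encoding : List ℤ
  encoding = + n ∷ + m ∷ entries Q ++ entries A ++ List.tabulate b

-- One sign bit followed by the binary digits of ∣ z ∣ (none for 0).
bits : ℤ → ℕ
bits z = suc ⌈log₂ suc ∣ z ∣ ⌉

encodingLength : Instance → ℕ
encodingLength I = ListAction.sum (List.map bits (encoding I))

-- Model of computation: the random access machine with addition,
-- subtraction, multiplication and division under the logarithmic cost
-- criterion (Aho, Hopcroft & Ullman), with structured control flow.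
-- Its running times are polynomially related to those of Turing
-- machines, since every integer that is read or produced, including
-- each address, is charged its bit length.

-- Registers are indexed by ℤ so that every computed address is legal.
Memory : Set
Memory = ℤ → ℤ

_[_↦_] : Memory → ℤ → ℤ → Memory
(σ [ a ↦ v ]) a′ with a′ ℤ.≟ a
... | yes _ = v
... | no  _ = σ a′

infixl 7 _⊗_ _⊘_
infixl 6 _⊕_ _⊖_

data Exp : Set where
  lit             : ℤ → Exp
  reg             : Exp → Exp   -- contents of the register at a computed address
  _⊕_ _⊖_ _⊗_ _⊘_ : Exp → Exp → Exp

infix  4 _≔_
infixr 3 _⨾_

data Program : Set where
  skip          : Program
  _≔_           : (address value : Exp) → Program
  _⨾_           : Program → Program → Program
  ifPos_⟨_⟩⟨_⟩  : Exp → Program → Program → Program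
  whilePos_⟨_⟩  : Exp → Program → Program

-- Euclidean division, made total by x / 0 = 0.
_div_ : ℤ → ℤ → ℤ
x div (+ zero)      = 0ℤ
x div y@(+ (suc _)) = x ℤ./ y
x div y@(-[1+ _ ])  = x ℤ./ y

⟦_⟧ : Exp → Memory → ℤ
⟦ lit z ⟧ σ = z
⟦ reg e ⟧ σ = σ (⟦ e ⟧ σ)
⟦ e ⊕ f ⟧ σ = ⟦ e ⟧ σ ℤ.+ ⟦ f ⟧ σ
⟦ e ⊖ f ⟧ σ = ⟦ e ⟧ σ ℤ.- ⟦ f ⟧ σ
⟦ e ⊗ f ⟧ σ = ⟦ e ⟧ σ ℤ.* ⟦ f ⟧ σ
⟦ e ⊘ f ⟧ σ = ⟦ e ⟧ σ div ⟦ f ⟧ σ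

-- The total bit length of the values of all subexpressions.
cost : Exp → Memory → ℕ
cost (lit z)     σ = bits z
cost g@(reg e)   σ = cost e σ ℕ.+ bits (⟦ g ⟧ σ)
cost g@(e ⊕ f) σ = cost e σ ℕ.+ cost f σ ℕ.+ bits (⟦ g ⟧ σ)
cost g@(e ⊖ f) σ = cost e σ ℕ.+ cost f σ ℕ.+ bits (⟦ g ⟧ σ)
cost g@(e ⊗ f) σ = cost e σ ℕ.+ cost f σ ℕ.+ bits (⟦ g ⟧ σ)
cost g@(e ⊘ f) σ = cost e σ ℕ.+ cost f σ ℕ.+ bits (⟦ g ⟧ σ)

-- ⟨ p , σ ⟩⇓⟨ σ′ , t ⟩: started in memory σ, the program p halts in
-- memory σ′ after time t.
data ⟨_,_⟩⇓⟨_,_⟩ : Program → Memory → Memory → ℕ → Set where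

  skip : ∀ {σ} → ⟨ skip , σ ⟩⇓⟨ σ , 1 ⟩

  assign : ∀ {σ a e} →
    ⟨ a ≔ e , σ ⟩⇓⟨ σ [ ⟦ a ⟧ σ ↦ ⟦ e ⟧ σ ] , cost a σ ℕ.+ cost e σ ⟩

  seq : ∀ {p q σ σ′ σ″ s t} →
    ⟨ p , σ ⟩⇓⟨ σ′ , s ⟩ → ⟨ q , σ′ ⟩⇓⟨ σ″ , t ⟩ →
    ⟨ p ⨾ q , σ ⟩⇓⟨ σ″ , s ℕ.+ t ⟩

  if-true : ∀ {e p q σ σ′ t} →
    0ℤ ℤ.< ⟦ e ⟧ σ → ⟨ p , σ ⟩⇓⟨ σ′ , t ⟩ →
    ⟨ ifPos e ⟨ p ⟩⟨ q ⟩ , σ ⟩⇓⟨ σ′ , cost e σ ℕ.+ t ⟩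

  if-false : ∀ {e p q σ σ′ t} →
    ⟦ e ⟧ σ ℤ.≤ 0ℤ → ⟨ q , σ ⟩⇓⟨ σ′ , t ⟩ →
    ⟨ ifPos e ⟨ p ⟩⟨ q ⟩ , σ ⟩⇓⟨ σ′ , cost e σ ℕ.+ t ⟩

  while-true : ∀ {e p σ σ′ σ″ s t} →
    0ℤ ℤ.< ⟦ e ⟧ σ → ⟨ p , σ ⟩⇓⟨ σ′ , s ⟩ →
    ⟨ whilePos e ⟨ p ⟩ , σ′ ⟩⇓⟨ σ″ , t ⟩ →
    ⟨ whilePos e ⟨ p ⟩ , σ ⟩⇓⟨ σ″ , cost e σ ℕ.+ s ℕ.+ t ⟩

  while-false : ∀ {e p σ} →
    ⟦ e ⟧ σ ℤ.≤ 0ℤ →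
    ⟨ whilePos e ⟨ p ⟩ , σ ⟩⇓⟨ σ , cost e σ ⟩

-- The input occupies the registers 0, 1, 2, …; all others contain 0.
initial : List ℤ → Memory
initial []       _           = 0ℤ
initial (z ∷ zs) (+ zero)    = z
initial (z ∷ zs) (+ (suc k)) = initial zs (+ k)
initial (z ∷ zs) -[1+ _ ]    = 0ℤ

Computable : (ℕ → ℕ → ℕ) → Set
Computable f = ∃[ p ] ∀ k l → ∃[ σ ] ∃[ t ]
  ⟨ p , initial (+ k ∷ + l ∷ []) ⟩⇓⟨ σ , t ⟩ × σ 0ℤ ≡ + f k l

-- Output convention: register 0 contains the verdict; for a feasible
-- and bounded instance, the registers 1, …, n contain the solution.

outputVector : ∀ {n} → Memory → Vector ℤ n
outputVector σ j = σ (+ suc (toℕ j))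

CorrectOutput : Instance → Memory → Set
CorrectOutput I σ =
    (σ 0ℤ ≡ + 0 × Infeasible I)
  ⊎ (σ 0ℤ ≡ + 1 × ∃ (Feasible I) × Unbounded I)
  ⊎ (σ 0ℤ ≡ + 2 × ∃ (Feasible I) × Bounded I × Optimal I (outputVector σ))

{-# OPTIONS --safe #-}

-- Every feasible point can be moved, without increasing the objective, to a
-- point determined by few small numbers and by b, unless the moves exhibit a
-- ray along which the objective is unbounded.  Keep a relation
-- D x = Σ zₜ dₜ + e, where D and the dₜ are small and e is a combination of
-- the bᵢ with small coefficients; initially the dₜ are the unit vectors and
-- z = x.  To get rid of the direction y = d₀, walk from x in steps of ± y, never
-- increasing the objective.  If a row aᵢ stops the walk, then aᵢ x = bᵢ - s with s
-- small; if the objective does (yQy > 0), then yQx is small.  Either equation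
-- has small coefficients and eliminates z₀.  If nothing stops the walk, then
-- Ay ≤ 0 and yQy ≤ 0, and either yQx < 0 for some feasible x, so that x + ty is
-- unbounded, or x can be moved freely along y and z₀ can be reduced modulo D.
-- After n eliminations D x = e.  Applied to the system extended by yQx ≤ -1,
-- the same argument lets the base point of a ray be of this form.
--
-- Only the least bᵢ among equal rows matters, and there are at most (2α + 1)ⁿ
-- different rows, so the candidates for x and y are bounded in number by a
-- function of n and α.  The program enumerates them; it is written in a small
-- language of bounded loops in which counters stay polynomial in
-- K = f(n, α) L and all other values have bit length polynomial in K, so that
-- the running time is polynomial in K.

module Submission where

open import Defs
import Algebra.Properties.Semiring.Sum
open import Data.Empty using (⊥; ⊥-elim)
open import Data.Fin using (#_)
open import Data.Fin.Base using (Fin; zero; suc; toℕ; fromℕ; fromℕ<; inject₁)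
import Data.Fin.Properties as Fin
open import Data.Integer.Base as ℤ using (ℤ; +_; -[1+_]; 0ℤ; 1ℤ; ∣_∣)
import Data.Integer.DivMod as ℤ
import Data.Integer.Properties as ℤ
open import Data.Integer.Tactic.RingSolver using (solve-∀)
open import Data.List.Base as List using (List; []; _∷_; _++_)
open import Data.List.Extrema.Nat using (xs≤max; max≤v⁺)
import Data.List.Properties as List
open import Data.List.Relation.Unary.All as All using (All; []; _∷_)
import Data.List.Relation.Unary.All.Properties as All
open import Data.Nat.Base as ℕ using (ℕ; zero; suc; z≤n; s≤s; NonZero; >-nonZero)
import Data.Nat.Divisibility as ℕ
import Data.Nat.DivMod as ℕ
open import Data.Nat.Induction using (<-rec)
import Data.Nat.ListAction as ListAction
open import Data.Nat.Logarithm
open import Data.Nat.Properties as ℕ using (≤-trans; ≤-reflexive; ≤-refl; <⇒≤; m≤m+n; m≤n+m; n≤1+n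
  ; +-mono-≤; *-monoʳ-≤; *-monoˡ-≤; ^-monoʳ-≤; m≤m*n; m≤n*m; ≤-<-trans; <-≤-trans; +-comm; +-monoʳ-≤; +-monoˡ-≤; +-identityʳ)
import Data.Nat.Tactic.RingSolver as ℕ-Ring
open import Data.Product.Base using (∃; ∃-syntax; Σ-syntax; _×_; _,_; proj₁; proj₂)
open import Data.Sum.Base using (_⊎_; inj₁; inj₂)
open import Data.Unit.Base using (⊤; tt)
open import Data.Vec.Functional using (Vector)
open import Function.Bundles using (_⇔_; mk⇔; Equivalence)
open import Relation.Binary.Definitions using (tri<; tri≈; tri>)
open import Relation.Binary.PropositionalEquality
open import Relation.Nullary.Decidable.Core using (Dec; yes; no; True; toWitness; _×-dec_; _→-dec_)
open import Relation.Nullary.Negation.Core using (¬_; contradiction)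

open Equivalence using (to; from)

-- The objective may be indefinite, so an optimum need not lie near a vertex of the polyhedron;
-- stationarity along y, a linear condition with coefficient vector `y *ₘ Q`, stands in for a
-- missing tight row. The right-hand sides can exceed every function of n and α, so they may enter
-- only linearly and with bounded coefficients, which is what `Describable` records. An elimination
-- multiplies the relation by h ≤ κ Y², and all new bounds stay below 4 κ Y⁴; requiring 4 κ ≤ Y
-- turns this into Y⁵, whence the exponents 5 ^ k. Existence of an optimum is never presupposed:
-- without a certificate every feasible point is matched by a candidate, and finitely many
-- candidates have a minimum. Codes that come from no true relation still decode to integer vectors
-- and do no harm, because each decoded vector is tested. For the running time the exponent of K
-- must be the same for all instances; it is therefore computed by recursion on the program text.

-- Inequalities between integers.

module Order where
  open import Data.Integer.Base using (_+_; _*_; _-_; -_; _≤_; _<_)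

  -- Linear inequalities are proved by exhibiting the difference of the two
  -- sides as a manifestly nonnegative expression.
  ≤-by : ∀ {x y} e → 0ℤ ≤ e → y - x ≡ e → x ≤ y
  ≤-by e 0≤e eq = ℤ.0≤i-j⇒j≤i (subst (0ℤ ≤_) (sym eq) 0≤e)

  gap : ∀ {x y} → x ≤ y → 0ℤ ≤ y - x
  gap = ℤ.i≤j⇒0≤j-i

  gap< : ∀ {x y} → x < y → 0ℤ ≤ y - x - 1ℤ
  gap< {x} {y} x<y = subst (0ℤ ≤_) (eq x y) (gap (ℤ.i<j⇒suc[i]≤j x<y))
    where
    eq : ∀ x y → y - (1ℤ + x) ≡ y - x - 1ℤ
    eq = solve-∀

  <-by : ∀ {x y} e → 0ℤ ≤ e → y - x - 1ℤ ≡ e → x < y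
  <-by {x} {y} e 0≤e eq = ℤ.suc[i]≤j⇒i<j (≤-by e 0≤e (trans (p x y) eq))
    where
    p : ∀ x y → y - (1ℤ + x) ≡ y - x - 1ℤ
    p = solve-∀

  infixl 6 _⊹_
  _⊹_ : ∀ {x y} → 0ℤ ≤ x → 0ℤ ≤ y → 0ℤ ≤ x + y
  _⊹_ = ℤ.+-mono-≤

  0≤* : ∀ {x y} → 0ℤ ≤ x → 0ℤ ≤ y → 0ℤ ≤ x * y
  0≤* {+ x} {+ y} _ _ = subst (0ℤ ≤_) (ℤ.pos-* x y) (ℤ.+≤+ z≤n)

  -∣∣ : ∀ {x} {k : ℕ} → - + k ≤ x → x ≤ + k → ∣ x ∣ ℕ.≤ k
  -∣∣ {+ x} _ (ℤ.+≤+ p) = p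
  -∣∣ { -[1+ x ]} {k} p _ = ℤ.drop‿+≤+ (ℤ.≤-trans (ℤ.neg-mono-≤ p) (ℤ.≤-reflexive (ℤ.neg-involutive (+ k))))

  ∣∣≤ : ∀ {x} {k : ℕ} → 0ℤ ≤ x → x ≤ + k → ∣ x ∣ ℕ.≤ k
  ∣∣≤ {+ x} _ (ℤ.+≤+ p) = p

  0<∣∣ : ∀ {x} → 0ℤ < x → 0 ℕ.< ∣ x ∣
  0<∣∣ {+ zero}  (ℤ.+<+ ())
  0<∣∣ {+ suc _} _ = s≤s z≤n

open Order

-- Dot products and quadratic forms along a line.

module Vectors where
  open import Data.Integer.Base using (_+_; _*_; _-_; -_; _≤_; _<_)
  open Algebra.Properties.Semiring.Sum ℤ.+-*-semiring

  dot : ∀ {n} → Vector ℤ n → Vector ℤ n → ℤ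
  dot a x = sum λ j → a j * x j

  form : ∀ {n} → Matrix n n → Vector ℤ n → Vector ℤ n → ℤ
  form Q x y = sum λ i → sum λ j → x i * Q i j * y j

  _*ₘ_ : ∀ {n} → Vector ℤ n → Matrix n n → Vector ℤ n
  (y *ₘ Q) j = sum λ i → y i * Q i j

  move : ∀ {n} → Vector ℤ n → ℤ → Vector ℤ n → Vector ℤ n
  move x t y j = x j + t * y j

  sum-lin : ∀ {k} t (f g : Vector ℤ k) → sum (λ i → f i + t * g i) ≡ sum f + t * sum g
  sum-lin t f g = trans (∑-distrib-+ f _) (cong (λ s → sum f + s) (sym (*-distribˡ-sum t g)))

  dot-cong : ∀ {n} (a : Vector ℤ n) {x y} → (∀ j → x j ≡ y j) → dot a x ≡ dot a y
  dot-cong a eq = sum-cong-≗ λ j → cong (a j *_) (eq j)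

  dot-congˡ : ∀ {n} {a b : Vector ℤ n} x → (∀ j → a j ≡ b j) → dot a x ≡ dot b x
  dot-congˡ x eq = sum-cong-≗ λ j → cong (_* x j) (eq j)

  dot-move : ∀ {n} (a x : Vector ℤ n) t y → dot a (move x t y) ≡ dot a x + t * dot a y
  dot-move a x t y = trans (sum-cong-≗ λ j → eq (a j) (x j) t (y j)) (sum-lin t (λ j → a j * x j) (λ j → a j * y j))
    where
    eq : ∀ a x t y → a * (x + t * y) ≡ a * x + t * (a * y)
    eq = solve-∀

  dot-neg : ∀ {n} (a y : Vector ℤ n) → dot a (λ j → - y j) ≡ - dot a y
  dot-neg {n} a y = trans (sum-cong-≗ λ j → eq (a j) (y j)) (trans (sum-lin -[1+ 0 ] (λ _ → 0ℤ) (λ j → a j * y j))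
    (trans (cong (λ s → s + -[1+ 0 ] * dot a y) (sum-replicate-zero n)) (eq′ (dot a y))))
    where
    eq : ∀ a y → a * - y ≡ 0ℤ + -[1+ 0 ] * (a * y)
    eq = solve-∀
    eq′ : ∀ y → 0ℤ + -[1+ 0 ] * y ≡ - y
    eq′ = solve-∀

  form-dot : ∀ {n} (Q : Matrix n n) y x → form Q y x ≡ dot (y *ₘ Q) x
  form-dot Q y x = trans (∑-comm (λ i j → y i * Q i j * x j))
    (sum-cong-≗ λ j → sym (*-distribʳ-sum (x j) (λ i → y i * Q i j)))

  form-cong : ∀ {n} (Q : Matrix n n) {x x′ y y′} → (∀ j → x j ≡ x′ j) → (∀ j → y j ≡ y′ j) →
    form Q x y ≡ form Q x′ y′
  form-cong Q p q = sum-cong-≗ λ i → sum-cong-≗ λ j → cong₂ (λ u v → u * Q i j * v) (p i) (q j)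

  form-moveʳ : ∀ {n} (Q : Matrix n n) z x t y → form Q z (move x t y) ≡ form Q z x + t * form Q z y
  form-moveʳ Q z x t y = trans (form-dot Q z _) (trans (dot-move (z *ₘ Q) x t y)
    (cong₂ (λ u v → u + t * v) (sym (form-dot Q z x)) (sym (form-dot Q z y))))

  form-negʳ : ∀ {n} (Q : Matrix n n) z y → form Q z (λ j → - y j) ≡ - form Q z y
  form-negʳ Q z y = trans (form-dot Q z _) (trans (dot-neg (z *ₘ Q) y) (cong -_ (sym (form-dot Q z y))))

  module _ {n} (Q : Matrix n n) (symmetric : ∀ i j → Q i j ≡ Q j i) where
    form-sym : ∀ x y → form Q x y ≡ form Q y x
    form-sym x y = trans (∑-comm (λ i j → x i * Q i j * y j))
      (sum-cong-≗ λ j → sum-cong-≗ λ i → trans (cong (λ q → x i * q * y j) (symmetric i j)) (eq (x i) (Q j i) (y j)))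
      where
      eq : ∀ x q y → x * q * y ≡ y * q * x
      eq = solve-∀

    -- Symmetry of Q merges the two cross terms, so the linear coefficient of the objective along y
    -- is twice `form Q y x`.
    form-move : ∀ x t y → form Q (move x t y) (move x t y) ≡
      form Q x x + (t * form Q y x + t * form Q y x + t * t * form Q y y)
    form-move x t y = trans (form-moveʳ Q (move x t y) x t y) (trans
      (cong₂ (λ u v → u + t * v)
        (trans (form-sym _ x) (form-moveʳ Q x x t y))
        (trans (form-sym _ y) (form-moveʳ Q y x t y)))
      (trans (cong (λ u → form Q x x + t * u + t * (form Q y x + t * form Q y y)) (form-sym x y))
        (eq (form Q x x) t (form Q y x) (form Q y y))))
      where
      eq : ∀ o t g q → o + t * g + t * (g + t * q) ≡ o + (t * g + t * g + t * t * q)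
      eq = solve-∀

    form-negˡ : ∀ y x → form Q (λ j → - y j) x ≡ - form Q y x
    form-negˡ y x = trans (form-sym _ x) (trans (form-negʳ Q x y) (cong -_ (form-sym x y)))

  ∣sum∣≤ : ∀ {k} Y (f : Vector ℤ k) → (∀ i → ∣ f i ∣ ℕ.≤ Y) → ∣ sum f ∣ ℕ.≤ k ℕ.* Y
  ∣sum∣≤ {zero} Y f h = z≤n
  ∣sum∣≤ {suc k} Y f h = ≤-trans (ℤ.∣i+j∣≤∣i∣+∣j∣ (f zero) _)
    (+-mono-≤ (h zero) (∣sum∣≤ Y (λ i → f (suc i)) (λ i → h (suc i))))

  ∣*∣≤ : ∀ {X Y} x y → ∣ x ∣ ℕ.≤ X → ∣ y ∣ ℕ.≤ Y → ∣ x * y ∣ ℕ.≤ X ℕ.* Y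
  ∣*∣≤ x y p q = subst (ℕ._≤ _) (sym (ℤ.∣i*j∣≡∣i∣*∣j∣ x y)) (ℕ.*-mono-≤ p q)

  ∣dot∣≤ : ∀ {n} X Y (a x : Vector ℤ n) → (∀ j → ∣ a j ∣ ℕ.≤ X) → (∀ j → ∣ x j ∣ ℕ.≤ Y) →
    ∣ dot a x ∣ ℕ.≤ n ℕ.* (X ℕ.* Y)
  ∣dot∣≤ X Y a x p q = ∣sum∣≤ _ _ λ j → ∣*∣≤ (a j) (x j) (p j) (q j)

open Vectors

-- Bounded combinations of 1 and the right-hand sides.

module Descriptions where
  open import Data.Integer.Base using (_+_; _*_; _-_; -_; _≤_; _<_)
  open Algebra.Properties.Semiring.Sum ℤ.+-*-semiring

  ∑< : ℕ → (ℕ → ℤ) → ℤ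
  ∑< zero    f = 0ℤ
  ∑< (suc k) f = ∑< k f + f k

  ∑<-cong : ∀ k {f g : ℕ → ℤ} → (∀ i → i ℕ.< k → f i ≡ g i) → ∑< k f ≡ ∑< k g
  ∑<-cong zero    h = refl
  ∑<-cong (suc k) h = cong₂ _+_ (∑<-cong k λ i p → h i (ℕ.m<n⇒m<1+n p)) (h k ≤-refl)

  ∑<-lin : ∀ k t (f g : ℕ → ℤ) → ∑< k (λ i → f i + t * g i) ≡ ∑< k f + t * ∑< k g
  ∑<-lin zero    t f g = sym (trans (ℤ.+-identityˡ _) (ℤ.*-zeroʳ t))
  ∑<-lin (suc k) t f g = trans (cong (λ s → s + (f k + t * g k)) (∑<-lin k t f g))
    (eq (∑< k f) (∑< k g) t (f k) (g k))
    where
    eq : ∀ a b t c d → a + t * b + (c + t * d) ≡ a + c + t * (b + d)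
    eq = solve-∀

  ∑<-zero : ∀ k f → (∀ i → i ℕ.< k → f i ≡ 0ℤ) → ∑< k f ≡ 0ℤ
  ∑<-zero zero    f h = refl
  ∑<-zero (suc k) f h = cong₂ _+_ (∑<-zero k f λ i p → h i (ℕ.m<n⇒m<1+n p)) (h k ≤-refl)

  ∑<-suc : ∀ k f → ∑< (suc k) f ≡ f 0 + ∑< k (λ i → f (suc i))
  ∑<-suc zero    f = ℤ.+-comm 0ℤ (f 0)
  ∑<-suc (suc k) f = trans (cong (λ s → s + f (suc k)) (∑<-suc k f)) (ℤ.+-assoc (f 0) _ _)

  sum-∑< : ∀ k (f : ℕ → ℤ) → sum {k} (λ i → f (toℕ i)) ≡ ∑< k f
  sum-∑< zero    f = refl
  sum-∑< (suc k) f = trans (cong (λ s → f 0 + s) (sum-∑< k (λ i → f (suc i)))) (sym (∑<-suc k f))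

  δ : ℕ → ℕ → ℤ
  δ c i with i ℕ.≟ c
  ... | yes _ = 1ℤ
  ... | no  _ = 0ℤ

  ∣δ∣≤1 : ∀ c i → ∣ δ c i ∣ ℕ.≤ 1
  ∣δ∣≤1 c i with i ℕ.≟ c
  ... | yes _ = ≤-refl
  ... | no  _ = z≤n

  δ-diag : ∀ c → δ c c ≡ 1ℤ
  δ-diag c with c ℕ.≟ c
  ... | yes _ = refl
  ... | no ¬p = contradiction refl ¬p

  δ-off : ∀ c i → i ≢ c → δ c i ≡ 0ℤ
  δ-off c i p with i ℕ.≟ c
  ... | yes q = contradiction q p
  ... | no _  = refl

  ∑<-δ : ∀ k c (f : ℕ → ℤ) → c ℕ.< k → ∑< k (λ i → δ c i * f i) ≡ f c
  ∑<-δ (suc k) c f c<k with k ℕ.≟ c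
  ... | yes refl = trans (cong (λ s → s + 1ℤ * f k) (∑<-zero k _ λ i p →
          trans (cong (λ s → s * f i) (δ-off k i (ℕ.<⇒≢ p))) (ℤ.*-zeroˡ (f i))))
          (trans (ℤ.+-identityˡ _) (ℤ.*-identityˡ (f k)))
  ... | no k≢c = trans (cong₂ _+_ (∑<-δ k c f (ℕ.≤∧≢⇒< (ℕ.s≤s⁻¹ c<k) (≢-sym k≢c))) (ℤ.*-zeroˡ (f k))) (ℤ.+-identityʳ _)

  module _ (T : ℕ) (β : ℕ → ℤ) where

    -- The values β c stand for right-hand sides, one for each of T possible rows. The size of β
    -- itself is left open: only the coefficients are bounded.
    record Describable (Y : ℕ) (v : ℤ) : Set where
      constructor describe
      field
        w  : ℤ
        u  : ℕ → ℤ
        w≤ : ∣ w ∣ ℕ.≤ Y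
        u≤ : ∀ c → ∣ u c ∣ ℕ.≤ Y
        eq : v ≡ w + ∑< T (λ c → u c * β c)

  module _ {T : ℕ} {β : ℕ → ℤ} where

    private
      Desc = Describable T β

    desc-mono : ∀ {Y Y′ v} → Y ℕ.≤ Y′ → Desc Y v → Desc Y′ v
    desc-mono p (describe w u w≤ u≤ eq) =
      describe w u (≤-trans w≤ p) (λ c → ≤-trans (u≤ c) p) eq

    desc-const : ∀ {Y} v → ∣ v ∣ ℕ.≤ Y → Desc Y v
    desc-const v v≤ = describe v (λ _ → 0ℤ) v≤ (λ _ → z≤n)
      (sym (trans (cong (λ s → v + s) (∑<-zero T _ λ c _ → ℤ.*-zeroˡ (β c))) (ℤ.+-identityʳ v)))

    desc-β : ∀ c → c ℕ.< T → Desc 1 (β c)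
    desc-β c c<T = describe 0ℤ (δ c) z≤n (∣δ∣≤1 c)
      (sym (trans (ℤ.+-identityˡ _) (∑<-δ T c β c<T)))

    -- Scaling, sums and differences are all instances of this one combination.
    desc-lin : ∀ {X Y K v v′} t → ∣ t ∣ ℕ.≤ K → Desc X v → Desc Y v′ → Desc (X ℕ.+ K ℕ.* Y) (v + t * v′)
    desc-lin {X} {Y} {K} {v} {v′} t t≤ (describe w u w≤ u≤ eq) (describe w′ u′ w′≤ u′≤ eq′) = describe
      (w + t * w′) (λ c → u c + t * u′ c)
      (bound w w′ w≤ w′≤) (λ c → bound (u c) (u′ c) (u≤ c) (u′≤ c))
      (trans (cong₂ (λ a b → a + t * b) eq eq′)
        (trans (rearrange w w′ t _ _)
        (cong (λ s → w + t * w′ + s) (trans (sym (∑<-lin T t _ _)) (∑<-cong T λ c _ → expand (u c) (u′ c) t (β c))))))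
      where
      bound : ∀ p q → ∣ p ∣ ℕ.≤ X → ∣ q ∣ ℕ.≤ Y → ∣ p + t * q ∣ ℕ.≤ X ℕ.+ K ℕ.* Y
      bound p q a b = ≤-trans (ℤ.∣i+j∣≤∣i∣+∣j∣ p _) (+-mono-≤ a (∣*∣≤ t q t≤ b))
      rearrange : ∀ w w′ t s s′ → w + s + t * (w′ + s′) ≡ w + t * w′ + (s + t * s′)
      rearrange = solve-∀
      expand : ∀ u u′ t b → u * b + t * (u′ * b) ≡ (u + t * u′) * b
      expand = solve-∀

    desc-scale : ∀ {Y K v} t → ∣ t ∣ ℕ.≤ K → Desc Y v → Desc (K ℕ.* Y) (t * v)
    desc-scale {v = v} t t≤ d = subst (Desc _) (ℤ.+-identityˡ _) (desc-lin t t≤ (desc-const 0ℤ z≤n) d)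

    desc-+ : ∀ {X Y v v′} → Desc X v → Desc Y v′ → Desc (X ℕ.+ Y) (v + v′)
    desc-+ {X} {Y} {v} {v′} d d′ = subst₂ (λ Z z → Desc (X ℕ.+ Z) (v + z)) (ℕ.*-identityˡ Y) (ℤ.*-identityˡ v′)
      (desc-lin 1ℤ ≤-refl d d′)

    desc-- : ∀ {X Y v v′} → Desc X v → Desc Y v′ → Desc (X ℕ.+ Y) (v - v′)
    desc-- {X} {Y} {v} {v′} d d′ = subst₂ (λ Z z → Desc (X ℕ.+ Z) (v + z)) (ℕ.*-identityˡ Y) (ℤ.-1*i≡-i v′)
      (desc-lin -[1+ 0 ] ≤-refl d d′)

    desc-sum : ∀ {Y k} (f : Vector ℤ k) → (∀ i → Desc Y (f i)) → Desc (k ℕ.* Y) (sum f)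
    desc-sum {k = zero}  f h = desc-const 0ℤ z≤n
    desc-sum {k = suc k} f h = desc-+ (h zero) (desc-sum (λ i → f (suc i)) (λ i → h (suc i)))

open Descriptions

-- The descent, which eliminates one direction at a time.

module Descent
  (T : ℕ) (β : ℕ → ℤ) {n m : ℕ} (α : ℕ)
  (Q : Matrix n n) (symmetric : ∀ i j → Q i j ≡ Q j i)
  (A : Matrix m n) (b : Vector ℤ m)
  (Q≤ : ∀ i j → ∣ Q i j ∣ ℕ.≤ α) (A≤ : ∀ i j → ∣ A i j ∣ ℕ.≤ α)
  -- The bound bᵢ need not be describable, since equal rows share a single value of β. It suffices
  -- that some describable v separates aᵢ x from bᵢ.
  (near : ∀ i x → (∀ i → dot (A i) x ℤ.≤ b i) →
          ∃[ v ] Describable T β 1 v × dot (A i) x ℤ.≤ v × v ℤ.≤ b i)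
  where
  open import Data.Integer.Base using (_+_; _*_; _-_; -_; _≤_; _<_)
  open Algebra.Properties.Semiring.Sum ℤ.+-*-semiring

  private
    Desc = Describable T β
    Feas : Vector ℤ n → Set
    Feas x = ∀ i → dot (A i) x ≤ b i
    obj : Vector ℤ n → ℤ
    obj x = form Q x x

  -- Up to the k coefficients z, the point x is given by bounded data and b.
  record State (Y k : ℕ) (x : Vector ℤ n) : Set where
    constructor state
    field
      D   : ℕ
      0<D : 0 ℕ.< D
      D≤  : D ℕ.≤ Y
      d   : Fin k → Vector ℤ n
      d≤  : ∀ t j → ∣ d t j ∣ ℕ.≤ Y
      z   : Fin k → ℤ
      e   : Vector ℤ n
      e≤  : ∀ j → Desc Y (e j)
      eq  : ∀ j → + D * x j ≡ sum (λ t → z t * d t j) + e j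

  -- In D (x + t y) the new term is t D y, so only the first coefficient changes. The directions
  -- remain definitionally the same, which is what keeps y the first direction during a walk.
  shift : ∀ {Y k x} (st : State Y (suc k) x) t → State Y (suc k) (move x t (State.d st zero))
  shift {x = x} (state D 0<D D≤ d d≤ z e e≤ eq) t = record
    { D = D ; 0<D = 0<D ; D≤ = D≤ ; d = d ; d≤ = d≤ ; e = e ; e≤ = e≤
    ; z  = λ { zero → z zero + t * + D ; (suc s) → z (suc s) }
    ; eq = λ j → trans (expand (+ D) (x j) t (d zero j)) (trans (cong (λ s → s + t * + D * d zero j) (eq j))
             (collect (z zero) (d zero j) (sum λ s → z (suc s) * d (suc s) j) (e j) (t * + D)))
    }
    where
    expand : ∀ D x t y → D * (x + t * y) ≡ D * x + t * D * y
    expand = solve-∀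
    collect : ∀ z y S e s → z * y + S + e + s * y ≡ (z + s) * y + S + e
    collect = solve-∀

  -- The sign of the first direction is free; it is chosen such that the walk starts with
  -- `form Q y x` ≤ 0.
  flip : ∀ {Y k x} (st : State Y (suc k) x) → State Y (suc k) x
  flip (state D 0<D D≤ d d≤ z e e≤ eq) = record
    { D = D ; 0<D = 0<D ; D≤ = D≤ ; e = e ; e≤ = e≤
    ; d  = λ { zero j → - d zero j ; (suc t) → d (suc t) }
    ; d≤ = λ { zero j → subst (ℕ._≤ _) (sym (ℤ.∣-i∣≡∣i∣ (d zero j))) (d≤ zero j) ; (suc t) → d≤ (suc t) }
    ; z  = λ { zero → - z zero ; (suc t) → z (suc t) }
    ; eq = λ j → trans (eq j) (cong (λ s → s + sum (λ t → z (suc t) * d (suc t) j) + e j) (neg (z zero) (d zero j)))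
    }
    where
    neg : ∀ z y → z * y ≡ - z * - y
    neg = solve-∀

  -- `tight`: the slack of row i is less than its growth per step. `critical`: the slope is within
  -- one step of changing sign. In both cases a linear form with small coefficients has an almost
  -- known value at x.
  data Stop (y x : Vector ℤ n) : Set where
    tight    : ∀ i → 0ℤ < dot (A i) y → b i < dot (A i) x + dot (A i) y → Stop y x
    critical : 0ℤ < form Q y y → - form Q y y ≤ form Q y x → form Q y x ≤ 0ℤ → Stop y x

  Improves : Vector ℤ n → (Vector ℤ n → Set) → Set
  Improves x P = ∃[ x′ ] Feas x′ × obj x′ ≤ obj x × P x′

  -- Along y the objective changes by 2 yQx + yQy ≤ 0 as long as yQx ≤ 0 and
  -- yQ(x + y) ≤ 0; the measure μ makes the walk end.
  walk : (P : Vector ℤ n → Set) (y : Vector ℤ n) (μ : Vector ℤ n → ℤ) →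
    (∀ x → P x → P (move x 1ℤ y)) → (∀ x → μ (move x 1ℤ y) < μ x) →
    (∀ x → Feas x → form Q y x ≤ 0ℤ → 0ℤ ≤ μ x) →
    ∀ fuel x → μ x ≤ + fuel → P x → Feas x → form Q y x ≤ 0ℤ →
    Improves x (λ x′ → P x′ × Stop y x′)
  walk P y μ Pmove μmove 0≤μ fuel x μ≤ px fx g≤0
    with Fin.all? (λ i → dot (A i) (move x 1ℤ y) ℤ.≤? b i)
  ... | no ¬f = x , fx , ℤ.≤-refl , px , stop (Fin.¬∀⟶∃¬ m _ (λ i → dot (A i) (move x 1ℤ y) ℤ.≤? b i) ¬f)
    where
    stop : ∃[ i ] ¬ dot (A i) (move x 1ℤ y) ≤ b i → Stop y x
    stop (i , ¬p) = tight i (<-by _ (gap< blocked ⊹ gap (fx i)) (e (dot (A i) x) (dot (A i) y) (b i))) blocked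
      where
      blocked : b i < dot (A i) x + dot (A i) y
      blocked = subst (λ s → b i < s) (trans (dot-move (A i) x 1ℤ y) (cong (λ s → dot (A i) x + s) (ℤ.*-identityˡ (dot (A i) y)))) (ℤ.≰⇒> ¬p)
      e : ∀ a h b → h - 0ℤ - 1ℤ ≡ (a + h - b - 1ℤ) + (b - a)
      e = solve-∀
  ... | yes f′ with form Q y x + form Q y y ℤ.≤? 0ℤ
  ...   | no g+q≰0 = x , fx , ℤ.≤-refl , px , critical
            (<-by _ (gap< 0<g+q ⊹ gap g≤0) (e₁ (form Q y x) (form Q y y)))
            (≤-by _ (gap (ℤ.<⇒≤ 0<g+q)) (e₂ (form Q y x) (form Q y y))) g≤0
    where
    0<g+q = ℤ.≰⇒> g+q≰0
    e₁ : ∀ g q → q - 0ℤ - 1ℤ ≡ (g + q - 0ℤ - 1ℤ) + (0ℤ - g)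
    e₁ = solve-∀
    e₂ : ∀ g q → g - - q ≡ g + q - 0ℤ
    e₂ = solve-∀
  ...   | yes g+q≤0 = continue fuel μ≤
    where
    x′ = move x 1ℤ y
    g′≤0 : form Q y x′ ≤ 0ℤ
    g′≤0 = subst (_≤ 0ℤ) (sym (trans (form-moveʳ Q y x 1ℤ y) (cong (λ s → form Q y x + s) (ℤ.*-identityˡ (form Q y y))))) g+q≤0
    improves : obj x′ ≤ obj x
    improves = ≤-by _ (gap g≤0 ⊹ gap g+q≤0) (trans (cong (λ s → obj x - s) (form-move Q symmetric x 1ℤ y)) (e (obj x) (form Q y x) (form Q y y)))
      where
      e : ∀ o g q → o - (o + (1ℤ * g + 1ℤ * g + 1ℤ * 1ℤ * q)) ≡ (0ℤ - g) + (0ℤ - (g + q))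
      e = solve-∀
    continue : ∀ fuel → μ x ≤ + fuel → Improves x (λ x′ → P x′ × Stop y x′)
    continue zero μ≤ = contradiction (ℤ.<-≤-trans (μmove x) μ≤) (ℤ.≤⇒≯ (0≤μ x′ f′ g′≤0))
    continue (suc fuel) μ≤ with walk P y μ Pmove μmove 0≤μ fuel x′ (≤-by _ (gap μ≤ ⊹ gap< (μmove x)) (e (μ x′) (μ x) (+ fuel))) (Pmove x px) f′ g′≤0
      where
      e : ∀ a b c → c - a ≡ (1ℤ + c - b) + (b - a - 1ℤ)
      e = solve-∀
    ... | x″ , fx″ , o , rest = x″ , fx″ , ℤ.≤-trans o improves , rest

  -- The objective falls without bound from x along y. Only y is bounded here; the base point x is
  -- still arbitrary.
  record Certificate (Y : ℕ) : Set where
    constructor certificate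
    field
      y x  : Vector ℤ n
      y≤   : ∀ j → ∣ y j ∣ ℕ.≤ Y
      feas : Feas x
      rec  : ∀ i → dot (A i) y ≤ 0ℤ
      yQy  : form Q y y ≤ 0ℤ
      yQx  : form Q y x < 0ℤ

  -- It pays for sums over n coordinates and for coefficients up to α: the rows used for elimination
  -- have entries at most `R`, and their products with directions are at most κ Y², called `G`
  -- below.
  κ : ℕ
  κ = suc n ℕ.* suc n ℕ.* suc α

  module _ {Y : ℕ} (4κ≤Y : 4 ℕ.* κ ℕ.≤ Y) where

    private
      G : ℕ
      G = κ ℕ.* (Y ℕ.* Y)
      R : ℕ
      R = suc n ℕ.* (suc α ℕ.* Y)

      instance
        Y≢0 : NonZero Y
        Y≢0 = >-nonZero (≤-trans (s≤s z≤n) 4κ≤Y)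

      n[RY]≤G : n ℕ.* (R ℕ.* Y) ℕ.≤ G
      n[RY]≤G = ≤-trans (*-monoˡ-≤ (R ℕ.* Y) (n≤1+n n)) (≤-reflexive (r (suc n) (suc α) Y))
        where
        r : ∀ N a Y → N ℕ.* (N ℕ.* (a ℕ.* Y) ℕ.* Y) ≡ N ℕ.* N ℕ.* a ℕ.* (Y ℕ.* Y)
        r = ℕ-Ring.solve-∀

      dot≤G : ∀ a x → (∀ j → ∣ a j ∣ ℕ.≤ R) → (∀ j → ∣ x j ∣ ℕ.≤ Y) → ∣ dot {n} a x ∣ ℕ.≤ G
      dot≤G a x p q = ≤-trans (∣dot∣≤ R Y a x p q) n[RY]≤G

      A≤R : ∀ i j → ∣ A i j ∣ ℕ.≤ R
      A≤R i j = ≤-trans (A≤ i j) (≤-trans (n≤1+n α) (≤-trans (m≤m*n (suc α) Y) (m≤n*m (suc α ℕ.* Y) (suc n))))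

      yQ≤R : ∀ y → (∀ j → ∣ y j ∣ ℕ.≤ Y) → ∀ j → ∣ (y *ₘ Q) j ∣ ℕ.≤ R
      yQ≤R y y≤ j = ≤-trans (∣dot∣≤ Y α y (λ i → Q i j) y≤ (λ i → Q≤ i j))
        (≤-trans (*-monoʳ-≤ n (≤-trans (≤-reflexive (ℕ.*-comm Y α)) (*-monoˡ-≤ Y (n≤1+n α))))
          (*-monoˡ-≤ (suc α ℕ.* Y) (n≤1+n n)))

      Y⁴ : ℕ
      Y⁴ = κ ℕ.* (Y ℕ.* Y ℕ.* (Y ℕ.* Y))

      4Y⁴≤ : 4 ℕ.* Y⁴ ℕ.≤ Y ℕ.^ 5
      4Y⁴≤ = ≤-trans (≤-reflexive (sym (ℕ.*-assoc 4 κ _)))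
        (≤-trans (*-monoˡ-≤ (Y ℕ.* Y ℕ.* (Y ℕ.* Y)) 4κ≤Y) (≤-reflexive (r Y)))
        where
        r : ∀ Y → Y ℕ.* (Y ℕ.* Y ℕ.* (Y ℕ.* Y)) ≡ Y ℕ.* (Y ℕ.* (Y ℕ.* (Y ℕ.* (Y ℕ.* 1))))
        r = ℕ-Ring.solve-∀

      Y²≤ : Y ℕ.* Y ℕ.≤ Y⁴
      Y²≤ = ≤-trans (m≤m*n (Y ℕ.* Y) (Y ℕ.* Y) ⦃ ℕ.m*n≢0 Y Y ⦄) (m≤n*m _ κ)

      GY≤ : G ℕ.* Y ℕ.≤ Y⁴
      GY≤ = ≤-trans (m≤m*n (G ℕ.* Y) Y) (≤-reflexive (r κ Y))
        where
        r : ∀ g Y → g ℕ.* (Y ℕ.* Y) ℕ.* Y ℕ.* Y ≡ g ℕ.* (Y ℕ.* Y ℕ.* (Y ℕ.* Y))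
        r = ℕ-Ring.solve-∀

      GY+GY≤ : G ℕ.* Y ℕ.+ G ℕ.* Y ℕ.≤ Y ℕ.^ 5
      GY+GY≤ = ≤-trans (+-mono-≤ GY≤ (≤-trans GY≤ (m≤m+n Y⁴ _))) 4Y⁴≤

      Y+YY≤ : Y ℕ.+ Y ℕ.* Y ℕ.≤ Y ℕ.^ 5
      Y+YY≤ = ≤-trans (+-mono-≤ (≤-trans (m≤m*n Y Y) Y²≤) (≤-trans Y²≤ (m≤m+n Y⁴ _))) 4Y⁴≤

      -- This is the bound that `eliminate` obtains for the new `e`; it is the largest of the new
      -- bounds and dictates the exponent 5.
      e≤Y⁵ : G ℕ.* Y ℕ.+ Y ℕ.* (Y ℕ.* suc G ℕ.+ G) ℕ.≤ Y ℕ.^ 5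
      e≤Y⁵ = ≤-trans (≤-trans (≤-reflexive (r κ Y))
        (+-mono-≤ (+-mono-≤ (+-mono-≤ GY≤ Y²≤) GY≤) ≤-refl)) (≤-trans (≤-reflexive (r′ Y⁴)) 4Y⁴≤)
        where
        r : ∀ g Y → g ℕ.* (Y ℕ.* Y) ℕ.* Y ℕ.+ Y ℕ.* (Y ℕ.* (1 ℕ.+ g ℕ.* (Y ℕ.* Y)) ℕ.+ g ℕ.* (Y ℕ.* Y)) ≡
          g ℕ.* (Y ℕ.* Y) ℕ.* Y ℕ.+ Y ℕ.* Y ℕ.+ g ℕ.* (Y ℕ.* Y) ℕ.* Y ℕ.+ g ℕ.* (Y ℕ.* Y ℕ.* (Y ℕ.* Y))
        r = ℕ-Ring.solve-∀
        r′ : ∀ y → y ℕ.+ y ℕ.+ y ℕ.+ y ≡ 4 ℕ.* y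
        r′ = ℕ-Ring.solve-∀

    -- Applying the row to D x = z₀ y + Σ zₜ dₜ + e gives D v = z₀ h + Σ zₜ cₜ + row · e, with v, h
    -- and cₜ the values of the row at x, y and dₜ. Multiplying the relation by h and substituting
    -- z₀ h removes z₀: each dₜ becomes h dₜ - cₜ y, and h e + y (D v - row · e) is left over.
    eliminate : ∀ {k x} (st : State Y (suc k) x) (let open State st) (row : Vector ℤ n) →
      (∀ j → ∣ row j ∣ ℕ.≤ R) → 0ℤ < dot row (d zero) → Desc (suc G) (dot row x) →
      State (Y ℕ.^ 5) k x
    eliminate {k} {x} (state D 0<D D≤ d d≤ z e e≤ eq) row row≤ 0<h v≤ = record
      { D   = ∣ h ∣ ℕ.* D
      ; 0<D = ℕ.*-mono-< {0} {∣ h ∣} {0} {D} (0<∣∣ 0<h) 0<D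
      ; D≤  = ≤-trans (ℕ.*-mono-≤ h≤ D≤) (≤-trans (m≤m+n (G ℕ.* Y) _) GY+GY≤)
      ; d   = λ t j → h * d (suc t) j + - y j * c t
      ; d≤  = λ t j → ≤-trans (ℤ.∣i+j∣≤∣i∣+∣j∣ (h * d (suc t) j) _)
                (≤-trans (+-mono-≤ (∣*∣≤ h (d (suc t) j) h≤ (d≤ (suc t) j))
                  (≤-trans (∣*∣≤ (- y j) (c t) (subst (ℕ._≤ Y) (sym (ℤ.∣-i∣≡∣i∣ (y j))) (d≤ zero j)) (dot≤G row (d (suc t)) row≤ (d≤ (suc t))))
                    (≤-reflexive (ℕ.*-comm Y G)))) GY+GY≤)
      ; z   = λ t → z (suc t)
      ; e   = λ j → h * e j + y j * (+ D * v - dot row e)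
      ; e≤  = λ j → desc-mono e≤Y⁵ (desc-+ (desc-scale h h≤ (e≤ j)) (desc-scale (y j) (d≤ zero j)
                (desc-- (desc-scale (+ D) D≤ v≤)
                  (desc-mono n[RY]≤G (desc-sum (λ i → row i * e i) λ i → desc-scale (row i) (row≤ i) (e≤ i))))))
      ; eq  = λ j → final j
      }
      where
      y = d zero
      h = dot row y
      v = dot row x
      h≤ = dot≤G row y row≤ (d≤ zero)
      c : Fin k → ℤ
      c t = dot row (d (suc t))
      S : Vector ℤ n
      S j = sum λ t → z (suc t) * d (suc t) j
      C = sum λ t → z (suc t) * c t
      dotS : dot row S ≡ C
      dotS = trans (sum-cong-≗ λ j → *-distribˡ-sum (row j) (λ t → z (suc t) * d (suc t) j))
        (trans (∑-comm (λ j t → row j * (z (suc t) * d (suc t) j)))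
          (sum-cong-≗ λ t → trans (sum-cong-≗ λ j → swap (row j) (z (suc t)) (d (suc t) j))
            (sym (*-distribˡ-sum (z (suc t)) (λ j → row j * d (suc t) j)))))
        where
        swap : ∀ r z d → r * (z * d) ≡ z * (r * d)
        swap = solve-∀
      Dv : + D * v ≡ z zero * h + C + dot row e
      Dv = trans (*-distribˡ-sum (+ D) (λ j → row j * x j))
        (trans (sum-cong-≗ λ j → trans (swap (+ D) (row j) (x j)) (trans (cong (λ s → row j * s) (eq j)) (expand (row j) (z zero) (y j) (S j) (e j))))
        (trans (sum-lin (z zero) (λ j → row j * S j + row j * e j) (λ j → row j * y j))
          (trans (cong (λ s → s + z zero * h) (trans (∑-distrib-+ (λ j → row j * S j) (λ j → row j * e j)) (cong (λ s → s + dot row e) dotS)))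
          (rot C (dot row e) (z zero * h)))))
        where
        swap : ∀ D r x → D * (r * x) ≡ r * (D * x)
        swap = solve-∀
        expand : ∀ r z y S e → r * (z * y + S + e) ≡ r * S + r * e + z * (r * y)
        expand = solve-∀
        rot : ∀ a b c → a + b + c ≡ c + a + b
        rot = solve-∀
      final : ∀ j → + (∣ h ∣ ℕ.* D) * x j ≡
        sum (λ t → z (suc t) * (h * d (suc t) j + - y j * c t)) + (h * e j + y j * (+ D * v - dot row e))
      final j = trans (cong (λ s → s * x j) (trans (ℤ.pos-* ∣ h ∣ D) (cong (λ s → s * + D) (ℤ.0≤i⇒+∣i∣≡i (ℤ.<⇒≤ 0<h)))))
        (trans (ℤ.*-assoc h (+ D) (x j)) (trans (cong (λ s → h * s) (eq j))
        (sym (trans (cong₂ (λ s s′ → s + (h * e j + y j * (s′ - dot row e))) lhs Dv)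
          (collect h (S j) (y j) C (e j) (z zero) (dot row e))))))
        where
        lhs : sum (λ t → z (suc t) * (h * d (suc t) j + - y j * c t)) ≡ h * S j + - y j * C
        lhs = trans (sum-cong-≗ λ t → expand (z (suc t)) h (d (suc t) j) (y j) (c t))
          (trans (sum-lin (- y j) (λ t → h * (z (suc t) * d (suc t) j)) (λ t → z (suc t) * c t))
            (cong (λ s → s + - y j * C) (sym (*-distribˡ-sum h (λ t → z (suc t) * d (suc t) j)))))
          where
          expand : ∀ z h d y c → z * (h * d + - y * c) ≡ h * (z * d) + - y * (z * c)
          expand = solve-∀
        collect : ∀ h S y C e z r → h * S + - y * C + (h * e + y * (z * h + C + r - r)) ≡ h * (z * y + S + e)
        collect = solve-∀

    -- A coefficient between 0 and D is itself small, so z₀ y can be moved into `e`.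
    absorb : ∀ {k x} (st : State Y (suc k) x) (let open State st) → 0ℤ ≤ z zero → z zero ≤ + D →
      State (Y ℕ.^ 5) k x
    absorb {k} {x} (state D 0<D D≤ d d≤ z e e≤ eq) 0≤z z≤D = record
      { D   = D
      ; 0<D = 0<D
      ; D≤  = ≤-trans D≤ Y≤
      ; d   = λ t → d (suc t)
      ; d≤  = λ t j → ≤-trans (d≤ (suc t) j) Y≤
      ; z   = λ t → z (suc t)
      ; e   = λ j → e j + z zero * d zero j
      ; e≤  = λ j → desc-mono Y+YY≤ (desc-+ (e≤ j) (desc-const (z zero * d zero j) (∣*∣≤ (z zero) (d zero j) (∣∣≤ 0≤z (ℤ.≤-trans z≤D (ℤ.+≤+ D≤))) (d≤ zero j))))
      ; eq  = λ j → trans (eq j) (rot (z zero * d zero j) (sum λ t → z (suc t) * d (suc t) j) (e j))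
      }
      where
      Y≤ = ≤-trans (m≤m+n Y _) Y+YY≤
      rot : ∀ a b c → a + b + c ≡ b + (c + a)
      rot = solve-∀

    private
      Along : ℕ → Vector ℤ n → Vector ℤ n → Set
      Along k y x = ∃[ st ] State.d {Y} {suc k} {x} st zero ≡ y

      along-shift : ∀ {k y} x t → Along k y x → Along k y (move x t y)
      along-shift x t (st , refl) = shift st t , refl

      -- At a tight row the v of `near` satisfies 0 ≤ v - aᵢ x ≤ aᵢ y, so aᵢ x is v minus a small
      -- constant. At a critical point yQx is itself small, and `y *ₘ Q` serves as the row.
      finish : ∀ {k y x} → Feas x → Along k y x → Stop y x → State (Y ℕ.^ 5) k x
      finish {x = x} fx (st , refl) (tight i 0<h blocked) with near i x fx
      ... | v , dv , ax≤v , v≤b = eliminate st (A i) (A≤R i) 0<h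
        (subst (Desc (suc G)) (e v (dot (A i) x)) (desc-- dv (desc-const (v - dot (A i) x)
          (≤-trans (∣∣≤ (gap ax≤v) (ℤ.≤-trans (≤-by _ (gap v≤b ⊹ gap (ℤ.<⇒≤ blocked)) (e′ v (dot (A i) x) (b i) (dot (A i) y)))
            (ℤ.≤-reflexive (sym (ℤ.0≤i⇒+∣i∣≡i (ℤ.<⇒≤ 0<h)))))) (dot≤G (A i) y (A≤R i) (State.d≤ st zero))))))
        where
        y = State.d st zero
        e : ∀ v a → v - (v - a) ≡ a
        e = solve-∀
        e′ : ∀ v a b h → h - (v - a) ≡ (b - v) + (a + h - b)
        e′ = solve-∀
      finish {x = x} fx (st , refl) (critical 0<q lo hi) = eliminate st (y *ₘ Q) (yQ≤R y (State.d≤ st zero))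
        (subst (0ℤ <_) (form-dot Q y y) 0<q)
        (desc-const _ (≤-trans (subst (λ g → ∣ g ∣ ℕ.≤ ∣ form Q y y ∣) (form-dot Q y x)
            (-∣∣ (subst (λ s → - s ≤ form Q y x) (sym (ℤ.0≤i⇒+∣i∣≡i (ℤ.<⇒≤ 0<q))) lo) (ℤ.≤-trans hi (ℤ.+≤+ z≤n))))
          (ℕ.m≤n⇒m≤1+n (subst (λ s → ∣ s ∣ ℕ.≤ G) (sym (form-dot Q y y)) (dot≤G (y *ₘ Q) y (yQ≤R y (State.d≤ st zero)) (State.d≤ st zero))))))
        where
        y = State.d st zero

      walk-finish : ∀ {k} y (μ : Vector ℤ n → ℤ) → (∀ x → μ (move x 1ℤ y) < μ x) →
        (∀ x → Feas x → form Q y x ≤ 0ℤ → 0ℤ ≤ μ x) →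
        ∀ x → Along k y x → Feas x → form Q y x ≤ 0ℤ → Improves x (State (Y ℕ.^ 5) k)
      walk-finish y μ μmove 0≤μ x al fx g≤0
        with walk (Along _ y) y μ (λ x → along-shift x 1ℤ) μmove 0≤μ ∣ μ x ∣ x (ℤ.≤-reflexive (sym (ℤ.0≤i⇒+∣i∣≡i (0≤μ x fx g≤0)))) al fx g≤0
      ... | x′ , fx′ , o , al′ , s = x′ , fx′ , o , finish fx′ al′ s

      -- A row that grows along y limits the walk, with its slack as the measure. The walk may well
      -- stop earlier for another reason, which serves equally.
      walk-to-row : ∀ {k} y i → 0ℤ < dot (A i) y →
        ∀ x → Along k y x → Feas x → form Q y x ≤ 0ℤ → Improves x (State (Y ℕ.^ 5) k)
      walk-to-row y i 0<h = walk-finish y (λ x → b i - dot (A i) x)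
        (λ x → <-by _ (gap< 0<h) (trans (cong (λ s → b i - dot (A i) x - (b i - s) - 1ℤ) (dot-move (A i) x 1ℤ y)) (e (b i) (dot (A i) x) (dot (A i) y))))
        (λ x fx _ → gap (fx i))
        where
        e : ∀ b a h → b - a - (b - (a + 1ℤ * h)) - 1ℤ ≡ h - 0ℤ - 1ℤ
        e = solve-∀

      -- Each step raises the slope yQx by yQy > 0, so minus the slope is a measure.
      walk-to-minimum : ∀ {k} y → 0ℤ < form Q y y →
        ∀ x → Along k y x → Feas x → form Q y x ≤ 0ℤ → Improves x (State (Y ℕ.^ 5) k)
      walk-to-minimum y 0<q = walk-finish y (λ x → - form Q y x)
        (λ x → <-by _ (gap< 0<q) (trans (cong (λ s → - form Q y x - (- s) - 1ℤ) (form-moveʳ Q y x 1ℤ y)) (e (form Q y x) (form Q y y))))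
        (λ x _ g≤0 → ℤ.neg-mono-≤ g≤0)
        where
        e : ∀ g q → - g - - (g + 1ℤ * q) - 1ℤ ≡ q - 0ℤ - 1ℤ
        e = solve-∀

      blocking? : ∀ y → (∃[ i ] 0ℤ < dot (A i) y) ⊎ (∀ i → dot (A i) y ≤ 0ℤ)
      blocking? y with Fin.any? (λ i → 0ℤ ℤ.<? dot (A i) y)
      ... | yes p = inj₁ p
      ... | no ¬p = inj₂ λ i → ℤ.≮⇒≥ λ q → ¬p (i , q)

      -- Every multiple of y can be added without touching a row or the objective; the one chosen
      -- replaces z₀ by its remainder modulo D.
      free : ∀ {k y x} → Along k y x → Feas x → (∀ i → dot (A i) y ≡ 0ℤ) → form Q y x ≡ 0ℤ → form Q y y ≡ 0ℤ →
        Improves x (State (Y ℕ.^ 5) k)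
      free {k} {_} {x} (st@(state D@(suc _) _ _ d _ z _ _ _) , refl) fx Ay≡0 g≡0 q≡0 = move x t y ,
        (λ i → ℤ.≤-trans (ℤ.≤-reflexive (trans (dot-move (A i) x t y) (trans (cong (λ s → dot (A i) x + t * s) (Ay≡0 i)) (e (dot (A i) x) t)))) (fx i)) ,
        ℤ.≤-reflexive (trans (form-move Q symmetric x t y) (trans (cong₂ (λ g q → obj x + (t * g + t * g + t * t * q)) g≡0 q≡0) (e′ (obj x) t))) ,
        absorb (shift st t)
          (subst (0ℤ ≤_) (sym rem) (ℤ.+≤+ z≤n))
          (subst (_≤ + D) (sym rem) (ℤ.+≤+ (<⇒≤ (ℤ.n%ℕd<d (z zero) D))))
        where
        y = d zero
        t = - (z zero ℤ./ℕ D)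
        rem : z zero + t * + D ≡ + (z zero ℤ.%ℕ D)
        rem = trans (cong (λ s → s + t * + D) (ℤ.a≡a%ℕn+[a/ℕn]*n (z zero) D)) (e″ (+ (z zero ℤ.%ℕ D)) (z zero ℤ./ℕ D) (+ D))
          where
          e″ : ∀ r q D → r + q * D + - q * D ≡ r
          e″ = solve-∀
        e : ∀ a t → a + t * 0ℤ ≡ a
        e = solve-∀
        e′ : ∀ o t → o + (t * 0ℤ + t * 0ℤ + t * t * 0ℤ) ≡ o
        e′ = solve-∀

      -- If no row grows along y, the sign of yQy decides: positive curvature ends the walk,
      -- negative curvature yields a ray, and with zero curvature the slope yQx is examined.
      step-descending : ∀ {k x} (st : State Y (suc k) x) → Feas x → form Q (State.d st zero) x ≤ 0ℤ →
        Improves x (State (Y ℕ.^ 5) k) ⊎ Certificate Y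
      step-descending {k} {x} st fx g≤0 with blocking? (State.d st zero)
      ... | inj₁ (i , 0<h) = inj₁ (walk-to-row _ i 0<h x (st , refl) fx g≤0)
      ... | inj₂ Ay≤0 with ℤ.<-cmp (form Q (State.d st zero) (State.d st zero)) 0ℤ
      ...   | tri> _ _ 0<q = inj₁ (walk-to-minimum _ 0<q x (st , refl) fx g≤0)
      -- The slope may vanish at x, but one step further it is yQx + yQy < 0; hence the base point x
      -- + y.
      ...   | tri< q<0 _ _ = inj₂ (certificate y (move x 1ℤ y) (State.d≤ st zero)
                (λ i → ≤-by _ (gap (fx i) ⊹ gap (Ay≤0 i)) (trans (cong (λ s → b i - s) (dot-move (A i) x 1ℤ y)) (e (b i) (dot (A i) x) (dot (A i) y))))
                Ay≤0 (ℤ.<⇒≤ q<0)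
                (<-by _ (gap g≤0 ⊹ gap< q<0) (trans (cong (λ s → 0ℤ - s - 1ℤ) (form-moveʳ Q y x 1ℤ y)) (e′ (form Q y x) (form Q y y)))))
        where
        y = State.d st zero
        e : ∀ b a h → b - (a + 1ℤ * h) ≡ (b - a) + (0ℤ - h)
        e = solve-∀
        e′ : ∀ g q → 0ℤ - (g + 1ℤ * q) - 1ℤ ≡ (0ℤ - g) + (0ℤ - q - 1ℤ)
        e′ = solve-∀
      ...   | tri≈ _ q≡0 _ with ℤ.<-cmp (form Q (State.d st zero) x) 0ℤ
      ...     | tri> g≮0 g≢0 _ = contradiction (ℤ.≤∧≢⇒< g≤0 g≢0) g≮0
      ...     | tri< g<0 _ _ = inj₂ (certificate _ x (State.d≤ st zero) fx Ay≤0 (ℤ.≤-reflexive q≡0) g<0)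
      -- Slope and curvature both vanish, so the objective is constant along y and walking along -y
      -- is permitted as well.
      ...     | tri≈ _ g≡0 _ with blocking? (λ j → - State.d st zero j)
      ...       | inj₁ (i , 0<h) = inj₁ (walk-to-row _ i 0<h x (flip st , refl) fx
                    (ℤ.≤-reflexive (trans (form-negˡ Q symmetric (State.d st zero) x) (cong -_ g≡0))))
      ...       | inj₂ -Ay≤0 = inj₁ (free (st , refl) fx
                    (λ i → ℤ.≤-antisym (Ay≤0 i) (≤-by _ (gap (-Ay≤0 i)) (trans (e (dot (A i) y)) (cong (λ s → 0ℤ - s) (sym (dot-neg (A i) y))))))
                    g≡0 q≡0)
        where
        y = State.d st zero
        e : ∀ h → h - 0ℤ ≡ 0ℤ - - h
        e = solve-∀

    step : ∀ {k x} → State Y (suc k) x → Feas x → Improves x (State (Y ℕ.^ 5) k) ⊎ Certificate Y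
    step {x = x} st fx with form Q (State.d st zero) x ℤ.≤? 0ℤ
    ... | yes g≤0 = step-descending st fx g≤0
    ... | no  g≰0 = step-descending (flip st) fx
      (subst (_≤ 0ℤ) (sym (form-negˡ Q symmetric (State.d st zero) x)) (ℤ.neg-mono-≤ (ℤ.<⇒≤ (ℤ.≰⇒> g≰0))))

  bound : ℕ → ℕ → ℕ
  bound k Y = Y ℕ.^ (5 ℕ.^ k)

  private
    4κ≤⇒1≤ : ∀ {Y} → 4 ℕ.* κ ℕ.≤ Y → 1 ℕ.≤ Y
    4κ≤⇒1≤ = ≤-trans (s≤s z≤n)

    1≤5^ : ∀ k → 1 ℕ.≤ 5 ℕ.^ k
    1≤5^ k = ℕ.m^n>0 5 k

    Y≤bound : ∀ {Y} k → 1 ℕ.≤ Y → Y ℕ.≤ bound k Y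
    Y≤bound {Y@(suc _)} k _ = subst (ℕ._≤ bound k Y) (ℕ.^-identityʳ Y) (^-monoʳ-≤ Y (1≤5^ k))

    bound-suc : ∀ k Y → bound k (Y ℕ.^ 5) ≡ bound (suc k) Y
    bound-suc k Y = ℕ.^-*-assoc Y 5 (5 ℕ.^ k)

  descend : ∀ k {Y x} → 4 ℕ.* κ ℕ.≤ Y → State Y k x → Feas x →
    Improves x (State (bound k Y) 0) ⊎ Certificate (bound k Y)
  descend zero {Y} {x} p st fx = inj₁ (x , fx , ℤ.≤-refl , subst (λ B → State B 0 x) (sym (ℕ.*-identityʳ Y)) st)
  descend (suc k) {Y} {x} p st fx with step p st fx
  ... | inj₂ (certificate y x y≤ f r q g) = inj₂ (certificate y x (λ j → ≤-trans (y≤ j) (Y≤bound (suc k) (4κ≤⇒1≤ p))) f r q g)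
  ... | inj₁ (x′ , fx′ , o , st′) with descend k (≤-trans p (Y≤bound 1 (4κ≤⇒1≤ p))) st′ fx′
  ...   | inj₁ (x″ , fx″ , o′ , st″) = inj₁ (x″ , fx″ , ℤ.≤-trans o′ o , subst (λ B → State B 0 x″) (bound-suc k Y) st″)
  ...   | inj₂ c = inj₂ (subst Certificate (bound-suc k Y) c)

  start : ∀ {Y} x → 1 ℕ.≤ Y → State Y n x
  start {Y} x 1≤Y = record
    { D   = 1
    ; 0<D = ≤-refl
    ; D≤  = 1≤Y
    ; d   = λ t j → δ (toℕ j) (toℕ t)
    ; d≤  = λ t j → ≤-trans (∣δ∣≤1 (toℕ j) (toℕ t)) 1≤Y
    ; z   = x
    ; e   = λ _ → 0ℤ
    ; e≤  = λ _ → desc-const 0ℤ z≤n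
    ; eq  = λ j → trans (ℤ.*-identityˡ (x j)) (trans (sym (pick x j)) (sym (ℤ.+-identityʳ _)))
    }
    where
    pick : ∀ {k} (x : Vector ℤ k) j → sum (λ t → x t * δ (toℕ j) (toℕ t)) ≡ x j
    pick {suc k} x zero = trans (cong₂ _+_ (ℤ.*-identityʳ (x zero)) (trans (sum-cong-≗ λ t → ℤ.*-zeroʳ (x (suc t))) (sum-replicate-zero k))) (ℤ.+-identityʳ _)
    pick {suc k} x (suc j) = trans (cong₂ _+_ (ℤ.*-zeroʳ (x zero)) (trans (sum-cong-≗ λ t → cong (λ s → x (suc t) * s) (δ-suc (toℕ j) (toℕ t))) (pick (λ t → x (suc t)) j))) (ℤ.+-identityˡ _)
      where
      δ-suc : ∀ c i → δ (suc c) (suc i) ≡ δ c i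
      δ-suc c i with i ℕ.≟ c
      ... | yes refl = δ-diag (suc c)
      ... | no ¬p    = δ-off (suc c) (suc i) (λ q → ¬p (ℕ.suc-injective q))

  descent : ∀ {Y} → 4 ℕ.* κ ℕ.≤ Y → ∀ x → Feas x →
    Improves x (State (bound n Y) 0) ⊎ Certificate (bound n Y)
  descent p x fx = descend n p (start x (4κ≤⇒1≤ p)) fx

-- Every feasible point is matched by a candidate or yields a ray.

module Completeness where
  open import Data.Integer.Base using (_+_; _*_; _-_; -_; _≤_; _<_)
  open Algebra.Properties.Semiring.Sum ℤ.+-*-semiring

  record Candidate (T : ℕ) (β : ℕ → ℤ) (Y : ℕ) {n : ℕ} (x : Vector ℤ n) : Set where
    constructor candidate
    field
      D   : ℕ
      0<D : 0 ℕ.< D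
      D≤  : D ℕ.≤ Y
      e   : ∀ j → Describable T β Y (+ D * x j)

  module _ (I : Instance) (T : ℕ) (β : ℕ → ℤ) (α M : ℕ) where
    open Instance I

    -- The first descent starts at M and ends at `Z₁`. The second has a row yQ with entries of the
    -- order of `Z₁`, so it starts at `Z₁ ^ 5` to make room for its larger κ.
    κ₀ Z₁ Z₂ : ℕ
    κ₀ = suc n ℕ.* suc n ℕ.* suc α
    Z₁ = M ℕ.^ (5 ℕ.^ n)
    Z₂ = (Z₁ ℕ.^ 5) ℕ.^ (5 ℕ.^ n)

    record Ray (Y : ℕ) (y x : Vector ℤ n) : Set where
      constructor ray
      field
        y≤   : ∀ j → ∣ y j ∣ ℕ.≤ Y
        rec  : ∀ i → dot (A i) y ≤ 0ℤ
        yQy  : form Q y y ≤ 0ℤ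
        yQx  : form Q y x < 0ℤ

    module _ (κ≤M : 4 ℕ.* κ₀ ℕ.≤ M) (Q≤ : ∀ i j → ∣ Q i j ∣ ℕ.≤ α) (A≤ : ∀ i j → ∣ A i j ∣ ℕ.≤ α)
      (near : ∀ i x → Feasible I x → ∃[ v ] Describable T β 1 v × dot (A i) x ≤ v × v ≤ b i)
      where

      private
        module Main = Descent T β α Q symmetric A b Q≤ A≤ near

        instance
          M≢0 : NonZero M
          M≢0 = >-nonZero (≤-trans (s≤s z≤n) κ≤M)

        κ≤Z₁ : 4 ℕ.* κ₀ ℕ.≤ Z₁
        κ≤Z₁ = ≤-trans κ≤M (subst (ℕ._≤ Z₁) (ℕ.^-identityʳ M) (^-monoʳ-≤ M (ℕ.m^n>0 5 n)))

        α₂ κ₂ : ℕ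
        α₂ = suc n ℕ.* (suc α ℕ.* Z₁)
        κ₂ = suc n ℕ.* suc n ℕ.* suc α₂

        instance
          Z₁≢0 : NonZero Z₁
          Z₁≢0 = ℕ.m^n≢0 M (5 ℕ.^ n)

        α≤α₂ : α ℕ.≤ α₂
        α≤α₂ = ≤-trans (n≤1+n α) (≤-trans (m≤m*n (suc α) Z₁) (m≤n*m (suc α ℕ.* Z₁) (suc n)))

        -- With N = n + 1 the new coefficient bound is N (α + 1) Z₁, so 4 κ₂ ≤ 4 κ₀ · 2 N · Z₁ ≤
        -- Z₁³.
        κ₂≤ : 4 ℕ.* κ₂ ℕ.≤ Z₁ ℕ.^ 5
        κ₂≤ = ≤-trans (*-monoʳ-≤ 4 (*-monoʳ-≤ (suc n ℕ.* suc n)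
            (≤-trans (+-monoˡ-≤ α₂ (ℕ.>-nonZero⁻¹ α₂ ⦃ ℕ.m*n≢0 (suc n) _ ⦃ _ ⦄ ⦃ ℕ.m*n≢0 (suc α) Z₁ ⦄ ⦄)) (≤-reflexive (r₁ α₂)))))
          (≤-trans (≤-reflexive (r₂ (suc n) (suc α) Z₁))
          (≤-trans (*-monoˡ-≤ Z₁ (ℕ.*-mono-≤ κ≤Z₁ (≤-trans 2N≤ κ≤Z₁)))
            (≤-trans (m≤m*n _ (Z₁ ℕ.* Z₁) ⦃ ℕ.m*n≢0 Z₁ Z₁ ⦄) (≤-reflexive (r₃ Z₁)))))
          where
          r₁ : ∀ a → a ℕ.+ a ≡ 2 ℕ.* a
          r₁ = ℕ-Ring.solve-∀
          r₂ : ∀ N a Z → 4 ℕ.* (N ℕ.* N ℕ.* (2 ℕ.* (N ℕ.* (a ℕ.* Z)))) ≡ 4 ℕ.* (N ℕ.* N ℕ.* a) ℕ.* (2 ℕ.* N) ℕ.* Z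
          r₂ = ℕ-Ring.solve-∀
          r₃ : ∀ Z → Z ℕ.* Z ℕ.* Z ℕ.* (Z ℕ.* Z) ≡ Z ℕ.* (Z ℕ.* (Z ℕ.* (Z ℕ.* (Z ℕ.* 1))))
          r₃ = ℕ-Ring.solve-∀
          2N≤ : 2 ℕ.* suc n ℕ.≤ 4 ℕ.* κ₀
          2N≤ = ℕ.*-mono-≤ {2} {4} (s≤s (s≤s z≤n))
            (≤-trans (m≤m*n (suc n) (suc n)) (m≤m*n (suc n ℕ.* suc n) (suc α)))

        Z₁≤Z₂ : Z₁ ℕ.≤ Z₂
        Z₁≤Z₂ = ≤-trans (subst (ℕ._≤ Z₁ ℕ.^ 5) (ℕ.^-identityʳ Z₁) (^-monoʳ-≤ Z₁ {1} {5} (s≤s z≤n)))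
          (subst (ℕ._≤ Z₂) (ℕ.^-identityʳ (Z₁ ℕ.^ 5)) (^-monoʳ-≤ (Z₁ ℕ.^ 5) ⦃ ℕ.m^n≢0 Z₁ 5 ⦄ (ℕ.m^n>0 5 n)))

        form-zero : ∀ {n} (y x : Vector ℤ n) → form (λ _ _ → 0ℤ) y x ≡ 0ℤ
        form-zero {n} y x = trans (sum-cong-≗ λ i → trans (sum-cong-≗ λ j → e (y i) (x j)) (sum-replicate-zero n)) (sum-replicate-zero n)
          where
          e : ∀ a b → a * 0ℤ * b ≡ 0ℤ
          e = solve-∀

      -- A certificate is turned into one whose base point is a candidate by
      -- looking for a feasible point of the system extended by yQx ≤ -1.
      module _ (y : Vector ℤ n) (y≤ : ∀ j → ∣ y j ∣ ℕ.≤ Z₁) where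
        private
          A′ : Matrix (suc m) n
          A′ zero    = y *ₘ Q
          A′ (suc i) = A i

          b′ : Vector ℤ (suc m)
          b′ zero    = -[1+ 0 ]
          b′ (suc i) = b i

          A′≤ : ∀ i j → ∣ A′ i j ∣ ℕ.≤ α₂
          A′≤ zero j = ≤-trans (∣dot∣≤ Z₁ α y (λ i → Q i j) y≤ (λ i → Q≤ i j))
            (ℕ.*-mono-≤ (n≤1+n n) (≤-trans (≤-reflexive (ℕ.*-comm Z₁ α)) (*-monoˡ-≤ Z₁ (n≤1+n α))))
          A′≤ (suc i) j = ≤-trans (A≤ i j) α≤α₂

          near′ : ∀ i x → (∀ i → dot (A′ i) x ≤ b′ i) →
            ∃[ v ] Describable T β 1 v × dot (A′ i) x ≤ v × v ≤ b′ i
          near′ zero    x fx = -[1+ 0 ] , desc-const -[1+ 0 ] ≤-refl , fx zero , ℤ.≤-refl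
          near′ (suc i) x fx = near i x (λ i → fx (suc i))

          -- With the zero form as objective the descent merely seeks a feasible point of candidate
          -- form, and no certificate can occur, since it would need a negative value of the form.
          module Extended = Descent T β α₂ (λ _ _ → 0ℤ) (λ _ _ → refl) A′ b′ (λ _ _ → z≤n) A′≤ near′

        candidate-below : ∀ x → Feasible I x → form Q y x < 0ℤ →
          ∃[ x′ ] Feasible I x′ × form Q y x′ < 0ℤ × Candidate T β Z₂ x′
        candidate-below x fx g<0 = convert (Extended.descent κ₂≤ x feas′)
          where
          feas′ : ∀ i → dot (A′ i) x ≤ b′ i
          feas′ zero    = subst (_≤ -[1+ 0 ]) (form-dot Q y x) (≤-by _ (gap< g<0) (e (form Q y x)))
            where
            e : ∀ g → -[1+ 0 ] - g ≡ 0ℤ - g - 1ℤ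
            e = solve-∀
          feas′ (suc i) = fx i
          convert : Extended.Improves x (Extended.State Z₂ 0) ⊎ Extended.Certificate Z₂ →
            ∃[ x′ ] Feasible I x′ × form Q y x′ < 0ℤ × Candidate T β Z₂ x′
          convert (inj₁ (x′ , fx′ , _ , Extended.state D 0<D D≤ _ _ _ e e≤ eq)) = x′ , (λ i → fx′ (suc i)) ,
            ℤ.≤-<-trans (subst (_≤ -[1+ 0 ]) (sym (form-dot Q y x′)) (fx′ zero)) ℤ.-<+ ,
            candidate D 0<D D≤ (λ j → subst (Describable T β Z₂) (sym (trans (eq j) (ℤ.+-identityˡ (e j)))) (e≤ j))
          convert (inj₂ (Extended.certificate y′ x′ _ _ _ _ g′<0)) =
            contradiction (subst (_< 0ℤ) (form-zero y′ x′) g′<0) (ℤ.<-irrefl refl)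

      completeness : ∀ x → Feasible I x →
        (∃[ x′ ] Feasible I x′ × objective I x′ ≤ objective I x × Candidate T β Z₂ x′) ⊎
        (∃[ y ] ∃[ x′ ] Ray Z₂ y x′ × Feasible I x′ × Candidate T β Z₂ x′)
      completeness x fx = convert (Main.descent κ≤M x fx)
        where
        convert : Main.Improves x (Main.State Z₁ 0) ⊎ Main.Certificate Z₁ →
          (∃[ x′ ] Feasible I x′ × objective I x′ ≤ objective I x × Candidate T β Z₂ x′) ⊎
          (∃[ y ] ∃[ x′ ] Ray Z₂ y x′ × Feasible I x′ × Candidate T β Z₂ x′)
        convert (inj₁ (x′ , fx′ , o , Main.state D 0<D D≤ _ _ _ e e≤ eq)) = inj₁ (x′ , fx′ , o ,
          candidate D 0<D (≤-trans D≤ Z₁≤Z₂)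
            (λ j → subst (Describable T β Z₂) (sym (trans (eq j) (ℤ.+-identityˡ (e j)))) (desc-mono Z₁≤Z₂ (e≤ j))))
        convert (inj₂ (Main.certificate y x′ y≤ fx′ r q g)) =
          let x″ , fx″ , g″ , c = candidate-below y y≤ x′ fx′ g
          in inj₂ (y , x″ , ray (λ j → ≤-trans (y≤ j) Z₁≤Z₂) r q g″ , fx″ , c)

  module _ (I : Instance) where
    open Instance I

    ray-unbounded : ∀ {y x} → (∀ i → dot (A i) y ≤ 0ℤ) → form Q y y ≤ 0ℤ → form Q y x < 0ℤ → Feasible I x → Unbounded I
    ray-unbounded {y} {x} rec yQy yQx fx B = move x t y ,
      (λ i → ≤-by _ (gap (fx i) ⊹ 0≤* 0≤t (gap (rec i))) (trans (cong (λ s → b i - s) (dot-move (A i) x t y)) (e₁ (b i) (dot (A i) x) t (dot (A i) y)))) ,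
      ≤-by _ (0≤* 0≤t (gap< yQx ⊹ gap< yQx) ⊹ 0≤* (0≤* 0≤t 0≤t) (gap yQy) ⊹ 0≤t ⊹ 0≤t-c)
        (trans (cong (λ s → B - s) (form-move Q symmetric x t y)) (e₂ B (form Q x x) t (form Q y x) (form Q y y)))
      where
      c = form Q x x - B
      -- As 2 t yQx ≤ -2 t and t² yQy ≤ 0, any t that is at least the distance c of the objective
      -- from B is large enough.
      t = + ∣ c ∣
      0≤t : 0ℤ ≤ t
      0≤t = ℤ.+≤+ z≤n
      i≤∣i∣ : ∀ i → i ≤ + ∣ i ∣
      i≤∣i∣ (+ _)    = ℤ.≤-refl
      i≤∣i∣ -[1+ _ ] = ℤ.-≤+
      0≤t-c : 0ℤ ≤ t - c
      0≤t-c = gap (i≤∣i∣ c)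
      e₁ : ∀ b a t h → b - (a + t * h) ≡ (b - a) + t * (0ℤ - h)
      e₁ = solve-∀
      e₂ : ∀ B o t g q → B - (o + (t * g + t * g + t * t * q)) ≡
        t * ((0ℤ - g - 1ℤ) + (0ℤ - g - 1ℤ)) + t * t * (0ℤ - q) + t + (t - (o - B))
      e₂ = solve-∀

open Completeness

-- Logarithms and polynomial bounds in K.

module Growth where
  open import Data.Nat.Base using (_+_; _*_; _^_; _≤_; _<_; ⌈_/2⌉; _∸_; NonZero)

  -- Strong induction: halving n, rounded up, lowers the logarithm by one.
  n≤2^⌈log₂n⌉ : ∀ n → n ≤ 2 ^ ⌈log₂ n ⌉
  n≤2^⌈log₂n⌉ = <-rec _ go
    where
    2≤⇒1≤log : ∀ n → 1 ≤ ⌈log₂ suc (suc n) ⌉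
    2≤⇒1≤log n = ≤-trans (≤-reflexive (sym (⌈log₂2^n⌉≡n 1))) (⌈log₂⌉-mono-≤ {2} {suc (suc n)} (s≤s (s≤s z≤n)))
    go : ∀ n → (∀ {m} → m < n → m ≤ 2 ^ ⌈log₂ m ⌉) → n ≤ 2 ^ ⌈log₂ n ⌉
    go zero    _  = z≤n
    go (suc zero) _ = ℕ.m^n>0 2 ⌈log₂ 1 ⌉
    go n@(suc (suc k)) ih = begin
      n                            ≡⟨ sym (ℕ.⌊n/2⌋+⌈n/2⌉≡n n) ⟩
      ℕ.⌊ n /2⌋ + ⌈ n /2⌉          ≤⟨ +-monoˡ-≤ ⌈ n /2⌉ (ℕ.⌊n/2⌋≤⌈n/2⌉ n) ⟩
      ⌈ n /2⌉ + ⌈ n /2⌉            ≤⟨ +-mono-≤ half half ⟩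
      2 ^ l + 2 ^ l                ≡⟨ cong (λ s → 2 ^ l + s) (sym (+-identityʳ _)) ⟩
      2 ^ suc l                    ≡⟨ cong (2 ^_) (ℕ.m+[n∸m]≡n (2≤⇒1≤log k)) ⟩
      2 ^ ⌈log₂ n ⌉                ∎
      where
      open ℕ.≤-Reasoning
      l = ⌈log₂ n ⌉ ∸ 1
      half : ⌈ n /2⌉ ≤ 2 ^ l
      half = subst (λ e → ⌈ n /2⌉ ≤ 2 ^ e) (⌈log₂⌈n/2⌉⌉≡⌈log₂n⌉∸1 n) (ih (ℕ.⌈n/2⌉<n k))

  log₂-* : ∀ a b → ⌈log₂ (a * b) ⌉ ≤ ⌈log₂ a ⌉ + ⌈log₂ b ⌉
  log₂-* a b = subst (⌈log₂ (a * b) ⌉ ≤_) (⌈log₂2^n⌉≡n (⌈log₂ a ⌉ + ⌈log₂ b ⌉)) (⌈log₂⌉-mono-≤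
    (subst (a * b ≤_) (sym (ℕ.^-distribˡ-+-* 2 ⌈log₂ a ⌉ ⌈log₂ b ⌉)) (ℕ.*-mono-≤ (n≤2^⌈log₂n⌉ a) (n≤2^⌈log₂n⌉ b))))

  n<2^n : ∀ n → n < 2 ^ n
  n<2^n zero    = s≤s z≤n
  n<2^n (suc n) = ≤-trans (+-mono-≤ (ℕ.m^n>0 2 n) (n<2^n n)) (≤-reflexive (cong (λ s → 2 ^ n + s) (sym (+-identityʳ _))))

  log₂≤ : ∀ n → ⌈log₂ suc n ⌉ ≤ n
  log₂≤ n = subst (⌈log₂ suc n ⌉ ≤_) (⌈log₂2^n⌉≡n n) (⌈log₂⌉-mono-≤ (n<2^n n))

  -- Exponents are kept as record parameters so that unification finds them.
  record Poly (K c x : ℕ) : Set where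
    constructor poly
    field holds : x ≤ K ^ c

  open Poly public

  module _ {K : ℕ} (2≤K : 2 ≤ K) where
    private
      instance
        K≢0 : NonZero K
        K≢0 = >-nonZero (≤-trans (s≤s z≤n) 2≤K)

    poly-const : ∀ x → Poly K x x
    poly-const x = poly (≤-trans (<⇒≤ (n<2^n x)) (ℕ.^-monoˡ-≤ x 2≤K))

    poly-+ : ∀ {a b x y} → Poly K a x → Poly K b y → Poly K (suc (a + b)) (x + y)
    poly-+ {a} {b} (poly p) (poly q) = poly (≤-trans
      (+-mono-≤ (≤-trans p (^-monoʳ-≤ K (m≤m+n a b))) (≤-trans q (^-monoʳ-≤ K (m≤n+m b a))))
      (≤-trans (≤-reflexive (cong (λ s → K ^ (a + b) + s) (sym (+-identityʳ _)))) (*-monoˡ-≤ (K ^ (a + b)) 2≤K)))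

    poly-wk : ∀ {a b x} → a ≤ b → Poly K a x → Poly K b x
    poly-wk a≤b (poly p) = poly (≤-trans p (^-monoʳ-≤ K a≤b))

    poly-self : Poly K 1 K
    poly-self = poly (≤-reflexive (sym (ℕ.^-identityʳ K)))

    2≤^ : ∀ c → 2 ≤ K ^ suc c
    2≤^ c = ≤-trans 2≤K (m≤m*n K (K ^ c) ⦃ ℕ.m^n≢0 K c ⦄)

    K≤^ : ∀ c → K ≤ K ^ suc c
    K≤^ c = m≤m*n K (K ^ c) ⦃ ℕ.m^n≢0 K c ⦄

  poly-* : ∀ {K a b x y} → Poly K a x → Poly K b y → Poly K (a + b) (x * y)
  poly-* {K} {a} {b} (poly p) (poly q) = poly (subst (_ ≤_) (sym (ℕ.^-distribˡ-+-* K a b)) (ℕ.*-mono-≤ p q))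

  poly-≤ : ∀ {K c x y} → x ≤ y → Poly K c y → Poly K c x
  poly-≤ x≤y (poly p) = poly (≤-trans x≤y p)

  -- Binding a variable replaces the base K by a power of K; this carries bounds back to K.
  poly-^ : ∀ {K a c x} → Poly (K ^ a) c x → Poly K (a * c) x
  poly-^ {K} {a} {c} (poly p) = poly (subst (_ ≤_) (ℕ.^-*-assoc K a c) p)

open Growth

-- A language of bounded loops and its compilation.

module Language where
  open import Data.Nat.Base using (_≤_; _<_)
  open import Data.Integer.Base using (_+_; _*_; _-_)

  Var : Set
  Var = Fin 24

  Input Env : Set
  Input = ℕ → ℤ
  Env   = Var → ℤ

  _[_≔ᵥ_] : {X : Set} → (Var → X) → Var → X → Var → X
  (f [ x ≔ᵥ v ]) y with y Fin.≟ x
  ... | yes _ = v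
  ... | no  _ = f y

  -- Values of type `small` are polynomial in K themselves and may serve as loop limits and
  -- addresses; for `big` ones, such as entries of the input and objective values, only the bit
  -- length is. The way from `big` to `small` inside a term is by truth value, through `cond` or the
  -- index found by `last`.
  data Ty : Set where
    small big : Ty

  data Op : Set where
    add sub mul quo : Op

  -- `last` yields one more than the last index with a positive body, or 0. `prod x` multiplies, but
  -- drops to 0 once the product exceeds the variable x: an uncapped product would not stay
  -- polynomial in K.
  data Mode : Ty → Ty → Set where
    sum  : ∀ {τ} → Mode τ τ
    last : ∀ {τ} → Mode τ small
    prod : Var → Mode small small

  data Tm : Ty → Set where
    num   : ∀ {τ} → ℤ → Tm τ
    var   : Var → Tm small
    up    : Tm small → Tm big
    input : ∀ {τ} → Tm τ → Tm big
    op    : ∀ {τ} → Op → Tm τ → Tm τ → Tm τ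
    cond  : ∀ {σ τ} → Tm σ → Tm τ → Tm τ → Tm τ
    bind  : ∀ {τ} → Var → Tm small → Tm τ → Tm τ
    loop  : ∀ {σ τ} → Mode σ τ → Var → Tm small → Tm σ → Tm τ

  select : {X : Set} → ℤ → X → X → X
  select (+ suc _) x y = x
  select _         x y = y

  clamp : ℤ → ℕ
  clamp (+ n)    = n
  clamp -[1+ _ ] = 0

  ⟦_⟧ₒ : Op → ℤ → ℤ → ℤ
  ⟦ add ⟧ₒ x y = x + y
  ⟦ sub ⟧ₒ x y = x - y
  ⟦ mul ⟧ₒ x y = x * y
  ⟦ quo ⟧ₒ x y = x div y

  init : ∀ {σ τ} → Mode σ τ → ℤ
  init sum      = 0ℤ
  init last     = 0ℤ
  init (prod _) = 1ℤ

  next : ∀ {σ τ} → Mode σ τ → Env → ℤ → ℕ → ℤ → ℤ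
  next sum      ρ acc i v = acc + v
  next last     ρ acc i v = select v (+ i + 1ℤ) acc
  next (prod x) ρ acc i v = select (acc * v) (select (ρ x + 1ℤ - acc * v) (acc * v) 0ℤ) 0ℤ

  fold : ∀ {σ τ} → Mode σ τ → Env → (ℕ → ℤ) → ℕ → ℤ
  fold M ρ f zero    = init M
  fold M ρ f (suc i) = next M ρ (fold M ρ f i) i (f i)

  ⟪_⟫ : ∀ {τ} → Tm τ → Input → Env → ℤ
  ⟪ num z ⟫        inp ρ = z
  ⟪ var x ⟫        inp ρ = ρ x
  ⟪ up t ⟫         inp ρ = ⟪ t ⟫ inp ρ
  ⟪ input t ⟫      inp ρ = inp (clamp (⟪ t ⟫ inp ρ))
  ⟪ op o t u ⟫     inp ρ = ⟦ o ⟧ₒ (⟪ t ⟫ inp ρ) (⟪ u ⟫ inp ρ)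
  ⟪ cond t u v ⟫   inp ρ = select (⟪ t ⟫ inp ρ) (⟪ u ⟫ inp ρ) (⟪ v ⟫ inp ρ)
  ⟪ bind x t u ⟫   inp ρ = ⟪ u ⟫ inp (ρ [ x ≔ᵥ ⟪ t ⟫ inp ρ ])
  ⟪ loop M x e t ⟫ inp ρ = fold M ρ (λ i → ⟪ t ⟫ inp (ρ [ x ≔ᵥ + i ])) (clamp (⟪ e ⟫ inp ρ))

  -- Work registers have negative addresses, so they never collide with the input.
  R : ℕ → Exp
  R a = reg (lit -[1+ a ])

  infix 4 _⇐_
  _⇐_ : ℕ → Exp → Program
  a ⇐ e = lit -[1+ a ] ≔ e

  opExp : Op → Exp → Exp → Exp
  opExp add = _⊕_
  opExp sub = _⊖_
  opExp mul = _⊗_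
  opExp quo = _⊘_

  -- A loop at depth d keeps its limit in work register d, the counter in 1 + d, the accumulator in
  -- 2 + d and the value of the body in 3 + d.
  stepCode : ∀ {σ τ} → Mode σ τ → (Var → ℕ) → ℕ → Program
  stepCode sum      r d = 2 ℕ.+ d ⇐ R (2 ℕ.+ d) ⊕ R (3 ℕ.+ d)
  stepCode last     r d = ifPos R (3 ℕ.+ d) ⟨ 2 ℕ.+ d ⇐ R (1 ℕ.+ d) ⊕ lit 1ℤ ⟩⟨ skip ⟩
  stepCode (prod x) r d =
    ifPos R (2 ℕ.+ d) ⊗ R (3 ℕ.+ d)
      ⟨ ifPos R (r x) ⊕ lit 1ℤ ⊖ R (2 ℕ.+ d) ⊗ R (3 ℕ.+ d)
          ⟨ 2 ℕ.+ d ⇐ R (2 ℕ.+ d) ⊗ R (3 ℕ.+ d) ⟩⟨ 2 ℕ.+ d ⇐ lit 0ℤ ⟩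
      ⟩⟨ 2 ℕ.+ d ⇐ lit 0ℤ ⟩

  -- The variable x lives in register -[1+ r x ]; the result of code r d t is
  -- left in register -[1+ d ], and the registers beyond it are scratch.
  code : ∀ {τ} → (Var → ℕ) → ℕ → Tm τ → Program
  code r d (num z)        = d ⇐ lit z
  code r d (var x)        = d ⇐ R (r x)
  code r d (up t)         = code r d t
  code r d (input t)      = code r d t ⨾ ifPos R d ⟨ d ⇐ reg (R d) ⟩⟨ d ⇐ reg (lit 0ℤ) ⟩
  code r d (op o t u)     = code r d t ⨾ code r (suc d) u ⨾ d ⇐ opExp o (R d) (R (suc d))
  code r d (cond t u v)   = code r d t ⨾ ifPos R d ⟨ code r d u ⟩⟨ code r d v ⟩
  code r d (bind x t u)   = code r d t ⨾ code (r [ x ≔ᵥ d ]) (suc d) u ⨾ d ⇐ R (suc d)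
  code r d (loop M x e t) = code r d e ⨾ 1 ℕ.+ d ⇐ lit 0ℤ ⨾ 2 ℕ.+ d ⇐ lit (init M) ⨾
    whilePos R d ⊖ R (1 ℕ.+ d)
      ⟨ code (r [ x ≔ᵥ 1 ℕ.+ d ]) (3 ℕ.+ d) t ⨾ stepCode M r d ⨾ 1 ℕ.+ d ⇐ R (1 ℕ.+ d) ⊕ lit 1ℤ ⟩ ⨾
    d ⇐ R (2 ℕ.+ d)

open Language

-- Sizes of the values of terms.

module Magnitude where
  open import Data.Nat.Base using (_+_; _*_; _^_; _≤_; _<_)

  mag : Ty → ℤ → ℕ
  mag small z = ∣ z ∣
  mag big   z = bits z

  bits-≤-* : ∀ z x y → suc ∣ z ∣ ≤ suc ∣ x ∣ * suc ∣ y ∣ → bits z ≤ bits x + bits y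
  bits-≤-* z x y p = s≤s (≤-trans (⌈log₂⌉-mono-≤ p) (≤-trans (log₂-* (suc ∣ x ∣) (suc ∣ y ∣))
    (+-monoʳ-≤ ⌈log₂ suc ∣ x ∣ ⌉ (n≤1+n ⌈log₂ suc ∣ y ∣ ⌉))))

  bits≤1+mag : ∀ τ z → bits z ≤ suc (mag τ z)
  bits≤1+mag small z = s≤s (log₂≤ ∣ z ∣)
  bits≤1+mag big   z = n≤1+n (bits z)

  -- Rounding down a negative quotient may add 1 to its absolute value; the summand d pays for that.
  ∣/ℕ∣≤ : ∀ x d .⦃ _ : NonZero d ⦄ → ∣ x ℤ./ℕ d ∣ ≤ ∣ x ∣ + d
  ∣/ℕ∣≤ (+ n) d = ≤-trans (ℕ.m/n≤m n d) (m≤m+n n d)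
  ∣/ℕ∣≤ -[1+ n ] d with suc n ℕ.% d
  ... | zero  = ≤-trans (≤-reflexive (ℤ.∣-i∣≡∣i∣ (+ (suc n ℕ./ d)))) (≤-trans (ℕ.m/n≤m (suc n) d) (m≤m+n (suc n) d))
  ... | suc _ = ≤-trans (≤-reflexive (+-comm 1 _)) (+-mono-≤ (ℕ.m/n≤m (suc n) d) (ℕ.>-nonZero⁻¹ d))

  ∣div∣≤ : ∀ x y → ∣ x div y ∣ ≤ ∣ x ∣ + ∣ y ∣
  ∣div∣≤ x (+ zero)  = z≤n
  ∣div∣≤ x (+ suc k) = subst (λ q → ∣ q ∣ ≤ ∣ x ∣ + suc k) (sym (ℤ.div-pos-is-/ℕ x (suc k))) (∣/ℕ∣≤ x (suc k))
  ∣div∣≤ x -[1+ k ]  = subst (λ q → ∣ q ∣ ≤ ∣ x ∣ + suc k) (sym (ℤ.div-neg-is-neg-/ℕ x (suc k)))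
    (subst (_≤ ∣ x ∣ + suc k) (sym (ℤ.∣-i∣≡∣i∣ (x ℤ./ℕ suc k))) (∣/ℕ∣≤ x (suc k)))

  -- The right side is (1 + ∣x∣)(1 + ∣y∣) - 1. Bit lengths are therefore subadditive under all four
  -- operations alike.
  ∣op∣≤ : ∀ o x y → ∣ ⟦ o ⟧ₒ x y ∣ ≤ ∣ x ∣ * ∣ y ∣ + (∣ x ∣ + ∣ y ∣)
  ∣op∣≤ add x y = ≤-trans (ℤ.∣i+j∣≤∣i∣+∣j∣ x y) (m≤n+m _ (∣ x ∣ * ∣ y ∣))
  ∣op∣≤ sub x y = ≤-trans (ℤ.∣i-j∣≤∣i∣+∣j∣ x y) (m≤n+m _ (∣ x ∣ * ∣ y ∣))
  ∣op∣≤ mul x y = ≤-trans (≤-reflexive (ℤ.∣i*j∣≡∣i∣*∣j∣ x y)) (m≤m+n _ (∣ x ∣ + ∣ y ∣))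
  ∣op∣≤ quo x y = ≤-trans (∣div∣≤ x y) (m≤n+m _ (∣ x ∣ * ∣ y ∣))

  mag-op : ∀ τ o x y → mag τ (⟦ o ⟧ₒ x y) ≤ mag τ x * mag τ y + (mag τ x + mag τ y)
  mag-op small o x y = ∣op∣≤ o x y
  mag-op big   o x y = ≤-trans (bits-≤-* (⟦ o ⟧ₒ x y) x y
    (≤-trans (s≤s (∣op∣≤ o x y)) (≤-reflexive (e ∣ x ∣ ∣ y ∣)))) (m≤n+m _ (bits x * bits y))
    where
    e : ∀ a b → 1 + (a * b + (a + b)) ≡ (1 + a) * (1 + b)
    e = ℕ-Ring.solve-∀

  mag-+ : ∀ τ x y → mag τ (x ℤ.+ y) ≤ mag τ x + mag τ y
  mag-+ small x y = ℤ.∣i+j∣≤∣i∣+∣j∣ x y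
  mag-+ big   x y = bits-≤-* (x ℤ.+ y) x y
    (≤-trans (s≤s (ℤ.∣i+j∣≤∣i∣+∣j∣ x y)) (≤-trans (m≤m+n _ (∣ x ∣ * ∣ y ∣)) (≤-reflexive (e ∣ x ∣ ∣ y ∣))))
    where
    e : ∀ a b → 1 + (a + b) + a * b ≡ (1 + a) * (1 + b)
    e = ℕ-Ring.solve-∀

  mag0≤1 : ∀ τ → mag τ 0ℤ ≤ 1
  mag0≤1 small = z≤n
  mag0≤1 big   = ≤-refl

  mag-select : ∀ τ z x y → mag τ (select z x y) ≤ mag τ x + mag τ y
  mag-select τ (+ zero)  x y = m≤n+m _ (mag τ x)
  mag-select τ (+ suc _) x y = m≤m+n _ (mag τ y)
  mag-select τ -[1+ _ ]  x y = m≤n+m _ (mag τ x)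

  clamp≤∣∣ : ∀ z → clamp z ≤ ∣ z ∣
  clamp≤∣∣ (+ n)    = ≤-refl
  clamp≤∣∣ -[1+ _ ] = z≤n

  record Bounds (K : ℕ) (inp : Input) (ρ : Env) : Set where
    constructor bounds
    field
      inp≤ : ∀ a → bits (inp a) ≤ K
      env≤ : ∀ x → ∣ ρ x ∣ ≤ K

  open Bounds public

  ≔ᵥ-≤ : ∀ {K} {ρ : Env} x v → (∀ x → ∣ ρ x ∣ ≤ K) → ∣ v ∣ ≤ K → ∀ y → ∣ (ρ [ x ≔ᵥ v ]) y ∣ ≤ K
  ≔ᵥ-≤ x v p q y with y Fin.≟ x
  ... | yes _ = q
  ... | no  _ = p y

  bounds-≤ : ∀ {K K′ inp ρ} → K ≤ K′ → Bounds K inp ρ → Bounds K′ inp ρ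
  bounds-≤ p (bounds i e) = bounds (λ a → ≤-trans (i a) p) (λ x → ≤-trans (e x) p)

  -- The bound variable may exceed K, so the base grows to K ^ (c + 1). Nesting multiplies
  -- exponents, but only as often as the term nests binders.
  bounds-bind : ∀ {K c inp ρ v} x → 2 ≤ K → Bounds K inp ρ → Poly K c ∣ v ∣ →
    Bounds (K ^ suc c) inp (ρ [ x ≔ᵥ v ])
  bounds-bind {c = c} {v = v} x 2≤K B v≤ with bounds-≤ (K≤^ 2≤K c) B
  ... | bounds i e = bounds i (≔ᵥ-≤ x v e (holds (poly-wk 2≤K (n≤1+n c) v≤)))

  -- A sum is charged X per round, `last` only the counter, and a product only the cap; one common
  -- bound lets a single exponent serve all modes.
  fold-≤ : ∀ {σ τ} (M : Mode σ τ) {K inp ρ} → Bounds K inp ρ → ∀ X f i → (∀ j → j < i → mag σ (f j) ≤ X) →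
    mag τ (fold M ρ f i) ≤ 1 + K + (i + i * X)
  fold-≤ {τ = τ} sum {K} {ρ = ρ} B X f i h = ≤-trans (go i h)
    (s≤s (≤-trans (m≤n+m (i * X) i) (m≤n+m (i + i * X) K)))
    where
    go : ∀ i → (∀ j → j < i → mag τ (f j) ≤ X) → mag τ (fold {τ} sum ρ f i) ≤ 1 + i * X
    go zero    h = mag0≤1 τ
    go (suc i) h = ≤-trans (mag-+ τ (fold {τ} sum ρ f i) (f i))
      (≤-trans (+-mono-≤ (go i λ j p → h j (ℕ.m<n⇒m<1+n p)) (h i ≤-refl))
        (s≤s (≤-reflexive (+-comm (i * X) X))))
  fold-≤ last {K} {ρ = ρ} B X f i h = ≤-trans (go i)
    (≤-trans (m≤m+n i (i * X)) (m≤n+m (i + i * X) (1 + K)))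
    where
    go : ∀ i → ∣ fold last ρ f i ∣ ≤ i
    go zero = z≤n
    go (suc i) with f i
    ... | + zero   = ℕ.m≤n⇒m≤1+n (go i)
    ... | + suc _  = ≤-reflexive (+-comm i 1)
    ... | -[1+ _ ] = ℕ.m≤n⇒m≤1+n (go i)
  fold-≤ (prod x) {K} {ρ = ρ} B X f i h = ≤-trans (go i) (m≤m+n (1 + K) (i + i * X))
    where
    capped : ∀ v → ∣ select v (select (ρ x ℤ.+ 1ℤ ℤ.- v) v 0ℤ) 0ℤ ∣ ≤ 1 + K
    capped (+ zero)   = z≤n
    capped -[1+ _ ]   = z≤n
    capped v@(+ suc n) with ρ x ℤ.+ 1ℤ ℤ.- v in eq
    ... | + zero   = z≤n
    ... | -[1+ _ ] = z≤n
    ... | + suc k  = ≤-trans (ℤ.drop‿+≤+ (ℤ.≤-trans {j = ρ x ℤ.+ 1ℤ} (ℤ.0≤i-j⇒j≤i (subst (0ℤ ℤ.≤_) (sym eq) (ℤ.+≤+ z≤n))) (bound (ρ x))))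
        (subst (ℕ._≤ 1 + K) (+-comm 1 ∣ ρ x ∣) (s≤s (env≤ B x)))
      where
      bound : ∀ z → z ℤ.+ 1ℤ ℤ.≤ + (∣ z ∣ + 1)
      bound (+ n)    = ℤ.≤-refl
      bound -[1+ n ] = ℤ.≤-trans (ℤ.+-monoˡ-≤ 1ℤ (ℤ.-≤+ {n} {suc n})) ℤ.≤-refl
    go : ∀ i → ∣ fold (prod x) ρ f i ∣ ≤ 1 + K
    go zero    = s≤s z≤n
    go (suc i) = capped (fold (prod x) ρ f i ℤ.* f i)

  fold-bound : ∀ {σ τ} (M : Mode σ τ) {K inp ρ a b} → 2 ≤ K → Bounds K inp ρ → ∀ f N → Poly K a N →
    (∀ j → j < N → Poly K b (mag σ (f j))) → ∀ i → i ≤ N →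
    Poly K (suc (suc (1 + 1) + suc (a + (a + b)))) (mag τ (fold M ρ f i))
  fold-bound M {K} {b = b} 2≤K B f N N≤ f≤ i i≤N = poly-≤ (fold-≤ M B (K ^ b) f i (λ j j<i → holds (f≤ j (<-≤-trans j<i i≤N))))
    (poly-+ 2≤K (poly-+ 2≤K (poly-const 2≤K 1) (poly-self 2≤K))
      (poly-+ 2≤K i≤ (poly-* i≤ (poly ≤-refl))))
    where
    i≤ = poly-≤ i≤N N≤

  -- Opaque, like exec below, because the exponents are huge numerals.
  opaque
    value : ∀ {τ} (t : Tm τ) → ∃[ c ] ∀ {K inp ρ} → 2 ≤ K → Bounds K inp ρ → Poly K c (mag τ (⟪ t ⟫ inp ρ))
    value {τ} (num z) = _ , λ 2≤K B → poly-const 2≤K (mag τ z)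
    value (var x)   = _ , λ 2≤K B → poly-≤ (env≤ B x) (poly-self 2≤K)
    value (up t)    = let _ , h = value t in _ , λ {K} {inp} {ρ} 2≤K B →
      poly-≤ (bits≤1+mag small (⟪ t ⟫ inp ρ)) (poly-+ 2≤K (poly-const 2≤K 1) (h 2≤K B))
    value (input t) = _ , λ 2≤K B → poly-≤ (inp≤ B _) (poly-self 2≤K)
    value {τ} (op o t u) = let _ , h = value t ; _ , k = value u in _ , λ {K} {inp} {ρ} 2≤K B →
      poly-≤ (mag-op τ o (⟪ t ⟫ inp ρ) (⟪ u ⟫ inp ρ))
        (poly-+ 2≤K (poly-* (h 2≤K B) (k 2≤K B)) (poly-+ 2≤K (h 2≤K B) (k 2≤K B)))
    value {τ} (cond t u v) = let _ , h = value u ; _ , k = value v in _ , λ {K} {inp} {ρ} 2≤K B →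
      poly-≤ (mag-select τ (⟪ t ⟫ inp ρ) (⟪ u ⟫ inp ρ) (⟪ v ⟫ inp ρ)) (poly-+ 2≤K (h 2≤K B) (k 2≤K B))
    value (bind x t u) = let c , h = value t ; _ , k = value u in _ , λ 2≤K B →
      poly-^ {a = suc c} (k (2≤^ 2≤K c) (bounds-bind x 2≤K B (h 2≤K B)))
    value (loop M x e t) = let c , h = value e ; _ , k = value t in _ , λ {K} {inp} {ρ} 2≤K B →
      let N≤ = poly-≤ (clamp≤∣∣ (⟪ e ⟫ inp ρ)) (h 2≤K B) in
      fold-bound M 2≤K B (λ i → ⟪ t ⟫ inp (ρ [ x ≔ᵥ + i ])) (clamp (⟪ e ⟫ inp ρ)) N≤
        (λ j j<N → poly-^ {a = suc c} (k (2≤^ 2≤K c) (bounds-bind x 2≤K B (poly-≤ (<⇒≤ j<N) N≤))))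
        (clamp (⟪ e ⟫ inp ρ)) ≤-refl

open Magnitude

-- Correctness and running time of compiled terms.

module Execution where
  open import Data.Nat.Base using (_+_; _*_; _^_; _≤_; _<_)

  record Upd (a v : ℤ) (σ σ′ : Memory) : Set where
    constructor upd
    field
      at  : σ′ a ≡ v
      off : ∀ a′ → a′ ≢ a → σ′ a′ ≡ σ a′

  update : ∀ σ a v → Upd a v σ (σ [ a ↦ v ])
  update σ a v = upd same other
    where
    same : (σ [ a ↦ v ]) a ≡ v
    same with a ℤ.≟ a
    ... | yes _ = refl
    ... | no ¬p = contradiction refl ¬p
    other : ∀ a′ → a′ ≢ a → (σ [ a ↦ v ]) a′ ≡ σ a′
    other a′ p with a′ ℤ.≟ a
    ... | yes q = contradiction q p
    ... | no _  = refl

  record Run (p : Program) (σ : Memory) (K c : ℕ) (Post : Memory → Set) : Set where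
    constructor run
    field
      {final} : Memory
      {time}  : ℕ
      halts   : ⟨ p , σ ⟩⇓⟨ final , time ⟩
      time≤   : Poly K c time
      post    : Post final

  map-post : ∀ {p σ K c P P′} → (∀ {σ′} → P σ′ → P′ σ′) → Run p σ K c P → Run p σ K c P′
  map-post f (run h t p) = run h t (f p)

  run-⨾ : ∀ {p q σ K a b P P′} → 2 ≤ K → Run p σ K a P → (∀ {σ′} → P σ′ → Run q σ′ K b P′) →
    Run (p ⨾ q) σ K (suc (a + b)) P′
  run-⨾ 2≤K (run h t p) k with k p
  ... | run h′ t′ p′ = run (seq h h′) (poly-+ 2≤K t t′) p′

  -- e evaluates to z; the exponents bound the bit length of z and the cost of e.
  record Ev (K a c : ℕ) (e : Exp) (σ : Memory) (z : ℤ) : Set where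
    constructor ev
    field
      value= : ⟦ e ⟧ σ ≡ z
      bits≤  : Poly K a (bits z)
      cost≤  : Poly K c (cost e σ)

  open Ev public

  ev-lit : ∀ {K σ} z → 2 ≤ K → Ev K (bits z) (bits z) (lit z) σ z
  ev-lit z 2≤K = ev refl (poly-const 2≤K (bits z)) (poly-const 2≤K (bits z))

  ev-reg : ∀ {K a b c e σ z v} → 2 ≤ K → Ev K a c e σ z → σ z ≡ v → Poly K b (bits v) →
    Ev K b (suc (c + b)) (reg e) σ v
  ev-reg 2≤K (ev refl _ p) refl q = ev refl q (poly-+ 2≤K p q)

  ev-R : ∀ {K b σ v} a → 2 ≤ K → σ -[1+ a ] ≡ v → Poly K b (bits v) → Ev K b (suc (bits -[1+ a ] + b)) (R a) σ v
  ev-R a 2≤K eq q = ev-reg 2≤K (ev-lit -[1+ a ] 2≤K) eq q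

  poly-op : ∀ o {K a b} x y → 2 ≤ K → Poly K a (bits x) → Poly K b (bits y) →
    Poly K (suc (a + b + suc (a + b))) (bits (⟦ o ⟧ₒ x y))
  poly-op o x y 2≤K p q = poly-≤ (mag-op big o x y) (poly-+ 2≤K (poly-* p q) (poly-+ 2≤K p q))

  ev-op : ∀ o {K a b c d e f σ x y} → 2 ≤ K → Ev K a c e σ x → Ev K b d f σ y →
    Ev K (suc (a + b + suc (a + b))) (suc (suc (c + d) + suc (a + b + suc (a + b)))) (opExp o e f) σ (⟦ o ⟧ₒ x y)
  ev-op add {x = x} {y} 2≤K (ev refl p q) (ev refl p′ q′) = let r = poly-op add x y 2≤K p p′ in ev refl r (poly-+ 2≤K (poly-+ 2≤K q q′) r)
  ev-op sub {x = x} {y} 2≤K (ev refl p q) (ev refl p′ q′) = let r = poly-op sub x y 2≤K p p′ in ev refl r (poly-+ 2≤K (poly-+ 2≤K q q′) r)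
  ev-op mul {x = x} {y} 2≤K (ev refl p q) (ev refl p′ q′) = let r = poly-op mul x y 2≤K p p′ in ev refl r (poly-+ 2≤K (poly-+ 2≤K q q′) r)
  ev-op quo {x = x} {y} 2≤K (ev refl p q) (ev refl p′ q′) = let r = poly-op quo x y 2≤K p p′ in ev refl r (poly-+ 2≤K (poly-+ 2≤K q q′) r)

  run-≔ : ∀ {e f σ K a b c d x z} → 2 ≤ K → Ev K a c e σ x → Ev K b d f σ z → Run (e ≔ f) σ K (suc (c + d)) (Upd x z σ)
  run-≔ {σ = σ} {x = x} {z} 2≤K (ev refl _ p) (ev refl _ q) = run assign (poly-+ 2≤K p q) (update σ x z)

  run-⇐ : ∀ {e σ K b d z} a → 2 ≤ K → Ev K b d e σ z → Run (a ⇐ e) σ K (suc (bits -[1+ a ] + d)) (Upd -[1+ a ] z σ)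
  run-⇐ a 2≤K E = run-≔ 2≤K (ev-lit -[1+ a ] 2≤K) E

  run-if : ∀ {e p q σ K a b b′ c z P} → 2 ≤ K → Ev K a c e σ z →
    (0ℤ ℤ.< z → Run p σ K b P) → (z ℤ.≤ 0ℤ → Run q σ K b′ P) →
    Run (ifPos e ⟨ p ⟩⟨ q ⟩) σ K (suc (c + (b + b′))) P
  run-if {b = b} {b′} {z = z} 2≤K (ev refl _ c) p q with 0ℤ ℤ.<? z
  ... | yes 0<z with p 0<z
  ...   | run h t post = run (if-true 0<z h) (poly-+ 2≤K c (poly-wk 2≤K (m≤m+n b b′) t)) post
  run-if {b = b} {b′} 2≤K (ev refl _ c) p q | no 0≮z with q (ℤ.≮⇒≥ 0≮z)
  ...   | run h t post = run (if-false (ℤ.≮⇒≥ 0≮z) h) (poly-+ 2≤K c (poly-wk 2≤K (m≤n+m b′ b) t)) post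

  -- The number N of rounds is known beforehand, so the cost is N times the uniform price K ^ a + K
  -- ^ b of a test and a body, plus the final failing test.
  run-while : ∀ {g p K a′ a b c} N (Inv : ℕ → Memory → Set) (val : ℕ → ℤ) → 2 ≤ K → Poly K c N →
    (∀ {i} → i < N → 0ℤ ℤ.< val i) → val N ℤ.≤ 0ℤ →
    (∀ {i σ} → i ≤ N → Inv i σ → Ev K a′ a g σ (val i)) →
    (∀ {i σ} → i < N → Inv i σ → Run p σ K b (Inv (suc i))) →
    ∀ {σ} → Inv 0 σ → Run (whilePos g ⟨ p ⟩) σ K (suc (c + suc (a + b) + a)) (Inv N)
  run-while {g} {p} {K} {a = a} {b} N Inv val 2≤K N≤ pos neg guard body inv₀ with go 0 N refl inv₀
    where
    go : ∀ i k → i + k ≡ N → ∀ {σ} → Inv i σ →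
      ∃[ σ′ ] ∃[ t ] ⟨ whilePos g ⟨ p ⟩ , σ ⟩⇓⟨ σ′ , t ⟩ × t ≤ k * (K ^ a + K ^ b) + K ^ a × Inv N σ′
    go i zero eq inv with trans (sym (+-identityʳ i)) eq
    ... | refl = _ , _ , while-false (subst (ℤ._≤ 0ℤ) (sym (value= (guard ≤-refl inv))) neg) , holds (cost≤ (guard ≤-refl inv)) , inv
    go i (suc k) eq inv with body i<N inv
      where
      i<N = subst (i <_) eq (ℕ.m<m+n i (s≤s z≤n))
    ... | run h t inv′ with go (suc i) k (trans (sym (ℕ.+-suc i k)) eq) inv′
    ...   | _ , _ , h′ , t′ , inv″ = _ , _ , while-true (subst (0ℤ ℤ.<_) (sym (value= (guard (<⇒≤ i<N) inv))) (pos i<N)) h h′ ,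
              ≤-trans (+-mono-≤ (+-mono-≤ (holds (cost≤ (guard (<⇒≤ i<N) inv))) (holds t)) t′)
                (≤-reflexive (sym (ℕ.+-assoc (K ^ a + K ^ b) (k * (K ^ a + K ^ b)) (K ^ a)))) , inv″
      where
      i<N = subst (i <_) eq (ℕ.m<m+n i (s≤s z≤n))
  ... | _ , _ , h , t , inv = run h (poly-≤ t (poly-+ 2≤K (poly-* N≤ (poly-+ 2≤K (poly {c = a} ≤-refl) (poly {c = b} ≤-refl))) (poly {c = a} ≤-refl))) inv

  poly-bits : ∀ {K c z} τ → 2 ≤ K → Poly K c (mag τ z) → Poly K (suc (1 + c)) (bits z)
  poly-bits {z = z} τ 2≤K p = poly-≤ (bits≤1+mag τ z) (poly-+ 2≤K (poly-const 2≤K 1) p)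

  -- The calling convention behind `code`: registers from depth d on are scratch, so subterms can be
  -- run one after another at increasing depth.
  record Frame (d : ℕ) (σ σ′ : Memory) : Set where
    constructor frame
    field
      nonneg : ∀ a → σ′ (+ a) ≡ σ (+ a)
      low    : ∀ {j} → j < d → σ′ -[1+ j ] ≡ σ -[1+ j ]

  open Frame public

  frame-trans : ∀ {d σ σ′ σ″} → Frame d σ σ′ → Frame d σ′ σ″ → Frame d σ σ″
  frame-trans (frame n l) (frame n′ l′) = frame (λ a → trans (n′ a) (n a)) (λ p → trans (l′ p) (l p))

  frame-≤ : ∀ {d d′ σ σ′} → d ≤ d′ → Frame d′ σ σ′ → Frame d σ σ′
  frame-≤ d≤d′ (frame n l) = frame n (λ p → l (<-≤-trans p d≤d′))

  -[1+]-≢ : ∀ {i j} → i ≢ j → -[1+ i ] ≢ -[1+ j ]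
  -[1+]-≢ i≢j refl = i≢j refl

  frame-upd : ∀ {d a v σ σ′} → d ≤ a → Upd -[1+ a ] v σ σ′ → Frame d σ σ′
  frame-upd d≤a (upd _ off) = frame (λ a → off (+ a) λ ()) (λ j<d → off _ (-[1+]-≢ (ℕ.<⇒≢ (<-≤-trans j<d d≤a))))

  record Rep (inp : Input) (ρ : Env) (r : Var → ℕ) (σ : Memory) : Set where
    constructor rep
    field
      inputs : ∀ a → σ (+ a) ≡ inp a
      vars   : ∀ x → σ -[1+ r x ] ≡ ρ x

  open Rep public

  rep-frame : ∀ {inp ρ r d σ σ′} → (∀ x → r x < d) → Frame d σ σ′ → Rep inp ρ r σ → Rep inp ρ r σ′
  rep-frame r<d (frame n l) (rep i v) = rep (λ a → trans (n a) (i a)) (λ x → trans (l (r<d x)) (v x))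

  rep-bind : ∀ {inp ρ r σ v a} x → σ -[1+ a ] ≡ v → Rep inp ρ r σ → Rep inp (ρ [ x ≔ᵥ v ]) (r [ x ≔ᵥ a ]) σ
  rep-bind {ρ = ρ} {r} {σ} {v} {a} x eq (rep i vs) = rep i vars′
    where
    vars′ : ∀ y → σ -[1+ (r [ x ≔ᵥ a ]) y ] ≡ (ρ [ x ≔ᵥ v ]) y
    vars′ y with y Fin.≟ x
    ... | yes _ = eq
    ... | no  _ = vs y

  bind-< : ∀ {r : Var → ℕ} {d d′ a} x → (∀ y → r y < d) → d ≤ d′ → a < d′ → ∀ y → (r [ x ≔ᵥ a ]) y < d′
  bind-< x r<d d≤d′ a<d′ y with y Fin.≟ x
  ... | yes _ = a<d′
  ... | no  _ = <-≤-trans (r<d y) d≤d′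

  record Result (d : ℕ) (z : ℤ) (σ σ′ : Memory) : Set where
    constructor result
    field
      framed : Frame d σ σ′
      result= : σ′ -[1+ d ] ≡ z

  select-pos : ∀ {X : Set} {z} {x y : X} → 0ℤ ℤ.< z → select z x y ≡ x
  select-pos {z = + zero}  (ℤ.+<+ ())
  select-pos {z = + suc _} _ = refl

  select-neg : ∀ {X : Set} {z} {x y : X} → z ℤ.≤ 0ℤ → select z x y ≡ y
  select-neg {z = + zero}   _ = refl
  select-neg {z = -[1+ _ ]} _ = refl
  select-neg {z = + suc _} (ℤ.+≤+ ())

  clamp-pos : ∀ {z} → 0ℤ ℤ.< z → z ≡ + clamp z
  clamp-pos {+ _} _ = refl

  clamp-neg : ∀ {z} → z ℤ.≤ 0ℤ → 0 ≡ clamp z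
  clamp-neg {+ zero}   _ = refl
  clamp-neg { -[1+ _ ]} _ = refl
  clamp-neg {+ suc _} (ℤ.+≤+ ())

  value-bits : ∀ {τ} (t : Tm τ) → ∃[ c ] ∀ {K inp ρ} → 2 ≤ K → Bounds K inp ρ → Poly K c (bits (⟪ t ⟫ inp ρ))
  value-bits {τ} t = let _ , h = value t in _ , λ 2≤K B → poly-bits τ 2≤K (h 2≤K B)

  upd-≡ : ∀ {a v v′ σ σ′} → v ≡ v′ → Upd a v σ σ′ → Upd a v′ σ σ′
  upd-≡ refl u = u

  rebase : ∀ {p σ K c P} a → Run p σ (K ^ a) c P → Run p σ K (a * c) P
  rebase a (run h t p) = run h (poly-^ {a = a} t) p

  step-run : ∀ {τ τ′} (M : Mode τ τ′) r d a b c → ∃[ k ] ∀ {K ρ σ i acc v} → 2 ≤ K →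
    (∀ x → σ -[1+ r x ] ≡ ρ x) → (∀ x → ∣ ρ x ∣ ≤ K) →
    σ -[1+ 1 + d ] ≡ + i → σ -[1+ 2 + d ] ≡ acc → σ -[1+ 3 + d ] ≡ v →
    Poly K a (bits (+ i)) → Poly K b (bits acc) → Poly K c (bits v) →
    Run (stepCode M r d) σ K k (Upd -[1+ 2 + d ] (next M ρ acc i v) σ)
  step-run sum r d a b c = _ , λ 2≤K vs vs≤ e₁ e₂ e₃ p₁ p₂ p₃ →
    run-⇐ (2 + d) 2≤K (ev-op add 2≤K (ev-R (2 + d) 2≤K e₂ p₂) (ev-R (3 + d) 2≤K e₃ p₃))
  step-run last r d a b c = _ , λ 2≤K vs vs≤ e₁ e₂ e₃ p₁ p₂ p₃ →
    run-if 2≤K (ev-R (3 + d) 2≤K e₃ p₃)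
      (λ 0<v → map-post (upd-≡ (sym (select-pos 0<v)))
        (run-⇐ (2 + d) 2≤K (ev-op add 2≤K (ev-R (1 + d) 2≤K e₁ p₁) (ev-lit 1ℤ 2≤K))))
      (λ v≤0 → run skip (poly-const 2≤K 1) (upd (trans e₂ (sym (select-neg v≤0))) (λ _ _ → refl)))
  step-run (prod x) r d a b c = _ , λ {K} {ρ} 2≤K vs vs≤ e₁ e₂ e₃ p₁ p₂ p₃ →
    let product = ev-op mul 2≤K (ev-R (2 + d) 2≤K e₂ p₂) (ev-R (3 + d) 2≤K e₃ p₃)
        cap     = ev-R (r x) 2≤K (vs x) (poly-bits {z = ρ x} small 2≤K (poly-≤ (vs≤ x) (poly-self 2≤K)))
    in run-if 2≤K product
      (λ 0<p → run-if 2≤K (ev-op sub 2≤K (ev-op add 2≤K cap (ev-lit 1ℤ 2≤K)) product)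
        (λ 0<c → map-post (upd-≡ (sym (trans (select-pos 0<p) (select-pos 0<c)))) (run-⇐ (2 + d) 2≤K product))
        (λ c≤0 → map-post (upd-≡ (sym (trans (select-pos 0<p) (select-neg c≤0)))) (run-⇐ (2 + d) 2≤K (ev-lit 0ℤ 2≤K))))
      (λ p≤0 → map-post (upd-≡ (sym (select-neg p≤0))) (run-⇐ (2 + d) 2≤K (ev-lit 0ℤ 2≤K)))

  record LoopInv (d : ℕ) (E : ℤ) (F : ℕ → ℤ) (σ : Memory) (i : ℕ) (σ′ : Memory) : Set where
    constructor loopInv
    field
      framed  : Frame d σ σ′
      limit   : σ′ -[1+ d ] ≡ E
      counter : σ′ -[1+ 1 + d ] ≡ + i
      acc     : σ′ -[1+ 2 + d ] ≡ F i

  private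
    d≢1+d : ∀ {d} → d ≢ 1 + d
    d≢1+d ()
    d≢2+d : ∀ {d} → d ≢ 2 + d
    d≢2+d ()

  0<E-i : ∀ {E i} → i < clamp E → 0ℤ ℤ.< E ℤ.- + i
  0<E-i {+ n} {i} p = subst (0ℤ ℤ.<_) (trans (sym (ℤ.⊖-≥ (<⇒≤ p))) (sym (ℤ.m-n≡m⊖n n i))) (ℤ.+<+ (ℕ.m<n⇒0<n∸m p))
  E-clamp≤0 : ∀ E → E ℤ.- + clamp E ℤ.≤ 0ℤ
  E-clamp≤0 (+ n)    = ℤ.≤-reflexive (ℤ.+-inverseʳ (+ n))
  E-clamp≤0 -[1+ n ] = ℤ.-≤+

  opaque
    -- The exponent is chosen before K, the input and the environment, so it depends on the code
    -- alone. The sizes of intermediate values, which determine the cost, come from `value`.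
    exec : ∀ {τ} (t : Tm τ) r d → (∀ x → r x < d) → ∃[ c ] ∀ {K inp ρ σ} → 2 ≤ K → Bounds K inp ρ → Rep inp ρ r σ →
      Run (code r d t) σ K c (Result d (⟪ t ⟫ inp ρ) σ)
    exec (num z) r d r<d = _ , λ 2≤K B S →
      map-post (λ u → result (frame-upd ≤-refl u) (Upd.at u)) (run-⇐ d 2≤K (ev-lit z 2≤K))
    exec (var x) r d r<d = _ , λ {ρ = ρ} 2≤K B S →
      map-post (λ u → result (frame-upd ≤-refl u) (Upd.at u))
        (run-⇐ d 2≤K (ev-R (r x) 2≤K (vars S x) (poly-bits {z = ρ x} small 2≤K (poly-≤ (env≤ B x) (poly-self 2≤K)))))
    exec (up t) r d r<d = exec t r d r<d
    exec (input t) r d r<d = let _ , E = exec t r d r<d ; _ , V = value-bits t in _ , λ {K} {inp} {ρ} {σ} 2≤K B S →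
      run-⨾ 2≤K (E 2≤K B S) λ {σ₁} (result F e) →
        let at-d = ev-R d 2≤K e (V 2≤K B)
            done : ∀ {σ′ σ″} → Frame d σ σ′ → Upd -[1+ d ] (inp (clamp (⟪ t ⟫ inp ρ))) σ′ σ″ → Result d (inp (clamp (⟪ t ⟫ inp ρ))) σ σ″
            done F u = result (frame-trans F (frame-upd ≤-refl u)) (Upd.at u)
            bits≤ = poly-≤ (inp≤ B (clamp (⟪ t ⟫ inp ρ))) (poly-self 2≤K)
        in run-if 2≤K at-d
          (λ 0<v → map-post (done F) (run-⇐ d 2≤K (ev-reg 2≤K at-d
            (trans (cong σ₁ (clamp-pos 0<v)) (trans (nonneg F _) (inputs S _))) bits≤)))
          (λ v≤0 → map-post (done F) (run-⇐ d 2≤K (ev-reg 2≤K (ev-lit 0ℤ 2≤K)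
            (trans (nonneg F 0) (trans (inputs S 0) (cong inp (clamp-neg v≤0)))) bits≤)))
    exec (op o t u) r d r<d =
      let _ , E = exec t r d r<d ; _ , E′ = exec u r (suc d) (λ x → ℕ.m<n⇒m<1+n (r<d x))
          _ , V = value-bits t ; _ , V′ = value-bits u
      in _ , λ 2≤K B S →
        run-⨾ 2≤K (E 2≤K B S) λ (result F e) →
        run-⨾ 2≤K (E′ 2≤K B (rep-frame r<d F S)) λ (result F′ e′) →
        map-post (λ u → result (frame-trans F (frame-trans (frame-≤ (n≤1+n d) F′) (frame-upd ≤-refl u))) (Upd.at u))
          (run-⇐ d 2≤K (ev-op o 2≤K (ev-R d 2≤K (trans (low F′ ≤-refl) e) (V 2≤K B)) (ev-R (suc d) 2≤K e′ (V′ 2≤K B))))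
    exec (cond t u v) r d r<d =
      let _ , E = exec t r d r<d ; _ , E′ = exec u r d r<d ; _ , E″ = exec v r d r<d ; _ , V = value-bits t
      in _ , λ 2≤K B S →
        run-⨾ 2≤K (E 2≤K B S) λ (result F e) →
        run-if 2≤K (ev-R d 2≤K e (V 2≤K B))
          (λ 0<v → map-post (λ (result F′ e′) → result (frame-trans F F′) (trans e′ (sym (select-pos 0<v)))) (E′ 2≤K B (rep-frame r<d F S)))
          (λ v≤0 → map-post (λ (result F′ e′) → result (frame-trans F F′) (trans e′ (sym (select-neg v≤0)))) (E″ 2≤K B (rep-frame r<d F S)))
    exec (bind x t u) r d r<d =
      let _ , E = exec t r d r<d ; _ , E′ = exec u (r [ x ≔ᵥ d ]) (suc d) (bind-< x r<d (n≤1+n d) ≤-refl)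
          c , V = value t ; _ , V′ = value-bits (bind x t u)
      in _ , λ 2≤K B S →
        run-⨾ 2≤K (E 2≤K B S) λ (result F e) →
        run-⨾ 2≤K (rebase (suc c) (E′ (2≤^ 2≤K c) (bounds-bind x 2≤K B (V 2≤K B)) (rep-bind x e (rep-frame r<d F S)))) λ (result F′ e′) →
        map-post (λ u → result (frame-trans F (frame-trans (frame-≤ (n≤1+n d) F′) (frame-upd ≤-refl u))) (Upd.at u))
          (run-⇐ d 2≤K (ev-R (suc d) 2≤K e′ (V′ 2≤K B)))
    exec (loop {τ} {τ′} M x e t) r d r<d =
      let c , V   = value e ; c′ , V′ = value t ; _ , Vₑ = value-bits e ; _ , Vₗ = value-bits (loop M x e t)
          _ , E   = exec e r d r<d
          _ , E′  = exec t (r [ x ≔ᵥ 1 + d ]) (3 + d) (bind-< x r<d (m≤n+m d 3) (ℕ.m<n⇒m<1+n ≤-refl))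
          _ , St  = step-run M r d _ _ _
      in _ , λ {K} {inp} {ρ} {σ} 2≤K B S →
        let N  = clamp (⟪ e ⟫ inp ρ)
            f  = λ i → ⟪ t ⟫ inp (ρ [ x ≔ᵥ + i ])
            N≤ = poly-≤ (clamp≤∣∣ (⟪ e ⟫ inp ρ)) (V 2≤K B)
            i≤ : ∀ {i} → i ≤ N → Poly K _ (bits (+ i))
            i≤ {i} i≤N = poly-bits {z = + i} small 2≤K (poly-≤ i≤N N≤)
            B′ : ∀ {i} → i < N → Bounds (K ^ suc c) inp (ρ [ x ≔ᵥ + i ])
            B′ i<N = bounds-bind x 2≤K B (poly-≤ (<⇒≤ i<N) N≤)
            f≤ : ∀ {i} → i < N → Poly K (suc c * c′) (mag τ (f i))
            f≤ i<N = poly-^ {a = suc c} (V′ (2≤^ 2≤K c) (B′ i<N))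
            acc≤ : ∀ {i} → i ≤ N → Poly K _ (bits (fold M ρ f i))
            acc≤ {i} i≤N = poly-bits {z = fold M ρ f i} τ′ 2≤K (fold-bound M 2≤K B f N N≤ (λ _ → f≤) i i≤N)
            Inv = LoopInv d (⟪ e ⟫ inp ρ) (fold M ρ f) σ
        in
        run-⨾ 2≤K (E 2≤K B S) λ (result F v) →
        run-⨾ 2≤K (run-⇐ (1 + d) 2≤K (ev-lit 0ℤ 2≤K)) λ u₁ →
        run-⨾ 2≤K (run-⇐ (2 + d) 2≤K (ev-lit (init M) 2≤K)) λ u₂ →
        run-⨾ 2≤K
          (run-while N Inv (λ i → ⟪ e ⟫ inp ρ ℤ.- + i) 2≤K N≤ (0<E-i {⟪ e ⟫ inp ρ}) (E-clamp≤0 (⟪ e ⟫ inp ρ))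
            (λ i≤N (loopInv _ l k _) → ev-op sub 2≤K (ev-R d 2≤K l (Vₑ 2≤K B)) (ev-R (1 + d) 2≤K k (i≤ i≤N)))
            (λ {i} i<N (loopInv F l k a) → let S′ = rep-frame r<d F S in
              run-⨾ 2≤K (rebase (suc c) (E′ (2≤^ 2≤K c) (B′ i<N) (rep-bind x k S′))) λ (result F′ v′) →
              let k′ = trans (low F′ (ℕ.m<n⇒m<1+n ≤-refl)) k
                  S″ = rep-frame r<d (frame-≤ (m≤n+m d 3) F′) S′
              in
              run-⨾ 2≤K (St 2≤K (vars S″) (env≤ B) k′ (trans (low F′ ≤-refl) a) v′
                (i≤ (<⇒≤ i<N)) (acc≤ (<⇒≤ i<N)) (poly-bits {z = f i} τ 2≤K (f≤ i<N))) λ u →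
              map-post (λ u′ → loopInv
                  (frame-trans F (frame-trans (frame-≤ (m≤n+m d 3) F′) (frame-trans (frame-upd (m≤n+m d 2) u) (frame-upd (n≤1+n d) u′))))
                  (trans (Upd.off u′ -[1+ d ] (-[1+]-≢ d≢1+d)) (trans (Upd.off u -[1+ d ] (-[1+]-≢ d≢2+d))
                    (trans (low F′ (ℕ.m<n+m d (s≤s z≤n))) l)))
                  (trans (Upd.at u′) (cong +_ (+-comm i 1)))
                  (trans (Upd.off u′ -[1+ 2 + d ] (-[1+]-≢ λ p → d≢1+d (sym p))) (Upd.at u)))
                (run-⇐ (1 + d) 2≤K (ev-op add 2≤K (ev-R (1 + d) 2≤K (trans (Upd.off u -[1+ 1 + d ] (-[1+]-≢ d≢1+d)) k′) (i≤ (<⇒≤ i<N))) (ev-lit 1ℤ 2≤K))))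
            (loopInv
              (frame-trans F (frame-trans (frame-upd (n≤1+n d) u₁) (frame-upd (m≤n+m d 2) u₂)))
              (trans (Upd.off u₂ -[1+ d ] (-[1+]-≢ d≢2+d)) (trans (Upd.off u₁ -[1+ d ] (-[1+]-≢ d≢1+d)) v))
              (trans (Upd.off u₂ -[1+ 1 + d ] (-[1+]-≢ d≢1+d)) (Upd.at u₁))
              (Upd.at u₂)))
        λ (loopInv F l k a) →
        map-post (λ u → result (frame-trans F (frame-upd ≤-refl u)) (Upd.at u)) (run-⇐ d 2≤K (ev-R (2 + d) 2≤K a (Vₗ 2≤K B)))

open Execution

-- Straight-line programs and repeated squaring.

module Straight where
  open import Data.Nat.Base using (_+_; _*_; _^_; _≤_; _<_)

  opaque
    -- The result of squaring 2 y times: cheap to compute in terms of its own size, yet above all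
    -- bounds of the descent.
    tower : ℕ → ℕ
    tower y = 2 ^ (2 ^ y)

    tower-def : ∀ y → tower y ≡ 2 ^ (2 ^ y)
    tower-def y = refl

  opaque
    unfolding tower

    tower-square : ∀ i → tower i * tower i ≡ tower (suc i)
    tower-square i = trans (sym (ℕ.^-distribˡ-+-* 2 (2 ^ i) (2 ^ i)))
      (cong (2 ^_) (cong (λ s → 2 ^ i + s) (sym (+-identityʳ (2 ^ i)))))

    tower-mono-≤ : ∀ {i j} → i ≤ j → tower i ≤ tower j
    tower-mono-≤ p = ^-monoʳ-≤ 2 (^-monoʳ-≤ 2 p)

    tower-mono-< : ∀ {i j} → i < j → tower i < tower j
    tower-mono-< p = ℕ.^-monoʳ-< 2 ≤-refl (ℕ.^-monoʳ-< 2 ≤-refl p)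

    tower-< : ∀ x → x < tower x
    tower-< x = ℕ.<-trans (n<2^n x) (n<2^n (2 ^ x))

    2≤tower : ∀ x → 2 ≤ tower x
    2≤tower x = ^-monoʳ-≤ 2 {1} {2 ^ x} (ℕ.m^n>0 2 x)

  -- Terms only produce values polynomial in what they are given, so the doubly exponential base and
  -- cap need a construct of their own, `towerOf`.
  data Line : Set where
    set     : ∀ {τ} → Var → Tm τ → Line
    towerOf : Var → Var → Line

  top : ℕ
  top = 24

  home : Var → ℕ
  home = toℕ

  lineCode : Line → Program
  lineCode (set x t)     = code home top t ⨾ home x ⇐ R top
  lineCode (towerOf x y) = top ⇐ lit 0ℤ ⨾ 1 + top ⇐ lit (+ 2) ⨾
    whilePos R (home y) ⊖ R top ⟨ 1 + top ⇐ R (1 + top) ⊗ R (1 + top) ⨾ top ⇐ R top ⊕ lit 1ℤ ⟩ ⨾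
    home x ⇐ R (1 + top)

  lineEnv : Line → Input → Env → Env
  lineEnv (set x t)     inp ρ = ρ [ x ≔ᵥ ⟪ t ⟫ inp ρ ]
  lineEnv (towerOf x y) inp ρ = ρ [ x ≔ᵥ + tower (clamp (ρ y)) ]

  ≔ᵥ-at : ∀ {X : Set} (f : Var → X) x v → (f [ x ≔ᵥ v ]) x ≡ v
  ≔ᵥ-at f x v with x Fin.≟ x
  ... | yes _ = refl
  ... | no ¬p = contradiction refl ¬p

  bounds-set : ∀ {K inp ρ v w} x → Bounds K inp ρ → v ≡ + w → w ≤ K → Bounds K inp (ρ [ x ≔ᵥ v ])
  bounds-set {v = v} x (bounds i e) refl w≤K = bounds i (≔ᵥ-≤ x v e w≤K)

  bounds-line : ∀ {K inp ρ τ} x (t : Tm τ) → Bounds K inp ρ → ∣ ⟪ t ⟫ inp ρ ∣ ≤ K → Bounds K inp (lineEnv (set x t) inp ρ)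
  bounds-line {inp = inp} {ρ} x t (bounds i e) t≤K = bounds i (≔ᵥ-≤ x (⟪ t ⟫ inp ρ) e t≤K)

  home<top : ∀ x → home x < top
  home<top = Fin.toℕ<n

  rep-home : ∀ {inp ρ v σ σ′} x → Upd -[1+ home x ] v σ σ′ → Rep inp ρ home σ → Rep inp (ρ [ x ≔ᵥ v ]) home σ′
  rep-home {ρ = ρ} {v} {σ} {σ′} x (upd at off) (rep i vs) = rep (λ a → trans (off (+ a) λ ()) (i a)) vars′
    where
    vars′ : ∀ y → σ′ -[1+ home y ] ≡ (ρ [ x ≔ᵥ v ]) y
    vars′ y with y Fin.≟ x
    ... | yes refl = at
    ... | no y≢x   = trans (off _ (-[1+]-≢ λ e → y≢x (Fin.toℕ-injective e))) (vs y)

  record TowerInv (inp : Input) (ρ : Env) (i : ℕ) (σ : Memory) : Set where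
    constructor towerInv
    field
      homes   : Rep inp ρ home σ
      counter : σ -[1+ top ] ≡ + i
      acc     : σ -[1+ 1 + top ] ≡ + tower i

  private
    tower-suc : ∀ i → + tower i ℤ.* + tower i ≡ + tower (suc i)
    tower-suc i = trans (sym (ℤ.pos-* (tower i) (tower i))) (cong +_ (tower-square i))

  line-run : ∀ l → ∃[ c ] ∀ {K inp ρ σ} → 2 ≤ K → Bounds K inp ρ → Bounds K inp (lineEnv l inp ρ) → Rep inp ρ home σ →
    Run (lineCode l) σ K c (Rep inp (lineEnv l inp ρ) home)
  line-run (set x t) = let _ , E = exec t home top home<top ; _ , V = value-bits t in _ , λ 2≤K B _ S →
    run-⨾ 2≤K (E 2≤K B S) λ (result F e) →
    map-post (λ u → rep-home x u (rep-frame home<top F S)) (run-⇐ (home x) 2≤K (ev-R top 2≤K e (V 2≤K B)))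
  line-run (towerOf x y) = _ , λ {K} {inp} {ρ} {σ} 2≤K B B′ S →
    let N  = clamp (ρ y)
        y≤ = poly-≤ (env≤ B y) (poly-self 2≤K)
        N≤ = poly-≤ (clamp≤∣∣ (ρ y)) y≤
        i≤ : ∀ {i} → i ≤ N → Poly K _ (bits (+ i))
        i≤ {i} i≤N = poly-bits {z = + i} small 2≤K (poly-≤ i≤N N≤)
        -- Every intermediate square is at most the last one, which K bounds because it is a value
        -- of the final environment.
        acc≤ : ∀ {i} → i ≤ N → Poly K _ (bits (+ tower i))
        acc≤ {i} i≤N = poly-bits {z = + tower i} small 2≤K (poly-≤ (≤-trans (tower-mono-≤ i≤N)
          (subst (λ v → ∣ v ∣ ≤ K) (≔ᵥ-at ρ x (+ tower N)) (env≤ B′ x))) (poly-self 2≤K))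
    in
    run-⨾ 2≤K (run-⇐ top 2≤K (ev-lit 0ℤ 2≤K)) λ u₁ →
    run-⨾ 2≤K (run-⇐ (1 + top) 2≤K (ev-lit (+ 2) 2≤K)) λ u₂ →
    run-⨾ 2≤K
      (run-while N (TowerInv inp ρ) (λ i → ρ y ℤ.- + i) 2≤K N≤ (0<E-i {ρ y}) (E-clamp≤0 (ρ y))
        (λ i≤N (towerInv S k _) → ev-op sub 2≤K (ev-R (home y) 2≤K (vars S y) (poly-bits {z = ρ y} small 2≤K y≤)) (ev-R top 2≤K k (i≤ i≤N)))
        (λ {i} i<N (towerInv S k a) → let acc = ev-R (1 + top) 2≤K a (acc≤ (<⇒≤ i<N)) in
          run-⨾ 2≤K (run-⇐ (1 + top) 2≤K (ev-op mul 2≤K acc acc)) λ u →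
          map-post (λ u′ → towerInv (rep-frame home<top (frame-trans (frame-upd (n≤1+n top) u) (frame-upd ≤-refl u′)) S)
              (trans (Upd.at u′) (cong +_ (+-comm i 1)))
              (trans (Upd.off u′ -[1+ 1 + top ] λ ()) (trans (Upd.at u) (tower-suc i))))
            (run-⇐ top 2≤K (ev-op add 2≤K (ev-R top 2≤K (trans (Upd.off u -[1+ top ] λ ()) k) (i≤ (<⇒≤ i<N))) (ev-lit 1ℤ 2≤K))))
        (towerInv (rep-frame home<top (frame-trans (frame-upd ≤-refl u₁) (frame-upd (n≤1+n top) u₂)) S)
          (trans (Upd.off u₂ -[1+ top ] λ ()) (Upd.at u₁)) (trans (Upd.at u₂) (cong +_ (sym (tower-def 0))))))
    λ (towerInv S _ a) →
    map-post (λ u → rep-home x u S) (run-⇐ (home x) 2≤K (ev-R (1 + top) 2≤K a (acc≤ ≤-refl)))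

  linesCode : List Line → Program
  linesCode []       = skip
  linesCode (l ∷ ls) = lineCode l ⨾ linesCode ls

  linesEnv : List Line → Input → Env → Env
  linesEnv []       inp ρ = ρ
  linesEnv (l ∷ ls) inp ρ = linesEnv ls inp (lineEnv l inp ρ)

  -- The same K has to bound the environment before and after every line. Unlike under `bind`, the
  -- base is then never raised, and each line contributes its own exponent only.
  Within : ℕ → Input → List Line → Env → Set
  Within K inp []       ρ = Bounds K inp ρ
  Within K inp (l ∷ ls) ρ = Bounds K inp ρ × Within K inp ls (lineEnv l inp ρ)

  within-head : ∀ {K inp} ls {ρ} → Within K inp ls ρ → Bounds K inp ρ
  within-head []      B       = B
  within-head (_ ∷ _) (B , _) = B

  record Reaches (K : ℕ) (inp : Input) (Goal : Env → Set) (ls : List Line) (ρ : Env) : Set where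
    constructor reaches
    field
      within : Within K inp ls ρ
      final  : Goal (linesEnv ls inp ρ)

  reach : ∀ {K inp Goal l ls ρ} → Bounds K inp ρ → Reaches K inp Goal ls (lineEnv l inp ρ) → Reaches K inp Goal (l ∷ ls) ρ
  reach B (reaches W f) = reaches (B , W) f

  opaque
    lines-run : ∀ ls → ∃[ c ] ∀ {K inp ρ σ} → 2 ≤ K → Within K inp ls ρ → Rep inp ρ home σ →
      Run (linesCode ls) σ K c (Rep inp (linesEnv ls inp ρ) home)
    lines-run []       = _ , λ 2≤K _ S → run skip (poly-const 2≤K 1) S
    lines-run (l ∷ ls) = let _ , E = line-run l ; _ , E′ = lines-run ls in _ , λ 2≤K (B , W) S →
      run-⨾ 2≤K (E 2≤K B (within-head ls W) S) (E′ 2≤K W)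

  reaches-run : ∀ ls {K inp Goal ρ σ} → 2 ≤ K → Reaches K inp Goal ls ρ → Rep inp ρ home σ →
    Run (linesCode ls) σ K (proj₁ (lines-run ls)) (λ σ′ → ∃[ ρ′ ] Goal ρ′ × Rep inp ρ′ home σ′)
  reaches-run ls {inp = inp} {ρ = ρ} 2≤K (reaches W f) S = map-post (λ S′ → linesEnv ls inp ρ , f , S′) (proj₂ (lines-run ls) 2≤K W S)

-- Truth of terms and the meaning of loops.

module Logic where
  open import Data.Nat.Base using (_+_; _*_; _^_; _≤_; _<_)
  open Algebra.Properties.Semiring.Sum ℤ.+-*-semiring using () renaming (sum to ∑; sum-cong-≗ to ∑-cong)

  infix 4 _⊨_
  record _⊨_ {τ} (s : Input × Env) (t : Tm τ) : Set where
    constructor sat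
    field positive : 0ℤ ℤ.< ⟪ t ⟫ (proj₁ s) (proj₂ s)

  open _⊨_ public

  infixl 6 _⊞_ _⊟_
  infixl 7 _⊠_ _⊡_
  infix  5 _≼_ _≗ₜ_
  infixr 4 _∧ₜ_ _⇒ₜ_
  _⊞_ _⊟_ _⊠_ _⊡_ _≼_ _≗ₜ_ : ∀ {τ} → Tm τ → Tm τ → Tm τ
  _⊞_ = op add
  _⊟_ = op sub
  _⊠_ = op mul
  _⊡_ = op quo
  -- Truth is positivity, and u - t + 1 > 0 says t ≤ u for integers.
  t ≼ u = u ⊟ t ⊞ num 1ℤ
  _∧ₜ_ _⇒ₜ_ : ∀ {σ τ} → Tm σ → Tm τ → Tm τ
  t ∧ₜ u = cond t u (num 0ℤ)
  t ⇒ₜ u = cond t u (num 1ℤ)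
  t ≗ₜ u = t ≼ u ∧ₜ u ≼ t

  -- The inner `cond` negates t, so `last` searches for a counterexample and its result 0 means that
  -- there is none.
  all : ∀ {τ} → Var → Tm small → Tm τ → Tm big
  all x e t = cond (loop last x e (cond t (num {big} 0ℤ) (num 1ℤ))) (num 0ℤ) (num 1ℤ)

  private
    0<1 : 0ℤ ℤ.< 1ℤ
    0<1 = ℤ.+<+ (s≤s z≤n)

    0≮0 : ∀ {X : Set} → 0ℤ ℤ.< 0ℤ → X
    0≮0 p = contradiction p (ℤ.<-irrefl refl)

  module _ {inp : Input} {ρ : Env} where

    ⊨-≼ : ∀ {τ} (t u : Tm τ) → ((inp , ρ) ⊨ t ≼ u) ⇔ (⟪ t ⟫ inp ρ ℤ.≤ ⟪ u ⟫ inp ρ)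
    ⊨-≼ t u = mk⇔ (λ (sat p) → ≤-by _ (gap< p) (e (⟪ t ⟫ inp ρ) (⟪ u ⟫ inp ρ)))
                  (λ p → sat (<-by _ (gap p) (sym (e (⟪ t ⟫ inp ρ) (⟪ u ⟫ inp ρ)))))
      where
      e : ∀ t u → u ℤ.- t ≡ u ℤ.- t ℤ.+ 1ℤ ℤ.- 0ℤ ℤ.- 1ℤ
      e = solve-∀

    ⊨-∧ : ∀ {σ τ} (t : Tm σ) (u : Tm τ) → ((inp , ρ) ⊨ (t ∧ₜ u)) ⇔ ((inp , ρ) ⊨ t × (inp , ρ) ⊨ u)
    ⊨-∧ t u with 0ℤ ℤ.<? ⟪ t ⟫ inp ρ
    ... | yes p = mk⇔ (λ (sat q) → sat p , sat (subst (0ℤ ℤ.<_) (select-pos p) q)) (λ (_ , sat q) → sat (subst (0ℤ ℤ.<_) (sym (select-pos p)) q))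
    ... | no ¬p = mk⇔ (λ (sat q) → 0≮0 (subst (0ℤ ℤ.<_) (select-neg (ℤ.≮⇒≥ ¬p)) q)) (λ (sat p , _) → contradiction p ¬p)

    ⊨-⇒ : ∀ {σ τ} (t : Tm σ) (u : Tm τ) → ((inp , ρ) ⊨ (t ⇒ₜ u)) ⇔ ((inp , ρ) ⊨ t → (inp , ρ) ⊨ u)
    ⊨-⇒ t u with 0ℤ ℤ.<? ⟪ t ⟫ inp ρ
    ... | yes p = mk⇔ (λ (sat q) _ → sat (subst (0ℤ ℤ.<_) (select-pos p) q)) (λ f → sat (subst (0ℤ ℤ.<_) (sym (select-pos p)) (positive (f (sat p)))))
    ... | no ¬p = mk⇔ (λ _ (sat p) → contradiction p ¬p) (λ _ → sat (subst (0ℤ ℤ.<_) (sym (select-neg (ℤ.≮⇒≥ ¬p))) 0<1))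

    ⊨-≗ : ∀ {τ} (t u : Tm τ) → ((inp , ρ) ⊨ t ≗ₜ u) ⇔ (⟪ t ⟫ inp ρ ≡ ⟪ u ⟫ inp ρ)
    ⊨-≗ t u = mk⇔
      (λ p → let a , b = to (⊨-∧ (t ≼ u) (u ≼ t)) p in
        ℤ.≤-antisym (to (⊨-≼ t u) a) (to (⊨-≼ u t) b))
      (λ e → from (⊨-∧ (t ≼ u) (u ≼ t))
        (from (⊨-≼ t u) (ℤ.≤-reflexive e) , from (⊨-≼ u t) (ℤ.≤-reflexive (sym e))))

    fold-last : ∀ {σ} (f : ℕ → ℤ) N →
      (fold {σ} last ρ f N ≡ 0ℤ × (∀ (i : Fin N) → ¬ 0ℤ ℤ.< f (toℕ i))) ⊎
      (∃[ i ] fold {σ} last ρ f N ≡ + suc (toℕ {N} i) × 0ℤ ℤ.< f (toℕ i))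
    fold-last f zero = inj₁ (refl , λ ())
    fold-last {σ} f (suc N) with 0ℤ ℤ.<? f N
    ... | yes p = inj₂ (fromℕ N ,
          trans (select-pos p) (cong +_ (trans (+-comm N 1) (cong suc (sym (Fin.toℕ-fromℕ N))))) ,
          subst (λ i → 0ℤ ℤ.< f i) (sym (Fin.toℕ-fromℕ N)) p)
    ... | no ¬p with fold-last {σ} f N
    ...   | inj₂ (i , e , p) = inj₂ (inject₁ i ,
            trans (select-neg (ℤ.≮⇒≥ ¬p)) (trans e (cong (λ i → + suc i) (sym (Fin.toℕ-inject₁ i)))) ,
            subst (λ i → 0ℤ ℤ.< f i) (sym (Fin.toℕ-inject₁ i)) p)
    ...   | inj₁ (e , ¬q) = inj₁ (trans (select-neg (ℤ.≮⇒≥ ¬p)) e , none)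
      where
      none : ∀ (i : Fin (suc N)) → ¬ 0ℤ ℤ.< f (toℕ i)
      none i p with toℕ i ℕ.≟ N
      ... | yes e = ¬p (subst (λ i → 0ℤ ℤ.< f i) e p)
      ... | no i≢N = ¬q (fromℕ< i<N) (subst (λ i → 0ℤ ℤ.< f i) (sym (Fin.toℕ-fromℕ< i<N)) p)
        where
        i<N = ℕ.≤∧≢⇒< (ℕ.s≤s⁻¹ (Fin.toℕ<n i)) i≢N

  module _ (inp : Input) (ρ : Env) where

    ⟪last⟫ : ∀ {τ} x e (t : Tm τ) {N} → ⟪ e ⟫ inp ρ ≡ + N →
      (⟪ loop last x e t ⟫ inp ρ ≡ 0ℤ × (∀ (i : Fin N) → ¬ (inp , ρ [ x ≔ᵥ + toℕ i ]) ⊨ t)) ⊎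
      (∃[ i ] ⟪ loop last x e t ⟫ inp ρ ≡ + suc (toℕ {N} i) × (inp , ρ [ x ≔ᵥ + toℕ i ]) ⊨ t)
    ⟪last⟫ {τ} x e t {N} eq rewrite eq with fold-last {inp} {ρ} {τ} (λ i → ⟪ t ⟫ inp (ρ [ x ≔ᵥ + i ])) N
    ... | inj₁ (z , none)  = inj₁ (z , λ i (sat p) → none i p)
    ... | inj₂ (i , z , p) = inj₂ (i , z , sat p)

    ⟪sum⟫ : ∀ {τ} x e (t : Tm τ) {N} → ⟪ e ⟫ inp ρ ≡ + N →
      ⟪ loop sum x e t ⟫ inp ρ ≡ ∑< N (λ i → ⟪ t ⟫ inp (ρ [ x ≔ᵥ + i ]))
    ⟪sum⟫ {τ} x e t {N} eq rewrite eq = go (λ i → ⟪ t ⟫ inp (ρ [ x ≔ᵥ + i ])) N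
      where
      go : ∀ f N → fold {τ} sum ρ f N ≡ ∑< N f
      go f zero    = refl
      go f (suc N) = cong (ℤ._+ f N) (go f N)

    ⟪∑⟫ : ∀ {τ} x e (t : Tm τ) {N} {g : Vector ℤ N} → ⟪ e ⟫ inp ρ ≡ + N →
      (∀ i → ⟪ t ⟫ inp (ρ [ x ≔ᵥ + toℕ i ]) ≡ g i) → ⟪ loop sum x e t ⟫ inp ρ ≡ ∑ g
    ⟪∑⟫ x e t {N} eq h = trans (⟪sum⟫ x e t eq) (trans (sym (sum-∑< N _)) (∑-cong h))

    -- All partial powers are positive and at most B ^ N ≤ F, so the cap is never hit.
    ⟪prod⟫ : ∀ {F B N} x y e t → ρ x ≡ + F → 1 ≤ B → B ^ N ≤ F → ⟪ e ⟫ inp ρ ≡ + N →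
      (∀ i → ⟪ t ⟫ inp (ρ [ y ≔ᵥ + i ]) ≡ + B) → ⟪ loop (prod x) y e t ⟫ inp ρ ≡ + (B ^ N)
    ⟪prod⟫ {F} {B} {N} x y e t x= 1≤B ≤F eq t= rewrite eq = go N ≤F
      where
      f = λ i → ⟪ t ⟫ inp (ρ [ y ≔ᵥ + i ])
      go : ∀ i → B ^ i ≤ F → fold (prod x) ρ f i ≡ + (B ^ i)
      go zero    _  = refl
      go (suc i) ≤F = trans (cong₂ (λ v X → select v (select (X ℤ.+ 1ℤ ℤ.- v) v 0ℤ) 0ℤ) step x=)
        (trans (select-pos (ℤ.+<+ (ℕ.m^n>0 B ⦃ >-nonZero 1≤B ⦄ (suc i)))) (select-pos {z = + F ℤ.+ 1ℤ ℤ.- + (B ^ suc i)} (<-by _ (gap (ℤ.+≤+ ≤F)) (ring (+ F) (+ (B ^ suc i))))))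
        where
        step : fold (prod x) ρ f i ℤ.* f i ≡ + (B ^ suc i)
        step = trans (cong₂ ℤ._*_ (go i (≤-trans (m≤n*m (B ^ i) B ⦃ >-nonZero 1≤B ⦄) ≤F)) (t= i))
          (trans (sym (ℤ.pos-* (B ^ i) B)) (cong +_ (ℕ.*-comm (B ^ i) B)))
        ring : ∀ F p → F ℤ.+ 1ℤ ℤ.- p ℤ.- 0ℤ ℤ.- 1ℤ ≡ F ℤ.- p
        ring = solve-∀

  module _ {inp : Input} {ρ : Env} where

    ⊨-all : ∀ {τ} x e (t : Tm τ) {N} → ⟪ e ⟫ inp ρ ≡ + N →
      ((inp , ρ) ⊨ all x e t) ⇔ (∀ (i : Fin N) → (inp , ρ [ x ≔ᵥ + toℕ i ]) ⊨ t)
    ⊨-all {τ} x e t {N} eq with ⟪last⟫ inp ρ x e (cond t (num {big} 0ℤ) (num 1ℤ)) eq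
    ... | inj₁ (z , none) = mk⇔ (λ _ i → holdsAt i) (λ _ → sat (subst (0ℤ ℤ.<_) (sym (cong (λ v → select v 0ℤ 1ℤ) z)) 0<1))
      where
      holdsAt : ∀ (i : Fin N) → (inp , ρ [ x ≔ᵥ + toℕ i ]) ⊨ t
      holdsAt i with 0ℤ ℤ.<? ⟪ t ⟫ inp (ρ [ x ≔ᵥ + toℕ i ])
      ... | yes p = sat p
      ... | no ¬p = contradiction (sat (subst (0ℤ ℤ.<_) (sym (select-neg (ℤ.≮⇒≥ ¬p))) 0<1)) (none i)
    ... | inj₂ (i , z , sat p) = mk⇔ (λ (sat q) → 0≮0 (subst (0ℤ ℤ.<_) (cong (λ v → select v 0ℤ 1ℤ) z) q))
                                 (λ f → 0≮0 (subst (0ℤ ℤ.<_) (select-pos (positive (f i))) p))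

  -- The index is reported plus one, which leaves 0 free for failure.
  data Selects {N} (X : Fin N → Set) (z : ℤ) : Set where
    nothingFound : z ≡ 0ℤ → (∀ i → ¬ X i) → Selects X z
    found : ∀ i → z ≡ + suc (toℕ i) → X i → Selects X z

  last-selects : ∀ {τ} inp ρ x e (t : Tm τ) {N} {X : Fin N → Set} → ⟪ e ⟫ inp ρ ≡ + N →
    (∀ i → ((inp , ρ [ x ≔ᵥ + toℕ i ]) ⊨ t) ⇔ X i) → Selects X (⟪ loop last x e t ⟫ inp ρ)
  last-selects inp ρ x e t e= t⇔ with ⟪last⟫ inp ρ x e t e=
  ... | inj₁ (z= , ¬p)    = nothingFound z= λ i p → ¬p i (from (t⇔ i) p)
  ... | inj₂ (i , z= , p) = found i z= (to (t⇔ i) p)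

  _∶_⇓_ : ∀ {τ} → Input × Env → Tm τ → ℕ → Set
  (inp , ρ) ∶ t ⇓ a = ⟪ t ⟫ inp ρ ≡ + a

  div-pos : ∀ a b .⦃ _ : NonZero b ⦄ → (+ a) div (+ b) ≡ + (a ℕ./ b)
  div-pos a (suc b) = ℤ.div-pos-is-/ℕ (+ a) (suc b)

  module _ (inp : Input) (ρ : Env) where

    ⇓-⊞ : ∀ {τ} (t u : Tm τ) {a b} → (inp , ρ) ∶ t ⇓ a → (inp , ρ) ∶ u ⇓ b → (inp , ρ) ∶ t ⊞ u ⇓ (a ℕ.+ b)
    ⇓-⊞ t u = cong₂ ℤ._+_

    ⇓-⊠ : ∀ {τ} (t u : Tm τ) {a b} → (inp , ρ) ∶ t ⇓ a → (inp , ρ) ∶ u ⇓ b → (inp , ρ) ∶ t ⊠ u ⇓ (a ℕ.* b)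
    ⇓-⊠ t u {a} {b} p q = trans (cong₂ ℤ._*_ p q) (sym (ℤ.pos-* a b))

    ⟪input⟫ : ∀ {τ} (t : Tm τ) {a} → (inp , ρ) ∶ t ⇓ a → ⟪ input t ⟫ inp ρ ≡ inp a
    ⟪input⟫ t = cong (λ v → inp (clamp v))

  ⟪bind⟫ : ∀ {τ} inp ρ x t (u : Tm τ) {z} → ⟪ u ⟫ inp (ρ [ x ≔ᵥ ⟪ t ⟫ inp ρ ]) ≡ z → ⟪ bind x t u ⟫ inp ρ ≡ z
  ⟪bind⟫ inp ρ x t u eq = eq

  ⊨-bind : ∀ {τ} inp ρ x t (u : Tm τ) {X : Set} →
    ((inp , ρ [ x ≔ᵥ ⟪ t ⟫ inp ρ ]) ⊨ u) ⇔ X → ((inp , ρ) ⊨ bind x t u) ⇔ X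
  ⊨-bind inp ρ x t u eq = mk⇔ (λ (sat p) → to eq (sat p)) (λ q → sat (positive (from eq q)))

open Straight
open Logic

-- Digit expansions.

module Digits where
  open import Data.Nat.Base using (_+_; _*_; _^_; _≤_; _<_; _/_; _%_; NonZero)

  module _ (B : ℕ) ⦃ _ : NonZero B ⦄ where

    digit : ℕ → ℕ → ℕ
    digit k p = _/_ k (B ^ p) ⦃ ℕ.m^n≢0 B p ⦄ % B

    -- Horner's scheme: g 0 is the lowest digit, and a code of the remaining ones is multiplied by
    -- B.
    encode : ∀ (g : ℕ → ℕ) → (∀ p → g p < B) → ∀ P → ∃[ k ] k < B ^ P × (∀ p → p < P → digit k p ≡ g p)
    encode g g<B zero    = 0 , s≤s z≤n , λ _ ()
    encode g g<B (suc P) with encode (λ p → g (suc p)) (λ p → g<B (suc p)) P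
    ... | k , k<B^P , digits = g 0 + k * B , fits , digits′
      where
      fits : g 0 + k * B < B * B ^ P
      fits = <-≤-trans (ℕ.+-monoˡ-< (k * B) (g<B 0)) (≤-trans (*-monoˡ-≤ B k<B^P) (≤-reflexive (ℕ.*-comm (B ^ P) B)))
      quotient : (g 0 + k * B) / B ≡ k
      quotient = trans (ℕ.+-distrib-/-∣ʳ (g 0) (ℕ.n∣m*n k)) (cong₂ _+_ (ℕ.m<n⇒m/n≡0 (g<B 0)) (ℕ.m*n/n≡m k B))
      digits′ : ∀ p → p < suc P → digit (g 0 + k * B) p ≡ g p
      digits′ zero    _ = trans (cong (_% B) (ℕ.n/1≡n (g 0 + k * B))) (trans (ℕ.[m+kn]%n≡m%n (g 0) k B) (ℕ.m<n⇒m%n≡m (g<B 0)))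
      digits′ (suc p) p<P = trans (cong (_% B) (trans (sym (ℕ.m/n/o≡m/[n*o] (g 0 + k * B) B (B ^ p) ⦃ _ ⦄ ⦃ ℕ.m^n≢0 B p ⦄ ⦃ ℕ.m^n≢0 B (suc p) ⦄)) (cong (λ q → _/_ q (B ^ p) ⦃ ℕ.m^n≢0 B p ⦄) quotient)))
        (digits p (ℕ.s≤s⁻¹ p<P))

-- Positions of the data in the input registers.

module Layout where
  open import Data.Nat.Base using (_+_; _*_)

  initial-skip : ∀ (xs zs : List ℤ) k → initial (xs ++ zs) (+ (List.length xs + k)) ≡ initial zs (+ k)
  initial-skip []       zs k = refl
  initial-skip (x ∷ xs) zs k = initial-skip xs zs k

  initial-tabulate : ∀ {n} (f : Fin n → ℤ) zs i → initial (List.tabulate f ++ zs) (+ toℕ i) ≡ f i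
  initial-tabulate f zs zero    = refl
  initial-tabulate f zs (suc i) = initial-tabulate (λ i → f (suc i)) zs i

  initial-entries : ∀ {m n} (M : Matrix m n) zs i j → initial (entries M ++ zs) (+ (toℕ i * n + toℕ j)) ≡ M i j
  initial-entries {suc m} {n} M zs i j rewrite List.++-assoc (List.tabulate (M zero)) (entries (λ i → M (suc i))) zs with i
  ... | zero  = initial-tabulate (M zero) _ j
  ... | suc i = trans
    (cong (λ k → initial (List.tabulate (M zero) ++ entries (λ i → M (suc i)) ++ zs) (+ k))
      (trans (ℕ.+-assoc n (toℕ i * n) (toℕ j)) (cong (_+ (toℕ i * n + toℕ j)) (sym (List.length-tabulate (M zero))))))
    (trans (initial-skip (List.tabulate (M zero)) _ _) (initial-entries (λ i → M (suc i)) zs i j))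

  length-entries : ∀ {m n} (M : Matrix m n) → List.length (entries M) ≡ m * n
  length-entries {zero}      M = refl
  length-entries {suc m} {n} M = trans (List.length-++ (List.tabulate (M zero)))
    (cong₂ _+_ (List.length-tabulate (M zero)) (length-entries (λ i → M (suc i))))

  initial-All : ∀ {P : ℤ → Set} {zs} → P 0ℤ → All P zs → ∀ a → P (initial zs (+ a))
  initial-All p []       a       = p
  initial-All p (q ∷ qs) zero    = q
  initial-All p (q ∷ qs) (suc a) = initial-All p qs a

  All-initial⁻ : ∀ {L L′ : List ℤ} {P : ℤ → Set} {a} → All P L → a ℕ.< List.length L → P (initial (L ++ L′) (+ a))
  All-initial⁻ {a = zero}  (p ∷ _)  _ = p
  All-initial⁻ {a = suc a} (_ ∷ ps) q = All-initial⁻ ps (ℕ.s≤s⁻¹ q)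

  All-initial⁺ : ∀ {L L′ : List ℤ} {P : ℤ → Set} → (∀ a → a ℕ.< List.length L → P (initial (L ++ L′) (+ a))) → All P L
  All-initial⁺ {[]}         h = []
  All-initial⁺ {_ ∷ L} {L′} h = h 0 (s≤s z≤n) ∷ All-initial⁺ {L} {L′} (λ a p → h (suc a) (s≤s p))

  All-entries : ∀ {P : ℤ → Set} {m n} (M : Matrix m n) → (∀ i j → P (M i j)) → All P (entries M)
  All-entries M p = All.concat⁺ (All.tabulate⁺ λ i → All.tabulate⁺ (p i))

-- The program.

module Algorithm where

  -- The numbers below 9 are reserved for data that stay fixed during the enumeration; `bindᵍ`
  -- relies on this.
  vn vm vα vr vB vF vH vT vN vC vG vk vk′ vj vi vi′ vc vp vl vq vz : Var
  vn  = # 0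
  vm  = # 1
  vα  = # 2
  vr  = # 3
  vB  = # 4
  vF  = # 5
  vH  = # 6
  vT  = # 7
  vN  = # 8
  vC  = # 9
  vG  = # 10
  vk  = # 11
  vk′ = # 12
  vj  = # 13
  vi  = # 14
  vi′ = # 15
  vc  = # 16
  vp  = # 17
  vl  = # 18
  vq  = # 19
  vz  = # 20

  n̂ m̂ : Tm small
  n̂ = var vn
  m̂ = var vm

  lit′ : ℕ → Tm small
  lit′ a = num (+ a)

  powerOf : Tm small → Tm small
  powerOf e = loop (prod vF) vp e (var vB)

  -- Digit p of k, as a remainder modulo B obtained by division. Subtracting H, half of B, makes
  -- digits signed.
  entry : Tm small → Tm small → Tm small
  entry k p = q ⊟ var vB ⊠ (q ⊡ var vB) ⊟ var vH
    where q = k ⊡ powerOf p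

  -- Registers 0 and 1 hold n and m; Q and A follow row by row, then b.
  Qₜ Aₜ : Tm small → Tm small → Tm big
  Qₜ i j = input (lit′ 2 ⊞ (i ⊠ n̂ ⊞ j))
  Aₜ i j = input (lit′ 2 ⊞ (n̂ ⊠ n̂ ⊞ (i ⊠ n̂ ⊞ j)))

  bₜ : Tm small → Tm big
  bₜ i = input (lit′ 2 ⊞ (n̂ ⊠ n̂ ⊞ (m̂ ⊠ n̂ ⊞ i)))

  rowIs : Tm big
  rowIs = all vl n̂ (Aₜ (var vi) (var vl) ≗ₜ up (entry (var vc) (var vl)))

  isLeast : Tm big
  isLeast = rowIs ∧ₜ all vi′ m̂ (bind vi (var vi′) rowIs ⇒ₜ bₜ (var vi) ≼ bₜ (var vi′))

  -- Grouping equal rows makes the number of candidates independent of m.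
  βₜ : Tm big
  βₜ = bind vz (loop last vi m̂ isLeast) (cond (var vz) (bₜ (var vz ⊟ lit′ 1)) (num 0ℤ))

  -- The division by digit 0, the denominator D, is exact whenever the code stems from a relation D
  -- x = w + Σ u β.
  xₜ : Tm big
  xₜ = (up (entry (var vk) (lit′ 1 ⊞ var vj))
      ⊞ loop sum vc (var vT)
          (up (entry (var vk) (lit′ 1 ⊞ (n̂ ⊞ (n̂ ⊞ (var vj ⊠ var vT ⊞ var vc))))) ⊠ βₜ))
    ⊡ up (entry (var vk) (lit′ 0))

  yₜ : Var → Tm big
  yₜ v = up (entry (var vk) (lit′ 1 ⊞ (n̂ ⊞ var v)))

  quadratic : Tm big → Tm big → Tm big
  quadratic s t = loop sum vi n̂ (loop sum vq n̂ (s ⊠ Qₜ (var vi) (var vq) ⊠ t))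

  leastBy : Tm big → Tm big → Tm big
  leastBy f g = f ∧ₜ all vk′ (var vN) (bind vk (var vk′) f ⇒ₜ g ≼ bind vk (var vk′) g)

  feasible recession certificate optimum objectiveₜ : Tm big
  feasible    = all vi m̂ (loop sum vj n̂ (Aₜ (var vi) (var vj) ⊠ xₜ) ≼ bₜ (var vi))
  recession   = all vi m̂ (loop sum vj n̂ (Aₜ (var vi) (var vj) ⊠ yₜ vj) ≼ num 0ℤ)
  certificate = feasible ∧ₜ recession ∧ₜ quadratic (yₜ vi) (yₜ vq) ≼ num 0ℤ
                ∧ₜ quadratic (yₜ vi) (bind vj (var vq) xₜ) ≼ num -[1+ 0 ]
  objectiveₜ  = quadratic (bind vj (var vi) xₜ) (bind vj (var vq) xₜ)
  optimum     = leastBy feasible objectiveₜ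

  ∣_∣ₜ : Tm big → Tm big
  ∣ t ∣ₜ = cond t t (num 0ℤ ⊟ t)

  coefficients : Tm small
  coefficients = n̂ ⊠ n̂ ⊞ m̂ ⊠ n̂

  dominant : Tm big
  dominant = all vi′ coefficients (∣ input (lit′ 2 ⊞ var vi′) ∣ₜ ≼ ∣ input (lit′ 2 ⊞ var vi) ∣ₜ)

  -- No loop mode takes maxima, so α is read at an index whose entry dominates all others. As `vz`
  -- is that index plus one, the offset is 1 instead of 2; the default 0 is the maximum when there
  -- are no coefficients.
  αₜ : Tm big
  αₜ = bind vz (loop last vi coefficients dominant) (cond (var vz) ∣ input (lit′ 1 ⊞ var vz) ∣ₜ (num 0ℤ))

  rₜ : Tm small
  rₜ = lit′ 4 ⊠ ((lit′ 1 ⊞ n̂) ⊠ (lit′ 1 ⊞ n̂) ⊠ (lit′ 1 ⊞ var vα)) ⊞ lit′ 6 ⊠ n̂ ⊞ lit′ 5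

  lineH lineT lineN lineC lineG : Line
  lineH = set vH (var vB ⊡ lit′ 2)
  lineT = set vT (powerOf n̂)
  lineN = set vN (powerOf (lit′ 1 ⊞ (n̂ ⊞ (n̂ ⊞ n̂ ⊠ var vT))))
  lineC = set vC (loop last vk (var vN) certificate)
  lineG = set vG (loop last vk (var vN) optimum)

  search : List Line
  search = lineH ∷ lineT ∷ lineN ∷ lineC ∷ lineG ∷ []

  -- The continuation is a parameter because the program that computes f begins in the same way.
  sizing : List Line → List Line
  sizing ls = set vr rₜ ∷ towerOf vB vr ∷ towerOf vF vB ∷ ls

  prelude : List Line
  prelude = set vn (input (lit′ 0)) ∷ set vm (input (lit′ 1)) ∷ set vα αₜ ∷ sizing search

open Digits
open Layout
open Algorithm

-- Choice of the digit base and of the cap.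

module Sizes where
  open import Data.Nat.Base using (_+_; _*_; _^_; _≤_; _<_; _/_)

  κ : ℕ → ℕ → ℕ
  κ n α = suc n * suc n * suc α

  -- Every elimination raises the bound 4 κ to its fifth power; n eliminations,
  -- one more power for the row yQ, and n eliminations again give
  -- (4 κ) ^ 5 ^ (2 n + 1) ≤ tower (4 κ + 6 n + 3).
  opaque
    rank : ℕ → ℕ → ℕ
    rank n α = 4 * κ n α + 6 * n + 5

    rank-def : ∀ n α → rank n α ≡ 4 * κ n α + 6 * n + 5
    rank-def n α = refl

  -- These are the digit base B, the cap F on all powers formed, which also bounds the number of
  -- codes, and the shift H. As B is an even power of two, it equals H + H.
  base bound half : ℕ → ℕ → ℕ
  base n α  = tower (rank n α)
  bound n α = tower (base n α)
  half n α  = base n α / 2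

  base≡half+half : ∀ n α → base n α ≡ half n α + half n α
  base≡half+half n α = subst (λ t → t ≡ t / 2 + t / 2) (sym (tower-def (rank n α))) (even (2 ^ rank n α) (ℕ.m^n>0 2 (rank n α)))
    where
    even : ∀ e → 0 < e → 2 ^ e ≡ (2 ^ e) / 2 + (2 ^ e) / 2
    even (suc e) _ = trans (cong (λ s → 2 ^ e + s) (+-identityʳ (2 ^ e))) (sym (cong₂ _+_ q q))
      where
      q : (2 * 2 ^ e) / 2 ≡ 2 ^ e
      q = trans (cong (_/ 2) (ℕ.*-comm 2 (2 ^ e))) (ℕ.m*n/n≡m (2 ^ e) 2)

  -- One level more squares the tower, and the second factor is at least the 2 lost by halving.
  tower≤half : ∀ n α {x} → suc x ≤ rank n α → tower x ≤ half n α
  tower≤half n α {x} p = ℕ.*-cancelʳ-≤ (tower x) (half n α) 2 (≤-trans (*-monoʳ-≤ (tower x) (2≤tower x))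
    (≤-trans (≤-trans (≤-reflexive (tower-square x)) (tower-mono-≤ p)) (≤-reflexive (trans (base≡half+half n α) (double (half n α))))))
    where
    double : ∀ h → h + h ≡ h * 2
    double = ℕ-Ring.solve-∀

  -- Replacing M by 2 ^ M and 5 by 2 ^ 3 turns the iterated power into the tower of M + 6 n + 3. Two
  -- further levels, for strictness and for halving, explain the 5 in `rank`.
  final-bound : ∀ n α → (((4 * κ n α) ^ (5 ^ n)) ^ 5) ^ (5 ^ n) < half n α
  final-bound n α = begin-strict
    ((M ^ (5 ^ n)) ^ 5) ^ (5 ^ n)  ≡⟨ cong (_^ (5 ^ n)) (ℕ.^-*-assoc M (5 ^ n) 5) ⟩
    (M ^ (5 ^ n * 5)) ^ (5 ^ n)  ≡⟨ ℕ.^-*-assoc M (5 ^ n * 5) (5 ^ n) ⟩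
    M ^ (5 ^ n * 5 * 5 ^ n)  ≤⟨ ℕ.^-monoˡ-≤ (5 ^ n * 5 * 5 ^ n) (<⇒≤ (n<2^n M)) ⟩
    (2 ^ M) ^ (5 ^ n * 5 * 5 ^ n)  ≡⟨ ℕ.^-*-assoc 2 M (5 ^ n * 5 * 5 ^ n) ⟩
    2 ^ (M * (5 ^ n * 5 * 5 ^ n))  ≤⟨ ^-monoʳ-≤ 2 (ℕ.*-mono-≤ (<⇒≤ (n<2^n M)) (ℕ.*-mono-≤ (ℕ.*-mono-≤ 5^n≤ 5≤8) 5^n≤)) ⟩
    2 ^ (2 ^ M * (2 ^ (3 * n) * 2 ^ 3 * 2 ^ (3 * n)))  ≡⟨ trans (cong (2 ^_) exponent) (sym (tower-def (M + 6 * n + 3))) ⟩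
    tower (M + 6 * n + 3)  <⟨ tower-mono-< (ℕ.n<1+n (M + 6 * n + 3)) ⟩
    tower (suc (M + 6 * n + 3))  ≤⟨ tower≤half n α (≤-reflexive (trans (e (M + 6 * n)) (sym (rank-def n α)))) ⟩
    half n α  ∎
    where
    open ℕ.≤-Reasoning
    M = 4 * κ n α
    5≤8 : 5 ≤ 2 ^ 3
    5≤8 = m≤m+n 5 3
    5^n≤ : 5 ^ n ≤ 2 ^ (3 * n)
    5^n≤ = ≤-trans (ℕ.^-monoˡ-≤ n 5≤8) (≤-reflexive (ℕ.^-*-assoc 2 3 n))
    exponent : 2 ^ M * (2 ^ (3 * n) * 2 ^ 3 * 2 ^ (3 * n)) ≡ 2 ^ (M + 6 * n + 3)
    exponent = trans (cong (λ s → 2 ^ M * (s * 2 ^ (3 * n))) (sym (ℕ.^-distribˡ-+-* 2 (3 * n) 3)))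
      (trans (cong (2 ^ M *_) (sym (ℕ.^-distribˡ-+-* 2 (3 * n + 3) (3 * n))))
        (trans (sym (ℕ.^-distribˡ-+-* 2 M (3 * n + 3 + 3 * n))) (cong (2 ^_) (e′ M n))))
      where
      e′ : ∀ M n → M + (3 * n + 3 + 3 * n) ≡ M + 6 * n + 3
      e′ = ℕ-Ring.solve-∀
    e : ∀ s → suc (suc (s + 3)) ≡ s + 5
    e = ℕ-Ring.solve-∀

  α<rank : ∀ n α → suc α < rank n α
  α<rank n α = ≤-trans (s≤s (≤-trans (≤-trans (m≤n*m (suc α) (suc n * suc n)) (m≤n*m (κ n α) 4)) (m≤m+n (4 * κ n α) (6 * n))))
    (≤-trans (≤-reflexive (+-comm 1 _)) (≤-trans (+-monoʳ-≤ (4 * κ n α + 6 * n) (s≤s z≤n)) (≤-reflexive (sym (rank-def n α)))))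

  α<half : ∀ n α → α < half n α
  α<half n α = <-≤-trans (tower-< α) (tower≤half n α (<⇒≤ (α<rank n α)))

  6n+5≤rank : ∀ n α → 6 * n + 5 ≤ rank n α
  6n+5≤rank n α = ≤-trans (+-monoˡ-≤ 5 (m≤n+m (6 * n) (4 * κ n α))) (≤-reflexive (sym (rank-def n α)))

  n≤rank : ∀ n α → n ≤ rank n α
  n≤rank n α = ≤-trans (m≤n*m n 6) (≤-trans (m≤m+n (6 * n) 5) (6n+5≤rank n α))

  rank≤base : ∀ n α → rank n α ≤ base n α
  rank≤base n α = <⇒≤ (tower-< (rank n α))

  base≤bound : ∀ n α → base n α ≤ bound n α
  base≤bound n α = <⇒≤ (tower-< (base n α))

  -- With B = 2 ^ (2 ^ r) and P digits it suffices that 2 ^ r P ≤ 2 ^ B. Since P ≤ 4 ^ n B ^ n, the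
  -- exponent of 2 on the left is at most r + 2 n + 2 ^ r n, which is below B.
  code-bound : ∀ n α → base n α ^ (1 + (n + (n + n * base n α ^ n))) ≤ bound n α
  code-bound n α = begin
    B ^ (1 + (n + (n + n * B ^ n)))  ≡⟨ cong (_^ (1 + (n + (n + n * B ^ n)))) B≡ ⟩
    (2 ^ (2 ^ r)) ^ (1 + (n + (n + n * B ^ n)))  ≡⟨ ℕ.^-*-assoc 2 (2 ^ r) (1 + (n + (n + n * B ^ n))) ⟩
    2 ^ (2 ^ r * (1 + (n + (n + n * B ^ n))))  ≤⟨ ^-monoʳ-≤ 2 exponent ⟩
    2 ^ (2 ^ B)  ≡⟨ sym (tower-def B) ⟩
    bound n α  ∎
    where
    open ℕ.≤-Reasoning
    r = rank n α
    B = base n α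
    B≡ : B ≡ 2 ^ (2 ^ r)
    B≡ = tower-def r
    1≤B^n : 1 ≤ B ^ n
    1≤B^n = ℕ.m^n>0 B ⦃ >-nonZero (≤-trans (s≤s z≤n) (2≤tower r)) ⦄ n
    3n+1≤4^n : ∀ n → 1 + (n + (n + n)) ≤ 2 ^ (2 * n)
    3n+1≤4^n zero    = ≤-refl
    3n+1≤4^n (suc n) = ≤-trans (m≤m+n _ (n * 9)) (≤-trans (≤-reflexive (e n)) (≤-trans (*-monoʳ-≤ 4 (3n+1≤4^n n)) (≤-reflexive (e′ n))))
      where
      e : ∀ n → 1 + (suc n + (suc n + suc n)) + n * 9 ≡ 4 * (1 + (n + (n + n)))
      e = ℕ-Ring.solve-∀
      e′ : ∀ n → 4 * 2 ^ (2 * n) ≡ 2 ^ (2 * suc n)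
      e′ n = trans (sym (ℕ.^-distribˡ-+-* 2 2 (2 * n))) (cong (2 ^_) (sym (ℕ.*-suc 2 n)))
    P≤ : 1 + (n + (n + n * B ^ n)) ≤ 2 ^ (2 * n) * B ^ n
    P≤ = ≤-trans (+-mono-≤ 1≤B^n (+-mono-≤ (m≤m*n n (B ^ n) ⦃ >-nonZero 1≤B^n ⦄)
        (+-monoˡ-≤ (n * B ^ n) (m≤m*n n (B ^ n) ⦃ >-nonZero 1≤B^n ⦄))))
      (≤-trans (≤-reflexive (e n (B ^ n))) (*-monoˡ-≤ (B ^ n) (3n+1≤4^n n)))
      where
      e : ∀ n T → T + (n * T + (n * T + n * T)) ≡ (1 + (n + (n + n))) * T
      e = ℕ-Ring.solve-∀
    r≤2^r : r ≤ 2 ^ r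
    r≤2^r = <⇒≤ (n<2^n r)
    2n≤2^r : 2 * n ≤ 2 ^ r
    2n≤2^r = ≤-trans (≤-trans (*-monoˡ-≤ n {2} {6} (s≤s (s≤s z≤n))) (≤-trans (m≤m+n (6 * n) 5) (6n+5≤rank n α))) r≤2^r
    2k≤2^k : ∀ k → 1 ≤ k → k + k ≤ 2 ^ k
    2k≤2^k (suc k) _ = ≤-trans (+-mono-≤ (n<2^n k) (n<2^n k)) (≤-reflexive (cong (λ s → 2 ^ k + s) (sym (+-identityʳ (2 ^ k)))))
    sum≤ : r + 2 * n + 2 ^ r * n ≤ B
    sum≤ = begin
      r + 2 * n + 2 ^ r * n  ≤⟨ +-monoˡ-≤ (2 ^ r * n) (+-mono-≤ r≤2^r 2n≤2^r) ⟩
      2 ^ r + 2 ^ r + 2 ^ r * n  ≡⟨ e (2 ^ r) n ⟩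
      2 ^ r * suc (suc n)  ≤⟨ *-monoʳ-≤ (2 ^ r) (n<2^n (suc n)) ⟩
      2 ^ r * 2 ^ suc n  ≡⟨ sym (ℕ.^-distribˡ-+-* 2 r (suc n)) ⟩
      2 ^ (r + suc n)  ≤⟨ ^-monoʳ-≤ 2 (≤-trans (+-monoʳ-≤ r n<r) (2k≤2^k r (≤-trans (s≤s z≤n) n<r))) ⟩
      2 ^ (2 ^ r)  ≡⟨ sym B≡ ⟩
      B  ∎
      where
      e : ∀ x n → x + x + x * n ≡ x * suc (suc n)
      e = ℕ-Ring.solve-∀
      n<r : n < r
      n<r = ≤-trans (≤-trans (s≤s (m≤n*m n 6)) (≤-trans (≤-reflexive (+-comm 1 (6 * n))) (+-monoʳ-≤ (6 * n) {1} {5} (s≤s z≤n)))) (6n+5≤rank n α)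
    exponent : 2 ^ r * (1 + (n + (n + n * B ^ n))) ≤ 2 ^ B
    exponent = begin
      2 ^ r * (1 + (n + (n + n * B ^ n)))  ≤⟨ *-monoʳ-≤ (2 ^ r) P≤ ⟩
      2 ^ r * (2 ^ (2 * n) * B ^ n)  ≡⟨ cong (λ s → 2 ^ r * (2 ^ (2 * n) * s)) (trans (cong (_^ n) B≡) (ℕ.^-*-assoc 2 (2 ^ r) n)) ⟩
      2 ^ r * (2 ^ (2 * n) * 2 ^ (2 ^ r * n)) ≡⟨ sym (ℕ.*-assoc (2 ^ r) (2 ^ (2 * n)) _) ⟩
      2 ^ r * 2 ^ (2 * n) * 2 ^ (2 ^ r * n) ≡⟨ cong (_* 2 ^ (2 ^ r * n)) (sym (ℕ.^-distribˡ-+-* 2 r (2 * n))) ⟩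
      2 ^ (r + 2 * n) * 2 ^ (2 ^ r * n)  ≡⟨ sym (ℕ.^-distribˡ-+-* 2 (r + 2 * n) (2 ^ r * n)) ⟩
      2 ^ (r + 2 * n + 2 ^ r * n)  ≤⟨ ^-monoʳ-≤ 2 sum≤ ⟩
      2 ^ B  ∎

open Sizes

-- Meaning of the terms of the program.

module Search (I : Instance) (B H F : ℕ) ⦃ B≢0 : NonZero B ⦄
  (B^P≤F : B ℕ.^ (1 ℕ.+ (Instance.n I ℕ.+ (Instance.n I ℕ.+ Instance.n I ℕ.* B ℕ.^ Instance.n I))) ℕ.≤ F) where
  open import Data.Integer.Base using (_+_; _*_; _-_; -_; _≤_; _<_)
  open Instance I

  T P : ℕ
  T = B ℕ.^ n
  P = 1 ℕ.+ (n ℕ.+ (n ℕ.+ n ℕ.* T))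

  E : ℕ → ℕ → ℤ
  E k p = + digit B k p - + H

  RowIs : ℕ → Fin m → Set
  RowIs c i = ∀ l → A i l ≡ E c (toℕ l)

  rowIs? : ∀ c i → Dec (RowIs c i)
  rowIs? c i = Fin.all? λ l → A i l ℤ.≟ E c (toℕ l)

  Least : ℕ → Fin m → Set
  Least c i = RowIs c i × (∀ i′ → RowIs c i′ → b i ≤ b i′)

  least? : ∀ c i → Dec (Least c i)
  least? c i = rowIs? c i ×-dec Fin.all? λ i′ → rowIs? c i′ →-dec (b i ℤ.≤? b i′)

  -- Codes of no row of A get the default 0, as in `βₜ`. Two least rows with the same code have
  -- equal bounds, so the value does not depend on which of them is found.
  β : ℕ → ℤ
  β c with Fin.any? (least? c)
  ... | yes (i , _) = b i
  ... | no  _       = 0ℤ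

  β-least : ∀ {c i} → Least c i → β c ≡ b i
  β-least {c} {i} (r , l) with Fin.any? (least? c)
  ... | yes (i′ , r′ , l′) = ℤ.≤-antisym (l′ i r) (l i′ r′)
  ... | no ¬p = contradiction (i , r , l) ¬p

  β-none : ∀ {c} → (∀ i → ¬ Least c i) → β c ≡ 0ℤ
  β-none {c} none with Fin.any? (least? c)
  ... | yes (i , l) = contradiction l (none i)
  ... | no _ = refl

  -- The digits of k in base B, shifted by H, list D, the vectors w and y, and
  -- the n × T matrix u of a candidate D x = w + Σ u β with a direction y.
  x̂ ŷ : ℕ → Vector ℤ n
  x̂ k j = (E k (1 ℕ.+ toℕ j) + ∑< T (λ c → E k (1 ℕ.+ (n ℕ.+ (n ℕ.+ (toℕ j ℕ.* T ℕ.+ c)))) * β c)) div E k 0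
  ŷ k j = E k (1 ℕ.+ (n ℕ.+ toℕ j))

  record Globals (inp : Input) (ρ : Env) : Set where
    field
      n≡ : ρ vn ≡ + n
      m≡ : ρ vm ≡ + m
      B≡ : ρ vB ≡ + B
      F≡ : ρ vF ≡ + F
      H≡ : ρ vH ≡ + H
      T≡ : ρ vT ≡ + T
      N≡ : ρ vN ≡ + (B ℕ.^ P)
      A≡ : ∀ i j → inp (2 ℕ.+ (n ℕ.* n ℕ.+ (toℕ i ℕ.* n ℕ.+ toℕ j))) ≡ A i j
      b≡ : ∀ i → inp (2 ℕ.+ (n ℕ.* n ℕ.+ (m ℕ.* n ℕ.+ toℕ i))) ≡ b i

  open Globals

  private
    off : ∀ {ρ : Env} {x v} y → True (9 ℕ.≤? toℕ x) → True (toℕ y ℕ.<? 9) → (ρ [ x ≔ᵥ v ]) y ≡ ρ y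
    off {x = x} y x≥9 y<9 with y Fin.≟ x
    ... | yes refl = contradiction (toWitness x≥9) (ℕ.<⇒≱ (toWitness y<9))
    ... | no  _    = refl

  -- Local variables have numbers from 9 on; for a concrete variable the condition `p` is settled by
  -- evaluation.
  bindᵍ : ∀ {inp ρ} x v {p : True (9 ℕ.≤? toℕ x)} → Globals inp ρ → Globals inp (ρ [ x ≔ᵥ v ])
  bindᵍ {inp} {ρ} x v {p} G = record
    { n≡ = trans (off {ρ} {x} {v} vn p _) (n≡ G) ; m≡ = trans (off {ρ} {x} {v} vm p _) (m≡ G)
    ; B≡ = trans (off {ρ} {x} {v} vB p _) (B≡ G) ; F≡ = trans (off {ρ} {x} {v} vF p _) (F≡ G)
    ; H≡ = trans (off {ρ} {x} {v} vH p _) (H≡ G) ; T≡ = trans (off {ρ} {x} {v} vT p _) (T≡ G)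
    ; N≡ = trans (off {ρ} {x} {v} vN p _) (N≡ G) ; A≡ = A≡ G ; b≡ = b≡ G }

  module _ (inp : Input) (ρ : Env) where

    ⟪power⟫ : ∀ e {p} → ρ vB ≡ + B → ρ vF ≡ + F → (inp , ρ) ∶ e ⇓ p → p ℕ.≤ P → (inp , ρ) ∶ powerOf e ⇓ (B ℕ.^ p)
    ⟪power⟫ e B= F= eq p≤P = ⟪prod⟫ inp ρ vF vp e (var vB) F= (ℕ.>-nonZero⁻¹ B) (≤-trans (^-monoʳ-≤ B p≤P) B^P≤F) eq (λ _ → B=)

  module _ {inp : Input} {ρ : Env} (G : Globals inp ρ) where

    ⟪entry⟫ : ∀ k p {κ π} → (inp , ρ) ∶ k ⇓ κ → (inp , ρ) ∶ p ⇓ π → π ℕ.≤ P → ⟪ entry k p ⟫ inp ρ ≡ E κ π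
    ⟪entry⟫ k p {κ} {π} k= p= π≤P = trans (cong₂ (λ q B → q - B * (q div B) - ρ vH) q= (B≡ G))
      (trans (cong₂ (λ d H → + q - + B * d - H) (div-pos q B) (H≡ G))
        (cong (_- + H) (trans (cong (λ s → + s - + B * + (q ℕ./ B)) (ℕ.m≡m%n+[m/n]*n q B))
          (trans (cong (λ s → + (q ℕ.% B) + s - + B * + (q ℕ./ B)) (ℤ.pos-* (q ℕ./ B) B)) (e (+ (q ℕ.% B)) (+ (q ℕ./ B)) (+ B))))))
      where
      q = ℕ._/_ κ (B ℕ.^ π) ⦃ ℕ.m^n≢0 B π ⦄
      q= : ⟪ k ⊡ powerOf p ⟫ inp ρ ≡ + q
      q= = trans (cong₂ _div_ k= (⟪power⟫ inp ρ p (B≡ G) (F≡ G) p= π≤P)) (div-pos κ (B ℕ.^ π) ⦃ ℕ.m^n≢0 B π ⦄)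
      e : ∀ r q B → r + q * B - B * q ≡ r
      e = solve-∀

    ⟪A⟫ : ∀ i j {i′ j′} → (inp , ρ) ∶ i ⇓ toℕ {m} i′ → (inp , ρ) ∶ j ⇓ toℕ {n} j′ → ⟪ Aₜ i j ⟫ inp ρ ≡ A i′ j′
    ⟪A⟫ i j {i′} {j′} i= j= = trans (⟪input⟫ inp ρ (lit′ 2 ⊞ (n̂ ⊠ n̂ ⊞ (i ⊠ n̂ ⊞ j)))
      (cong (λ s → + 2 + s) (⇓-⊞ inp ρ (n̂ ⊠ n̂) (i ⊠ n̂ ⊞ j) (⇓-⊠ inp ρ n̂ n̂ (n≡ G) (n≡ G)) (⇓-⊞ inp ρ (i ⊠ n̂) j (⇓-⊠ inp ρ i n̂ i= (n≡ G)) j=)))) (A≡ G i′ j′)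

    ⟪b⟫ : ∀ i {i′} → (inp , ρ) ∶ i ⇓ toℕ {m} i′ → ⟪ bₜ i ⟫ inp ρ ≡ b i′
    ⟪b⟫ i {i′} i= = trans (⟪input⟫ inp ρ (lit′ 2 ⊞ (n̂ ⊠ n̂ ⊞ (m̂ ⊠ n̂ ⊞ i)))
      (cong (λ s → + 2 + s) (⇓-⊞ inp ρ (n̂ ⊠ n̂) (m̂ ⊠ n̂ ⊞ i) (⇓-⊠ inp ρ n̂ n̂ (n≡ G) (n≡ G)) (⇓-⊞ inp ρ (m̂ ⊠ n̂) i (⇓-⊠ inp ρ m̂ n̂ (m≡ G) (n≡ G)) i=)))) (b≡ G i′)

  n+n+jT+c<P : ∀ (j : Fin n) {c} → c ℕ.< T → 1 ℕ.+ (n ℕ.+ (n ℕ.+ (toℕ j ℕ.* T ℕ.+ c))) ℕ.< P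
  n+n+jT+c<P j {c} c<T = s≤s (ℕ.+-monoʳ-< n (ℕ.+-monoʳ-< n (<-≤-trans (ℕ.+-monoʳ-< (toℕ j ℕ.* T) c<T)
    (≤-trans (≤-reflexive (+-comm (toℕ j ℕ.* T) T)) (*-monoˡ-≤ T (Fin.toℕ<n j))))))

  n+j<P : ∀ (j : Fin n) → 1 ℕ.+ (n ℕ.+ toℕ j) ℕ.< P
  n+j<P j = s≤s (ℕ.+-monoʳ-< n (≤-trans (Fin.toℕ<n j) (m≤m+n n _)))

  j<P : ∀ (j : Fin n) → 1 ℕ.+ toℕ j ℕ.< P
  j<P j = s≤s (≤-trans (Fin.toℕ<n j) (m≤m+n n _))

  ⊨-rowIs : ∀ {inp ρ c i} → Globals inp ρ → ρ vc ≡ + c → ρ vi ≡ + toℕ i → ((inp , ρ) ⊨ rowIs) ⇔ RowIs c i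
  ⊨-rowIs {inp} {ρ} {c} {i} G c= i= = mk⇔
    (λ p l → trans (sym (lhs l)) (trans (to (⊨-≗ a e) (to all⇔ p l)) (rhs l)))
    (λ r → from all⇔ λ l → from (⊨-≗ a e) (trans (lhs l) (trans (r l) (sym (rhs l)))))
    where
    a = Aₜ (var vi) (var vl)
    e = up (entry (var vc) (var vl))
    all⇔ = ⊨-all {inp} {ρ} vl n̂ (a ≗ₜ e) (n≡ G)
    lhs : ∀ l → ⟪ a ⟫ inp (ρ [ vl ≔ᵥ + toℕ l ]) ≡ A i l
    lhs l = ⟪A⟫ (bindᵍ vl (+ toℕ l) G) (var vi) (var vl) i= refl
    rhs : ∀ l → ⟪ e ⟫ inp (ρ [ vl ≔ᵥ + toℕ l ]) ≡ E c (toℕ l)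
    rhs l = ⟪entry⟫ (bindᵍ vl (+ toℕ l) G) (var vc) (var vl) c= refl (<⇒≤ (≤-trans (ℕ.n<1+n _) (<⇒≤ (j<P l))))

  ⊨-isLeast : ∀ {inp ρ c i} → Globals inp ρ → ρ vc ≡ + c → ρ vi ≡ + toℕ i → ((inp , ρ) ⊨ isLeast) ⇔ Least c i
  ⊨-isLeast {inp} {ρ} {c} {i} G c= i= = mk⇔
    (λ p → let r , l = to (⊨-∧ rowIs rest) p in to row⇔ r ,
      λ i′ r′ → subst₂ _≤_ (lhs i′) (rhs i′) (to (⊨-≼ bᵢ bᵢ′) (to (⊨-⇒ other (bᵢ ≼ bᵢ′)) (to all⇔ l i′) (from (row′⇔ i′) r′))))
    (λ (r , l) → from (⊨-∧ rowIs rest) (from row⇔ r , from all⇔ λ i′ → from (⊨-⇒ other (bᵢ ≼ bᵢ′))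
      λ r′ → from (⊨-≼ bᵢ bᵢ′) (subst₂ _≤_ (sym (lhs i′)) (sym (rhs i′)) (l i′ (to (row′⇔ i′) r′)))))
    where
    bᵢ    = bₜ (var vi)
    bᵢ′   = bₜ (var vi′)
    other = bind vi (var vi′) rowIs
    rest  = all vi′ m̂ (other ⇒ₜ bᵢ ≼ bᵢ′)
    row⇔  = ⊨-rowIs G c= i=
    all⇔  = ⊨-all {inp} {ρ} vi′ m̂ (other ⇒ₜ bᵢ ≼ bᵢ′) (m≡ G)
    G′ : ∀ i′ → Globals inp (ρ [ vi′ ≔ᵥ + toℕ {m} i′ ])
    G′ i′ = bindᵍ vi′ (+ toℕ i′) G
    row′⇔ : ∀ i′ → ((inp , ρ [ vi′ ≔ᵥ + toℕ i′ ]) ⊨ other) ⇔ RowIs c i′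
    row′⇔ i′ = let r⇔ = ⊨-rowIs {i = i′} (bindᵍ vi (+ toℕ i′) (G′ i′)) c= refl in
      mk⇔ (λ (sat p) → to r⇔ (sat p)) (λ r → sat (positive (from r⇔ r)))
    lhs : ∀ i′ → ⟪ bᵢ ⟫ inp (ρ [ vi′ ≔ᵥ + toℕ {m} i′ ]) ≡ b i
    lhs i′ = ⟪b⟫ (G′ i′) (var vi) i=
    rhs : ∀ i′ → ⟪ bᵢ′ ⟫ inp (ρ [ vi′ ≔ᵥ + toℕ i′ ]) ≡ b i′
    rhs i′ = ⟪b⟫ (G′ i′) (var vi′) refl

  ⟪β⟫ : ∀ {inp ρ c} → Globals inp ρ → ρ vc ≡ + c → ⟪ βₜ ⟫ inp ρ ≡ β c
  ⟪β⟫ {inp} {ρ} {c} G c= = go (⟪last⟫ inp ρ vi m̂ isLeast (m≡ G))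
    where
    z = ⟪ loop last vi m̂ isLeast ⟫ inp ρ
    body : ℤ → ℤ
    body v = ⟪ cond (var vz) (bₜ (var vz ⊟ lit′ 1)) (num 0ℤ) ⟫ inp (ρ [ vz ≔ᵥ v ])
    least⇔ : ∀ i → ((inp , ρ [ vi ≔ᵥ + toℕ i ]) ⊨ isLeast) ⇔ Least c i
    least⇔ i = ⊨-isLeast (bindᵍ vi (+ toℕ i) G) c= refl
    go : (z ≡ 0ℤ × (∀ (i : Fin m) → ¬ (inp , ρ [ vi ≔ᵥ + toℕ i ]) ⊨ isLeast)) ⊎
         (∃[ i ] z ≡ + suc (toℕ {m} i) × (inp , ρ [ vi ≔ᵥ + toℕ i ]) ⊨ isLeast) → body z ≡ β c
    go (inj₁ (z= , none)) = trans (cong body z=) (sym (β-none λ i l → none i (from (least⇔ i) l)))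
    go (inj₂ (i , z= , p)) = trans (cong body z=)
      (trans (⟪b⟫ (bindᵍ vz (+ suc (toℕ i)) G) (var vz ⊟ lit′ 1) {i} refl) (sym (β-least (to (least⇔ i) p))))

  ⟪x⟫ : ∀ {inp ρ k} j → Globals inp ρ → ρ vk ≡ + k → ρ vj ≡ + toℕ j → ⟪ xₜ ⟫ inp ρ ≡ x̂ k j
  ⟪x⟫ {inp} {ρ} {k} j G k= j= = cong₂ _div_
    (cong₂ _+_ (⟪entry⟫ G (var vk) (lit′ 1 ⊞ var vj) k= (cong (λ s → + 1 + s) j=) (<⇒≤ (j<P j)))
      (trans (⟪sum⟫ inp ρ vc (var vT) (up (entry (var vk) pos) ⊠ βₜ) (T≡ G))
        (∑<-cong T λ c c<T → cong₂ _*_ (term c c<T) (⟪β⟫ (bindᵍ vc (+ c) G) refl))))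
    (⟪entry⟫ G (var vk) (lit′ 0) k= refl z≤n)
    where
    pos = lit′ 1 ⊞ (n̂ ⊞ (n̂ ⊞ (var vj ⊠ var vT ⊞ var vc)))
    term : ∀ c → c ℕ.< T → ⟪ entry (var vk) pos ⟫ inp (ρ [ vc ≔ᵥ + c ]) ≡ E k (1 ℕ.+ (n ℕ.+ (n ℕ.+ (toℕ j ℕ.* T ℕ.+ c))))
    term c c<T = ⟪entry⟫ (bindᵍ vc (+ c) G) (var vk) pos k=
      (cong (λ s → + 1 + s) (cong₂ _+_ (n≡ G) (cong₂ _+_ (n≡ G) (cong (_+ + c) (⇓-⊠ inp ρ (var vj) (var vT) j= (T≡ G))))))
      (<⇒≤ (n+n+jT+c<P j c<T))

  ⟪y⟫ : ∀ {inp ρ k} v j → Globals inp ρ → ρ vk ≡ + k → ρ v ≡ + toℕ j → ⟪ yₜ v ⟫ inp ρ ≡ ŷ k j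
  ⟪y⟫ v j G k= j= = ⟪entry⟫ G (var vk) (lit′ 1 ⊞ (n̂ ⊞ var v)) k= (cong (λ s → + 1 + s) (cong₂ _+_ (n≡ G) j=)) (<⇒≤ (n+j<P j))

  ⊨-rows : ∀ {inp ρ} (t u : Tm big) {v : Vector ℤ n} {w : Vector ℤ m} → Globals inp ρ →
    (∀ i j → ⟪ t ⟫ inp ((ρ [ vi ≔ᵥ + toℕ i ]) [ vj ≔ᵥ + toℕ j ]) ≡ v j) →
    (∀ i → ⟪ u ⟫ inp (ρ [ vi ≔ᵥ + toℕ i ]) ≡ w i) →
    ((inp , ρ) ⊨ all vi m̂ (loop sum vj n̂ (Aₜ (var vi) (var vj) ⊠ t) ≼ u)) ⇔ (∀ i → dot (A i) v ≤ w i)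
  ⊨-rows {inp} {ρ} t u {v} {w} G t= u= = mk⇔
    (λ p i → subst₂ _≤_ (lhs i) (u= i) (to (⊨-≼ s u) (to all⇔ p i)))
    (λ f → from all⇔ λ i → from (⊨-≼ s u) (subst₂ _≤_ (sym (lhs i)) (sym (u= i)) (f i)))
    where
    s = loop sum vj n̂ (Aₜ (var vi) (var vj) ⊠ t)
    all⇔ = ⊨-all {inp} {ρ} vi m̂ (s ≼ u) (m≡ G)
    lhs : ∀ i → ⟪ s ⟫ inp (ρ [ vi ≔ᵥ + toℕ i ]) ≡ dot (A i) v
    lhs i = ⟪∑⟫ inp (ρ [ vi ≔ᵥ + toℕ i ]) vj n̂ (Aₜ (var vi) (var vj) ⊠ t) (n≡ G) λ j → cong₂ _*_
      (⟪A⟫ (bindᵍ vj (+ toℕ j) (bindᵍ vi (+ toℕ i) G)) (var vi) (var vj) refl refl) (t= i j)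

  ⊨-feasible : ∀ {inp ρ k} → Globals inp ρ → ρ vk ≡ + k → ((inp , ρ) ⊨ feasible) ⇔ Feasible I (x̂ k)
  ⊨-feasible G k= = ⊨-rows xₜ (bₜ (var vi)) G
    (λ i j → ⟪x⟫ j (bindᵍ vj (+ toℕ j) (bindᵍ vi (+ toℕ i) G)) k= refl)
    (λ i → ⟪b⟫ (bindᵍ vi (+ toℕ i) G) (var vi) refl)

  ⊨-recession : ∀ {inp ρ k} → Globals inp ρ → ρ vk ≡ + k → ((inp , ρ) ⊨ recession) ⇔ (∀ i → dot (A i) (ŷ k) ≤ 0ℤ)
  ⊨-recession G k= = ⊨-rows (yₜ vj) (num 0ℤ) G
    (λ i j → ⟪y⟫ vj j (bindᵍ vj (+ toℕ j) (bindᵍ vi (+ toℕ i) G)) k= refl) (λ _ → refl)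

  -- Kept apart from `Globals` because writing the solution overwrites entries of Q, while the
  -- coordinates of x must remain computable.
  QStored : Input → Set
  QStored inp = ∀ i j → inp (2 ℕ.+ (toℕ i ℕ.* n ℕ.+ toℕ j)) ≡ Q i j

  ⟪quadratic⟫ : ∀ {inp ρ} (s t : Tm big) {u v : Vector ℤ n} → Globals inp ρ → QStored inp →
    (∀ i q → ⟪ s ⟫ inp ((ρ [ vi ≔ᵥ + toℕ i ]) [ vq ≔ᵥ + toℕ q ]) ≡ u i) →
    (∀ i q → ⟪ t ⟫ inp ((ρ [ vi ≔ᵥ + toℕ i ]) [ vq ≔ᵥ + toℕ q ]) ≡ v q) →
    ⟪ quadratic s t ⟫ inp ρ ≡ form Q u v
  ⟪quadratic⟫ {inp} {ρ} s t {u} {v} G QS s= t= =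
    ⟪∑⟫ inp ρ vi n̂ (loop sum vq n̂ (s ⊠ q ⊠ t)) (n≡ G) λ i →
    ⟪∑⟫ inp (ρ [ vi ≔ᵥ + toℕ i ]) vq n̂ (s ⊠ q ⊠ t) (n≡ G) λ j →
      cong₂ _*_ (cong₂ _*_ (s= i j) (q= i j)) (t= i j)
    where
    q = Qₜ (var vi) (var vq)
    q= : ∀ i j → ⟪ q ⟫ inp ((ρ [ vi ≔ᵥ + toℕ i ]) [ vq ≔ᵥ + toℕ j ]) ≡ Q i j
    q= i j = let ρ′ = (ρ [ vi ≔ᵥ + toℕ i ]) [ vq ≔ᵥ + toℕ j ] in
      trans (⟪input⟫ inp ρ′ (lit′ 2 ⊞ (var vi ⊠ n̂ ⊞ var vq))
        (cong (λ s → + 2 + s) (⇓-⊞ inp ρ′ (var vi ⊠ n̂) (var vq) (⇓-⊠ inp ρ′ (var vi) n̂ refl (n≡ G)) refl))) (QS i j)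

  private
    ⟪xᵢ⟫ : ∀ {inp ρ k} v j → Globals inp ρ → ρ vk ≡ + k → ρ v ≡ + toℕ j → ⟪ bind vj (var v) xₜ ⟫ inp ρ ≡ x̂ k j
    ⟪xᵢ⟫ {inp} {ρ} v j G k= j= = ⟪bind⟫ inp ρ vj (var v) xₜ (⟪x⟫ j (bindᵍ vj (ρ v) G) k= j=)

    bindᵢⱼ : ∀ {inp ρ} (i j : Fin n) → Globals inp ρ → Globals inp ((ρ [ vi ≔ᵥ + toℕ i ]) [ vq ≔ᵥ + toℕ j ])
    bindᵢⱼ i j G = bindᵍ vq (+ toℕ j) (bindᵍ vi (+ toℕ i) G)

  ⟪objective⟫ : ∀ {inp ρ k} → Globals inp ρ → QStored inp → ρ vk ≡ + k → ⟪ objectiveₜ ⟫ inp ρ ≡ objective I (x̂ k)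
  ⟪objective⟫ G QS k= = ⟪quadratic⟫ (bind vj (var vi) xₜ) (bind vj (var vq) xₜ) G QS
    (λ i j → ⟪xᵢ⟫ vi i (bindᵢⱼ i j G) k= refl) (λ i j → ⟪xᵢ⟫ vq j (bindᵢⱼ i j G) k= refl)

  record Cert (k : ℕ) : Set where
    constructor cert
    field
      feas : Feasible I (x̂ k)
      rec  : ∀ i → dot (A i) (ŷ k) ≤ 0ℤ
      yQy  : form Q (ŷ k) (ŷ k) ≤ 0ℤ
      yQx  : form Q (ŷ k) (x̂ k) ≤ -[1+ 0 ]

  ⊨-certificate : ∀ {inp ρ k} → Globals inp ρ → QStored inp → ρ vk ≡ + k → ((inp , ρ) ⊨ certificate) ⇔ Cert k
  ⊨-certificate {inp} {ρ} {k} G QS k= = mk⇔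
    (λ p → let f , p = to (⊨-∧ feasible _) p ; r , p = to (⊨-∧ recession _) p ; a , b = to (⊨-∧ (yy ≼ num 0ℤ) _) p in
      cert (to (⊨-feasible G k=) f) (to (⊨-recession G k=) r)
        (subst (_≤ 0ℤ) yy= (to (⊨-≼ yy (num 0ℤ)) a)) (subst (_≤ -[1+ 0 ]) yx= (to (⊨-≼ yx (num -[1+ 0 ])) b)))
    (λ (cert f r a b) → from (⊨-∧ feasible _) (from (⊨-feasible G k=) f ,
      from (⊨-∧ recession _) (from (⊨-recession G k=) r , from (⊨-∧ (yy ≼ num 0ℤ) _)
        (from (⊨-≼ yy (num 0ℤ)) (subst (_≤ 0ℤ) (sym yy=) a) , from (⊨-≼ yx (num -[1+ 0 ])) (subst (_≤ -[1+ 0 ]) (sym yx=) b)))))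
    where
    yy = quadratic (yₜ vi) (yₜ vq)
    yx = quadratic (yₜ vi) (bind vj (var vq) xₜ)
    yy= : ⟪ yy ⟫ inp ρ ≡ form Q (ŷ k) (ŷ k)
    yy= = ⟪quadratic⟫ (yₜ vi) (yₜ vq) G QS (λ i j → ⟪y⟫ vi i (bindᵢⱼ i j G) k= refl) (λ i j → ⟪y⟫ vq j (bindᵢⱼ i j G) k= refl)
    yx= : ⟪ yx ⟫ inp ρ ≡ form Q (ŷ k) (x̂ k)
    yx= = ⟪quadratic⟫ (yₜ vi) (bind vj (var vq) xₜ) G QS (λ i j → ⟪y⟫ vi i (bindᵢⱼ i j G) k= refl) (λ i j → ⟪xᵢ⟫ vq j (bindᵢⱼ i j G) k= refl)

  Optimum : Fin (B ℕ.^ P) → Set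
  Optimum k = Feasible I (x̂ (toℕ k)) ×
    (∀ (k′ : Fin (B ℕ.^ P)) → Feasible I (x̂ (toℕ k′)) → objective I (x̂ (toℕ k)) ≤ objective I (x̂ (toℕ k′)))

  ⊨-leastBy : ∀ {inp ρ} {N} {k : Fin N} (f g : Tm big) {X : ℕ → Set} {o : ℕ → ℤ} →
    (∀ {ρ k} → Globals inp ρ → ρ vk ≡ + k → ((inp , ρ) ⊨ f) ⇔ X k) →
    (∀ {ρ k} → Globals inp ρ → ρ vk ≡ + k → ⟪ g ⟫ inp ρ ≡ o k) →
    Globals inp ρ → ρ vN ≡ + N → ρ vk ≡ + toℕ k →
    ((inp , ρ) ⊨ leastBy f g) ⇔ (X (toℕ k) × (∀ (k′ : Fin N) → X (toℕ k′) → o (toℕ k) ≤ o (toℕ k′)))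
  ⊨-leastBy {inp} {ρ} {N} {k} f g {X} {o} f⇔ g= G N= k= = mk⇔
    (λ p → let q , l = to (⊨-∧ f rest) p in to (f⇔ G k=) q ,
      λ k′ q′ → subst₂ _≤_ (lhs k′) (rhs k′) (to (⊨-≼ g g′) (to (⊨-⇒ f′ (g ≼ g′)) (to all⇔ l k′) (from (f′⇔ k′) q′))))
    (λ (q , l) → from (⊨-∧ f rest) (from (f⇔ G k=) q , from all⇔ λ k′ → from (⊨-⇒ f′ (g ≼ g′))
      λ q′ → from (⊨-≼ g g′) (subst₂ _≤_ (sym (lhs k′)) (sym (rhs k′)) (l k′ (to (f′⇔ k′) q′)))))
    where
    f′   = bind vk (var vk′) f
    g′   = bind vk (var vk′) g
    rest = all vk′ (var vN) (f′ ⇒ₜ g ≼ g′)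
    all⇔ = ⊨-all {inp} {ρ} vk′ (var vN) (f′ ⇒ₜ g ≼ g′) N=
    module _ (k′ : Fin N) where
      ρ′ = ρ [ vk′ ≔ᵥ + toℕ k′ ]
      G′ = bindᵍ vk′ (+ toℕ k′) G
      f′⇔ : ((inp , ρ′) ⊨ f′) ⇔ X (toℕ k′)
      f′⇔ = ⊨-bind inp ρ′ vk (var vk′) f (f⇔ (bindᵍ vk (+ toℕ k′) G′) refl)
      lhs : ⟪ g ⟫ inp ρ′ ≡ o (toℕ k)
      lhs = g= G′ k=
      rhs : ⟪ g′ ⟫ inp ρ′ ≡ o (toℕ k′)
      rhs = ⟪bind⟫ inp ρ′ vk (var vk′) g (g= (bindᵍ vk (+ toℕ k′) G′) refl)

  ⊨-optimum : ∀ {inp ρ k} → Globals inp ρ → QStored inp → ρ vk ≡ + toℕ k → ((inp , ρ) ⊨ optimum) ⇔ Optimum k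
  ⊨-optimum G QS k= = ⊨-leastBy feasible objectiveₜ ⊨-feasible (λ G → ⟪objective⟫ G QS) G (N≡ G) k=

  cert-spec : ∀ {inp ρ} → Globals inp ρ → QStored inp →
    Selects {B ℕ.^ P} (λ k → Cert (toℕ k)) (⟪ loop last vk (var vN) certificate ⟫ inp ρ)
  cert-spec {inp} {ρ} G QS = last-selects inp ρ vk (var vN) certificate (N≡ G)
    λ k → ⊨-certificate (bindᵍ vk (+ toℕ k) G) QS refl

  opt-spec : ∀ {inp ρ} → Globals inp ρ → QStored inp →
    Selects Optimum (⟪ loop last vk (var vN) optimum ⟫ inp ρ)
  opt-spec {inp} {ρ} G QS = last-selects inp ρ vk (var vN) optimum (N≡ G)
    λ k → ⊨-optimum (bindᵍ vk (+ toℕ k) G) QS refl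

  record Final (K : ℕ) (inp : Input) (ρ : Env) : Set where
    field
      globals : Globals inp ρ
      bounded : Bounds K inp ρ
      certs   : Selects {B ℕ.^ P} (λ k → Cert (toℕ k)) (ρ vC)
      optima  : Selects Optimum (ρ vG)

  -- Every lemma below speaks about a variable environment and a single line:
  -- the conversion checker would unfold concrete environments exponentially.
  module Stage {K : ℕ} (inp : Input) (B/2= : (+ B) div (+ 2) ≡ + H) (QS : QStored inp)
    (A= : ∀ i j → inp (2 ℕ.+ (n ℕ.* n ℕ.+ (toℕ i ℕ.* n ℕ.+ toℕ j))) ≡ A i j)
    (b= : ∀ i → inp (2 ℕ.+ (n ℕ.* n ℕ.+ (m ℕ.* n ℕ.+ toℕ i))) ≡ b i)
    (F≤K : F ℕ.≤ K) (H≤K : H ℕ.≤ K) where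

    private
      n≤P : n ℕ.≤ P
      n≤P = ≤-trans (m≤m+n n _) (n≤1+n _)

      B^p≤K : ∀ {p} → p ℕ.≤ P → B ℕ.^ p ℕ.≤ K
      B^p≤K p≤P = ≤-trans (^-monoʳ-≤ B p≤P) (≤-trans B^P≤F F≤K)

      selects≤ : ∀ {X} z → Selects {B ℕ.^ P} X z → ∣ z ∣ ℕ.≤ K
      selects≤ _ (nothingFound refl _) = z≤n
      selects≤ _ (found k refl _)      = ≤-trans (Fin.toℕ<n k) (B^p≤K ≤-refl)

    fromG : ∀ ρ → Globals inp ρ → Bounds K inp ρ → Selects {B ℕ.^ P} (λ k → Cert (toℕ k)) (ρ vC) →
      Reaches K inp (Final K inp) (lineG ∷ []) ρ
    fromG ρ G Bd C = reach Bd (reaches Bd′ (record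
      { globals = bindᵍ vG (⟪ loop last vk (var vN) optimum ⟫ inp ρ) G ; bounded = Bd′ ; certs = C ; optima = S }))
      where
      S = opt-spec G QS
      Bd′ = bounds-line vG (loop last vk (var vN) optimum) Bd (selects≤ (⟪ loop last vk (var vN) optimum ⟫ inp ρ) S)

    fromC : ∀ ρ → Globals inp ρ → Bounds K inp ρ → Reaches K inp (Final K inp) (lineC ∷ lineG ∷ []) ρ
    fromC ρ G Bd = reach Bd (fromG (lineEnv lineC inp ρ) (bindᵍ vC (⟪ loop last vk (var vN) certificate ⟫ inp ρ) G)
      (bounds-line vC (loop last vk (var vN) certificate) Bd (selects≤ (⟪ loop last vk (var vN) certificate ⟫ inp ρ) S)) S)
      where
      S = cert-spec G QS

    fromN : ∀ ρ → ρ vn ≡ + n → ρ vm ≡ + m → ρ vB ≡ + B → ρ vF ≡ + F → ρ vH ≡ + H → ρ vT ≡ + T → Bounds K inp ρ →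
      Reaches K inp (Final K inp) (lineN ∷ lineC ∷ lineG ∷ []) ρ
    fromN ρ n= m= B= F= H= T= Bd = reach Bd (fromC (lineEnv lineN inp ρ)
      (record { n≡ = n= ; m≡ = m= ; B≡ = B= ; F≡ = F= ; H≡ = H= ; T≡ = T= ; N≡ = N= ; A≡ = A= ; b≡ = b= })
      (bounds-set vN Bd N= (B^p≤K ≤-refl)))
      where
      N= : ⟪ powerOf (lit′ 1 ⊞ (n̂ ⊞ (n̂ ⊞ n̂ ⊠ var vT))) ⟫ inp ρ ≡ + (B ℕ.^ P)
      N= = ⟪power⟫ inp ρ (lit′ 1 ⊞ (n̂ ⊞ (n̂ ⊞ n̂ ⊠ var vT))) B= F=
        (cong (λ s → + 1 + s) (cong₂ _+_ n= (cong₂ _+_ n= (⇓-⊠ inp ρ n̂ (var vT) n= T=)))) ≤-refl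

    fromT : ∀ ρ → ρ vn ≡ + n → ρ vm ≡ + m → ρ vB ≡ + B → ρ vF ≡ + F → ρ vH ≡ + H → Bounds K inp ρ →
      Reaches K inp (Final K inp) (lineT ∷ lineN ∷ lineC ∷ lineG ∷ []) ρ
    fromT ρ n= m= B= F= H= Bd = reach Bd (fromN (lineEnv lineT inp ρ) n= m= B= F= H= T= (bounds-set vT Bd T= (B^p≤K n≤P)))
      where
      T= : ⟪ powerOf n̂ ⟫ inp ρ ≡ + T
      T= = ⟪power⟫ inp ρ n̂ B= F= n= n≤P

    from-search : ∀ ρ → ρ vn ≡ + n → ρ vm ≡ + m → ρ vB ≡ + B → ρ vF ≡ + F → Bounds K inp ρ → Reaches K inp (Final K inp) search ρ
    from-search ρ n= m= B= F= Bd = reach Bd (fromT (lineEnv lineH inp ρ) n= m= B= F= H= (bounds-set vH Bd H= H≤K))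
      where
      H= : ⟪ var vB ⊡ lit′ 2 ⟫ inp ρ ≡ + H
      H= = trans (cong (λ B → B div (+ 2)) B=) B/2=

-- Minima over finite sets and exact division.

module Exactness where
  open import Data.Integer.Base using (_+_; _*_; _-_; -_; _≤_; _<_)

  argmin : ∀ {N} (S : Fin N → Set) → (∀ i → Dec (S i)) → (o : Fin N → ℤ) → ∀ i → S i →
    ∃[ i₀ ] S i₀ × (∀ i → S i → o i₀ ≤ o i)
  argmin {suc N} S S? o i s with Fin.any? (λ i → S? (suc i))
  ... | no ¬p = zero , first i s , least
    where
    first : ∀ i → S i → S zero
    first zero    s = s
    first (suc i) s = contradiction (i , s) ¬p
    least : ∀ i → S i → o zero ≤ o i
    least zero    _ = ℤ.≤-refl
    least (suc i) s = contradiction (i , s) ¬p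
  ... | yes (i′ , s′) with argmin (λ i → S (suc i)) (λ i → S? (suc i)) (λ i → o (suc i)) i′ s′
  ...   | i₀ , s₀ , l₀ with S? zero
  ...     | no ¬z = suc i₀ , s₀ , λ { zero z → contradiction z ¬z ; (suc i) → l₀ i }
  ...     | yes z with o zero ℤ.≤? o (suc i₀)
  ...       | yes p = zero , z , λ { zero _ → ℤ.≤-refl ; (suc i) s → ℤ.≤-trans p (l₀ i s) }
  ...       | no ¬p = suc i₀ , s₀ , λ { zero _ → ℤ.<⇒≤ (ℤ.≰⇒> ¬p) ; (suc i) → l₀ i }

  -- With quotient q and remainder r, (x - q) D = r < D forces x = q.
  *-div-cancel : ∀ D → 0 ℕ.< D → ∀ x → (+ D * x) div (+ D) ≡ x
  *-div-cancel (suc D) _ x = trans (ℤ.div-pos-is-/ℕ (+ suc D * x) (suc D)) (sym (ℤ.i-j≡0⇒i≡j x q (ℤ.∣i∣≡0⇒i≡0 (small-multiple ∣ x - q ∣ multiple))))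
    where
    q = (+ suc D * x) ℤ./ℕ suc D
    r = (+ suc D * x) ℤ.%ℕ suc D
    small-multiple : ∀ a → a ℕ.* suc D ℕ.< suc D → a ≡ 0
    small-multiple zero    _ = refl
    small-multiple (suc a) p = contradiction (m≤m+n (suc D) (a ℕ.* suc D)) (ℕ.<⇒≱ p)
    e : ∀ d x q r → d * x ≡ r + q * d → (x - q) * d ≡ r
    e d x q r h = trans (e₁ d x q) (trans (cong (λ s → s - q * d) h) (e₂ r (q * d)))
      where
      e₁ : ∀ d x q → (x - q) * d ≡ d * x - q * d
      e₁ = solve-∀
      e₂ : ∀ r s → r + s - s ≡ r
      e₂ = solve-∀
    multiple : ∣ x - q ∣ ℕ.* suc D ℕ.< suc D
    multiple = subst (ℕ._< suc D) (trans (cong ∣_∣ (sym (e (+ suc D) x q (+ r) (ℤ.a≡a%ℕn+[a/ℕn]*n (+ suc D * x) (suc D)))))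
      (ℤ.∣i*j∣≡∣i∣*∣j∣ (x - q) (+ suc D))) (ℤ.n%ℕd<d (+ suc D * x) (suc D))

open Exactness

-- From the outcome of the search to the verdict.

module Verdict (I : Instance) (B H F : ℕ) ⦃ B≢0 : NonZero B ⦄
  (B^P≤F : B ℕ.^ (1 ℕ.+ (Instance.n I ℕ.+ (Instance.n I ℕ.+ Instance.n I ℕ.* B ℕ.^ Instance.n I))) ℕ.≤ F)
  (B≡H+H : B ≡ H ℕ.+ H) (α : ℕ) (α<H : α ℕ.< H)
  (Z₂<H : Z₂ I 0 (λ _ → 0ℤ) α (4 ℕ.* κ₀ I 0 (λ _ → 0ℤ) α 0) ℕ.< H)
  (Q≤ : ∀ i j → ∣ Instance.Q I i j ∣ ℕ.≤ α) (A≤ : ∀ i j → ∣ Instance.A I i j ∣ ℕ.≤ α)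
  where
  open import Data.Integer.Base using (_+_; _*_; _-_; -_; _≤_; _<_)
  open Instance I
  open Search I B H F B^P≤F

  private
    Y : ℕ
    Y = Z₂ I 0 (λ _ → 0ℤ) α (4 ℕ.* κ₀ I 0 (λ _ → 0ℤ) α 0)

  -- Adding H to entries of absolute value below H gives digits below H + H = B. Positions beyond
  -- the list read 0, which is admissible too.
  encodeℤ : ∀ (L : List ℤ) → All (λ z → ∣ z ∣ ℕ.< H) L → ∀ p → ∃[ k ] k ℕ.< B ℕ.^ p × (∀ i → i ℕ.< p → E k i ≡ initial L (+ i))
  encodeℤ L L< p with encode B g g<B p
    where
    g : ℕ → ℕ
    g i = ∣ initial L (+ i) + + H ∣
    g<B : ∀ i → g i ℕ.< B
    g<B i = subst (g i ℕ.<_) (sym B≡H+H) (≤-<-trans (ℤ.∣i+j∣≤∣i∣+∣j∣ (initial L (+ i)) (+ H))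
      (ℕ.+-monoˡ-< H (initial-All (≤-<-trans z≤n α<H) L< i)))
  ... | k , k< , digits = k , k< , λ i i<p → trans (cong (λ d → + d - + H) (digits i i<p))
      (trans (cong (_- + H) (ℤ.0≤i⇒+∣i∣≡i (nonneg′ (initial L (+ i)) (initial-All (≤-<-trans z≤n α<H) L< i)))) (e (initial L (+ i)) (+ H)))
    where
    e : ∀ a h → a + h - h ≡ a
    e = solve-∀
    nonneg′ : ∀ z → ∣ z ∣ ℕ.< H → 0ℤ ≤ z + + H
    nonneg′ (+ n)    _ = ℤ.+≤+ z≤n
    nonneg′ -[1+ n ] p = subst (0ℤ ≤_) (sym (ℤ.⊖-≥ (<⇒≤ p))) (ℤ.+≤+ z≤n)

  row-code : ∀ i → ∃[ c ] c ℕ.< T × RowIs c i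
  row-code i with encodeℤ (List.tabulate (A i) ++ []) (All.++⁺ (All.tabulate⁺ λ l → ≤-<-trans (A≤ i l) α<H) []) n
  ... | c , c<T , c= = c , c<T , λ l → sym (trans (c= (toℕ l) (Fin.toℕ<n l)) (initial-tabulate (A i) [] l))

  -- Among the rows equal to row i the least bound is attained by some i₀; feasibility for i₀ bounds
  -- aᵢ x by β c, and minimality puts β c below bᵢ.
  near : ∀ i x → Feasible I x → ∃[ v ] Describable T β 1 v × dot (A i) x ≤ v × v ≤ b i
  near i x fx with row-code i
  ... | c , c<T , r with argmin (RowIs c) (rowIs? c) b i r
  ...   | i₀ , r₀ , l₀ = β c , desc-β c c<T ,
            subst₂ _≤_ (dot-congˡ x λ l → trans (r₀ l) (sym (r l))) (sym (β-least (r₀ , l₀))) (fx i₀) ,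
            subst (_≤ b i) (sym (β-least (r₀ , l₀))) (l₀ i r)

  module _ {x y : Vector ℤ n} (cand : Candidate T β Y x) (y≤ : ∀ j → ∣ y j ∣ ℕ.≤ Y) where
    private
      open Candidate cand using (D; D≤; e)
      w : Vector ℤ n
      w j = Describable.w (e j)
      U : Matrix n T
      U j c = Describable.u (e j) (toℕ c)
      L L′ L″ : List ℤ
      L″ = entries U ++ []
      L′ = List.tabulate y ++ L″
      L  = + D ∷ List.tabulate w ++ L′

      <H : ∀ {a} → a ℕ.≤ Y → a ℕ.< H
      <H p = ≤-<-trans p Z₂<H

      L< : All (λ z → ∣ z ∣ ℕ.< H) L
      L< = <H D≤ ∷ All.++⁺ (All.tabulate⁺ λ j → <H (Describable.w≤ (e j)))
        (All.++⁺ (All.tabulate⁺ λ j → <H (y≤ j)) (All.++⁺ (All-entries U λ j c → <H (Describable.u≤ (e j) (toℕ c))) []))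

      skip-w : ∀ a → initial (List.tabulate w ++ L′) (+ (n ℕ.+ a)) ≡ initial L′ (+ a)
      skip-w a = trans (cong (λ s → initial (List.tabulate w ++ L′) (+ (s ℕ.+ a))) (sym (List.length-tabulate w))) (initial-skip (List.tabulate w) L′ a)

      skip-y : ∀ a → initial L′ (+ (n ℕ.+ a)) ≡ initial L″ (+ a)
      skip-y a = trans (cong (λ s → initial L′ (+ (s ℕ.+ a))) (sym (List.length-tabulate y))) (initial-skip (List.tabulate y) L″ a)

    -- The list `L` holds D, w, y and u in the order in which `x̂` and `ŷ` read the digits;
    -- exactness of the division then recovers x.
    encode-candidate : ∃[ k ] k ℕ.< B ℕ.^ P × (∀ j → x̂ k j ≡ x j) × (∀ j → ŷ k j ≡ y j)
    encode-candidate with encodeℤ L L< P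
    ... | k , k< , k= = k , k< , x= , y=
      where
      y= : ∀ j → ŷ k j ≡ y j
      y= j = trans (k= _ (n+j<P j)) (trans (skip-w (toℕ j)) (initial-tabulate y L″ j))
      u= : ∀ j c → c ℕ.< T → E k (1 ℕ.+ (n ℕ.+ (n ℕ.+ (toℕ j ℕ.* T ℕ.+ c)))) ≡ Describable.u (e j) c
      u= j c c<T = trans (k= _ (n+n+jT+c<P j c<T)) (trans (skip-w _) (trans (skip-y _)
        (subst (λ d → initial L″ (+ (toℕ j ℕ.* T ℕ.+ d)) ≡ Describable.u (e j) d) (Fin.toℕ-fromℕ< c<T)
          (initial-entries U [] j (fromℕ< c<T)))))
      x= : ∀ j → x̂ k j ≡ x j
      x= j = trans (cong₂ _div_ (trans (cong₂ _+_ (trans (k= _ (j<P j)) (initial-tabulate w L′ j)) (∑<-cong T λ c c<T → cong (_* β c) (u= j c c<T)))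
          (sym (Describable.eq (e j)))) (k= 0 (s≤s z≤n))) (*-div-cancel D (Candidate.0<D cand) (x j))

  Feasible-cong : ∀ {x x′ : Vector ℤ n} → (∀ j → x′ j ≡ x j) → Feasible I x → Feasible I x′
  Feasible-cong eq fx i = subst (_≤ b i) (sym (dot-cong (A i) eq)) (fx i)

  objective-cong : ∀ {x x′ : Vector ℤ n} → (∀ j → x′ j ≡ x j) → objective I x′ ≡ objective I x
  objective-cong eq = form-cong Q eq eq

  private
    Found : Vector ℤ n → Set
    Found x = (∃[ k ] Feasible I (x̂ (toℕ {B ℕ.^ P} k)) × objective I (x̂ (toℕ k)) ≤ objective I x) ⊎
              (∃[ k ] Cert (toℕ {B ℕ.^ P} k))

  covers : ∀ x → Feasible I x → Found x
  covers x fx = convert (completeness I T β α (4 ℕ.* κ₀ I T β α 0) ≤-refl Q≤ A≤ near x fx)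
    where
    at : ∀ {k} (k< : k ℕ.< B ℕ.^ P) (X : ℕ → Set) → X k → X (toℕ (fromℕ< k<))
    at k< X = subst X (sym (Fin.toℕ-fromℕ< k<))
    convert : (∃[ x′ ] Feasible I x′ × objective I x′ ≤ objective I x × Candidate T β Y x′) ⊎
        (∃[ y ] ∃[ x′ ] Ray I T β α (4 ℕ.* κ₀ I T β α 0) Y y x′ × Feasible I x′ × Candidate T β Y x′) → Found x
    convert (inj₁ (x′ , fx′ , o , c)) =
      -- A code always has room for a direction; here the zero vector fills it.
      let k , k< , x= , _ = encode-candidate {y = λ _ → 0ℤ} c (λ _ → z≤n) in
      inj₁ (fromℕ< k< , at k< (λ k → Feasible I (x̂ k)) (Feasible-cong x= fx′) ,
        at k< (λ k → objective I (x̂ k) ≤ objective I x) (subst (_≤ objective I x) (sym (objective-cong x=)) o))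
    convert (inj₂ (y , x′ , ray y≤ r q g , fx′ , c)) =
      let k , k< , x= , y= = encode-candidate c y≤ in
      inj₂ (fromℕ< k< , at k< Cert (cert (Feasible-cong x= fx′)
        (λ i → subst (_≤ 0ℤ) (sym (dot-cong (A i) y=)) (r i))
        (subst (_≤ 0ℤ) (sym (form-cong Q y= y=)) q)
        (subst (_≤ -[1+ 0 ]) (sym (form-cong Q y= x=)) (≤-by _ (gap< g) (e (form Q y x′))))))
      where
      e : ∀ g → -[1+ 0 ] - g ≡ 0ℤ - g - 1ℤ
      e = solve-∀

  cert-sound : ∀ {k} → Cert k → ∃ (Feasible I) × Unbounded I
  cert-sound {k} (cert f r q g) = (x̂ k , f) ,
    ray-unbounded I r q (ℤ.≤-<-trans g ℤ.-<+) f

  module _ (¬cert : ∀ (k : Fin (B ℕ.^ P)) → ¬ Cert (toℕ k)) where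

    -- Comparison with the codes suffices: without a certificate, `covers` supplies for each
    -- feasible point a feasible code that is no worse.
    optimum-sound : ∀ {k} → Optimum k → Optimal I (x̂ (toℕ k))
    optimum-sound {k} (f , l) = f , λ x fx → below x (covers x fx)
      where
      below : ∀ x → Found x → objective I (x̂ (toℕ k)) ≤ objective I x
      below x (inj₁ (k′ , f′ , o)) = ℤ.≤-trans (l k′ f′) o
      below x (inj₂ (k′ , c))      = contradiction c (¬cert k′)

    optimum-bounded : ∀ {k} → Optimum k → Bounded I
    optimum-bounded {k} opt@(f , _) = (λ inf → inf (_ , f)) , λ unb →
      let x , fx , o = unb (objective I (x̂ (toℕ k)) - 1ℤ) in
      contradiction (ℤ.≤-trans (proj₂ (optimum-sound {k} opt) x fx) o) (ℤ.<⇒≱ (<-by 0ℤ ℤ.≤-refl (e (objective I (x̂ (toℕ k))))))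
      where
      e : ∀ o → o - (o - 1ℤ) - 1ℤ ≡ 0ℤ
      e = solve-∀

    -- A feasible point would give a feasible code, and among the finitely many feasible codes one
    -- minimizes the objective.
    no-optimum : (∀ k → ¬ Optimum k) → Infeasible I
    no-optimum none (x , fx) = absurd (covers x fx)
      where
      N = B ℕ.^ P
      feas? : ∀ (k : Fin N) → Dec (Feasible I (x̂ (toℕ k)))
      feas? k = Fin.all? λ i → dot (A i) (x̂ (toℕ k)) ℤ.≤? b i
      absurd : Found x → ⊥
      absurd (inj₂ (k , c))     = ¬cert k c
      absurd (inj₁ (k , f , _)) =
        let k₀ , f₀ , l₀ = argmin (λ k → Feasible I (x̂ (toℕ k))) feas? (λ k → objective I (x̂ (toℕ k))) k f
        in none k₀ (f₀ , l₀)

-- The stored instance and its largest coefficient.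

module Encoding (I : Instance) where
  open import Data.Nat.Base using (_+_; _*_; _≤_; _<_)
  open Instance I

  stored : Input
  stored a = initial (encoding I) (+ a)

  stored-Q : ∀ i j → stored (2 + (toℕ i * n + toℕ j)) ≡ Q i j
  stored-Q = initial-entries Q (entries A ++ List.tabulate b)

  private
    skip-Q : ∀ k → stored (2 + (n * n + k)) ≡ initial (entries A ++ List.tabulate b) (+ k)
    skip-Q k = trans (cong (λ s → initial (entries Q ++ entries A ++ List.tabulate b) (+ (s + k))) (sym (length-entries Q)))
      (initial-skip (entries Q) _ k)

  stored-A : ∀ i j → stored (2 + (n * n + (toℕ i * n + toℕ j))) ≡ A i j
  stored-A i j = trans (skip-Q _) (initial-entries A (List.tabulate b) i j)

  stored-b : ∀ i → stored (2 + (n * n + (m * n + toℕ i))) ≡ b i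
  stored-b i = trans (skip-Q _) (trans (cong (λ s → initial (entries A ++ List.tabulate b) (+ (s + toℕ i))) (sym (length-entries A)))
    (trans (initial-skip (entries A) (List.tabulate b) (toℕ i))
      (trans (cong (λ L → initial L (+ toℕ i)) (sym (List.++-identityʳ (List.tabulate b)))) (initial-tabulate b [] i))))

  α : ℕ
  α = maxCoefficient I

  private
    xs : List ℤ
    xs = entries Q ++ entries A

    xs≤α : All (λ z → ∣ z ∣ ≤ α) xs
    xs≤α = All.map⁻ (xs≤max 0 (List.map ∣_∣ xs))

    entries⁻ : ∀ {P : ℤ → Set} {m n} (M : Matrix m n) → All P (entries M) → ∀ i j → P (M i j)
    entries⁻ {P} {m} {n} M h i j = subst P (initial-entries M [] i j) (All-initial⁻ h inRange)
      where
      inRange : toℕ i * n + toℕ j < List.length (entries M)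
      inRange = subst (toℕ i * n + toℕ j <_) (sym (length-entries M))
        (<-≤-trans (ℕ.+-monoʳ-< (toℕ i * n) (Fin.toℕ<n j)) (≤-trans (≤-reflexive (+-comm (toℕ i * n) n)) (*-monoˡ-≤ n (Fin.toℕ<n i))))

  Q≤α : ∀ i j → ∣ Q i j ∣ ≤ α
  Q≤α = entries⁻ Q (All.++⁻ˡ (entries Q) xs≤α)

  A≤α : ∀ i j → ∣ A i j ∣ ≤ α
  A≤α = entries⁻ A (All.++⁻ʳ (entries Q) xs≤α)

  bits-stored : ∀ a → bits (stored a) ≤ encodingLength I
  bits-stored = initial-All (s≤s z≤n) (each (encoding I))
    where
    each : ∀ L → All (λ z → bits z ≤ ListAction.sum (List.map bits L)) L
    each []      = []
    each (z ∷ L) = m≤m+n (bits z) _ ∷ All.map (λ p → ≤-trans p (m≤n+m _ (bits z))) (each L)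

  length≤ : ∀ L → List.length L ≤ ListAction.sum (List.map bits L)
  length≤ []      = z≤n
  length≤ (z ∷ L) = +-mono-≤ (s≤s z≤n) (length≤ L)

  2≤length : 2 ≤ encodingLength I
  2≤length = ≤-trans (s≤s (s≤s z≤n)) (length≤ (encoding I))

  m≤length : m ≤ encodingLength I
  m≤length = ≤-trans (≤-trans (≤-trans (≤-reflexive (sym (List.length-tabulate b))) (m≤n+m _ (List.length (entries Q ++ entries A))))
    (≤-reflexive (trans (sym (List.length-++ (entries Q ++ entries A))) (cong List.length (List.++-assoc (entries Q) (entries A) (List.tabulate b))))))
    (≤-trans (m≤n+m _ 2) (length≤ (encoding I)))

  ⟪∣∣⟫ : ∀ inp ρ t → ⟪ ∣ t ∣ₜ ⟫ inp ρ ≡ + ∣ ⟪ t ⟫ inp ρ ∣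
  ⟪∣∣⟫ inp ρ t with ⟪ t ⟫ inp ρ
  ... | + zero   = refl
  ... | + suc _  = refl
  ... | -[1+ _ ] = refl

  ⟪α⟫ : ∀ {ρ} → ρ vn ≡ + n → ρ vm ≡ + m → ⟪ αₜ ⟫ stored ρ ≡ + α
  ⟪α⟫ {ρ} n= m= = go (⟪last⟫ stored ρ vi coefficients dominant len=)
    where
    N = n * n + m * n
    len= : ⟪ coefficients ⟫ stored ρ ≡ + N
    len= = ⇓-⊞ stored ρ (n̂ ⊠ n̂) (m̂ ⊠ n̂) (⇓-⊠ stored ρ n̂ n̂ n= n=) (⇓-⊠ stored ρ m̂ n̂ m= n=)
    c : ℕ → ℕ
    c p = ∣ stored (2 + p) ∣
    Dominant : Fin N → Set
    Dominant i = ∀ (i′ : Fin N) → c (toℕ i′) ≤ c (toℕ i)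
    dominant⇔ : ∀ (i : Fin N) → ((stored , ρ [ vi ≔ᵥ + toℕ i ]) ⊨ dominant) ⇔ Dominant i
    dominant⇔ i = mk⇔
      (λ p i′ → ℤ.drop‿+≤+ (subst₂ ℤ._≤_ (⟪∣∣⟫ stored (ρ′ i′) t′) (⟪∣∣⟫ stored (ρ′ i′) t) (to (⊨-≼ ∣ t′ ∣ₜ ∣ t ∣ₜ) (to all⇔ p i′))))
      (λ d → from all⇔ λ i′ → from (⊨-≼ ∣ t′ ∣ₜ ∣ t ∣ₜ)
        (subst₂ ℤ._≤_ (sym (⟪∣∣⟫ stored (ρ′ i′) t′)) (sym (⟪∣∣⟫ stored (ρ′ i′) t)) (ℤ.+≤+ (d i′))))
      where
      t  = input (lit′ 2 ⊞ var vi)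
      t′ = input (lit′ 2 ⊞ var vi′)
      ρ′ : Fin N → Env
      ρ′ i′ = (ρ [ vi ≔ᵥ + toℕ i ]) [ vi′ ≔ᵥ + toℕ i′ ]
      all⇔ = ⊨-all {stored} {ρ [ vi ≔ᵥ + toℕ i ]} vi′ coefficients (∣ t′ ∣ₜ ≼ ∣ t ∣ₜ) len=
    length-xs : List.length xs ≡ N
    length-xs = trans (List.length-++ (entries Q)) (cong₂ _+_ (length-entries Q) (length-entries A))
    at-xs : ∀ a → stored (2 + a) ≡ initial (xs ++ List.tabulate b) (+ a)
    at-xs a = cong (λ L → initial L (+ a)) (sym (List.++-assoc (entries Q) (entries A) (List.tabulate b)))
    α≤ : ∀ v → (∀ (i : Fin N) → c (toℕ i) ≤ v) → α ≤ v
    α≤ v h = max≤v⁺ {xs = List.map ∣_∣ xs} z≤n (All.map⁺ {f = ∣_∣} (All-initial⁺ {xs} {L′ = List.tabulate b} λ a a<len →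
      let a<N = subst (a <_) length-xs a<len in
      subst (λ z → ∣ z ∣ ≤ v) (at-xs a) (subst (λ k → c k ≤ v) (Fin.toℕ-fromℕ< a<N) (h (fromℕ< a<N)))))
    c≤α : ∀ (i : Fin N) → c (toℕ i) ≤ α
    c≤α i = subst (λ z → ∣ z ∣ ≤ α) (sym (at-xs (toℕ i))) (All-initial⁻ xs≤α (subst (toℕ i <_) (sym length-xs) (Fin.toℕ<n i)))
    z = ⟪ loop last vi coefficients dominant ⟫ stored ρ
    body : ℤ → ℤ
    body v = ⟪ cond (var vz) ∣ input (lit′ 1 ⊞ var vz) ∣ₜ (num 0ℤ) ⟫ stored (ρ [ vz ≔ᵥ v ])
    go : (z ≡ 0ℤ × (∀ (i : Fin N) → ¬ (stored , ρ [ vi ≔ᵥ + toℕ i ]) ⊨ dominant)) ⊎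
         (∃[ i ] z ≡ + suc (toℕ {N} i) × (stored , ρ [ vi ≔ᵥ + toℕ i ]) ⊨ dominant) → body z ≡ + α
    -- If there were any coefficient, an index minimizing -c would dominate; so there is none, and α
    -- is 0.
    go (inj₁ (z= , none)) = trans (cong body z=) (cong +_ (sym (ℕ.n≤0⇒n≡0 (α≤ 0 λ i →
      let i₀ , _ , l = argmin (λ (_ : Fin N) → ⊤) (λ _ → yes tt) (λ i → ℤ.- + c (toℕ i)) i tt
      in ⊥-elim (none i₀ (from (dominant⇔ i₀) λ i′ → ℤ.drop‿+≤+ (ℤ.neg-cancel-≤ (l i′ tt))))))))
    go (inj₂ (i , z= , p)) = trans (cong body z=) (trans (⟪∣∣⟫ stored (ρ [ vz ≔ᵥ + suc (toℕ i) ]) (input (lit′ 1 ⊞ var vz)))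
      (cong +_ (ℕ.≤-antisym (c≤α i) (α≤ (c (toℕ i)) (to (dominant⇔ i) p)))))

-- Computing the base and the cap.

module Sizing where
  open import Data.Nat.Base using (_+_; _*_; _≤_; _<_)

  ⟪r⟫ : ∀ inp ρ {n α} → ρ vn ≡ + n → ρ vα ≡ + α → ⟪ rₜ ⟫ inp ρ ≡ + rank n α
  ⟪r⟫ inp ρ {n} {α} n= α= = subst (λ r → ⟪ rₜ ⟫ inp ρ ≡ + r) (sym (rank-def n α))
    (⇓-⊞ inp ρ (lit′ 4 ⊠ (s ⊠ s ⊠ s′) ⊞ lit′ 6 ⊠ n̂) (lit′ 5)
      (⇓-⊞ inp ρ (lit′ 4 ⊠ (s ⊠ s ⊠ s′)) (lit′ 6 ⊠ n̂)
        (⇓-⊠ inp ρ (lit′ 4) (s ⊠ s ⊠ s′) refl (⇓-⊠ inp ρ (s ⊠ s) s′ (⇓-⊠ inp ρ s s s= s=) (cong (λ v → + 1 ℤ.+ v) α=)))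
        (⇓-⊠ inp ρ (lit′ 6) n̂ refl n=)) refl)
    where
    s  = lit′ 1 ⊞ n̂
    s′ = lit′ 1 ⊞ var vα
    s= : ⟪ s ⟫ inp ρ ≡ + suc n
    s= = cong (λ v → + 1 ℤ.+ v) n=

  -- The content μ of `vm` is m in the main program and 0 in the one for f.
  module _ {K : ℕ} {inp : Input} {Goal : Env → Set} {ls : List Line} {n α : ℕ} {μ : ℤ} (F≤K : bound n α ≤ K)
    (continue : ∀ ρ → ρ vn ≡ + n → ρ vm ≡ μ → ρ vB ≡ + base n α → ρ vF ≡ + bound n α → Bounds K inp ρ →
      Reaches K inp Goal ls ρ) where
    private
      B≤K : base n α ≤ K
      B≤K = ≤-trans (base≤bound n α) F≤K

      fromF : ∀ ρ → ρ vn ≡ + n → ρ vm ≡ μ → ρ vB ≡ + base n α → Bounds K inp ρ → Reaches K inp Goal (towerOf vF vB ∷ ls) ρ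
      fromF ρ n= m= B= Bd = reach Bd (continue (lineEnv (towerOf vF vB) inp ρ) n= m= B= F= (bounds-set vF Bd F= F≤K))
        where
        F= : + tower (clamp (ρ vB)) ≡ + bound n α
        F= = cong (λ v → + tower (clamp v)) B=

      fromB : ∀ ρ → ρ vn ≡ + n → ρ vm ≡ μ → ρ vr ≡ + rank n α → Bounds K inp ρ →
        Reaches K inp Goal (towerOf vB vr ∷ towerOf vF vB ∷ ls) ρ
      fromB ρ n= m= r= Bd = reach Bd (fromF (lineEnv (towerOf vB vr) inp ρ) n= m= B= (bounds-set vB Bd B= B≤K))
        where
        B= : + tower (clamp (ρ vr)) ≡ + base n α
        B= = cong (λ v → + tower (clamp v)) r=

    from-sizing : ∀ ρ → ρ vn ≡ + n → ρ vm ≡ μ → ρ vα ≡ + α → Bounds K inp ρ → Reaches K inp Goal (sizing ls) ρ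
    from-sizing ρ n= m= α= Bd = reach Bd (fromB (lineEnv (set vr rₜ) inp ρ) n= m= r= (bounds-set vr Bd r= (≤-trans (rank≤base n α) B≤K)))
      where
      r= : ⟪ rₜ ⟫ inp ρ ≡ + rank n α
      r= = ⟪r⟫ inp ρ n= α=

  n≤bound : ∀ n α → n ≤ bound n α
  n≤bound n α = ≤-trans (n≤rank n α) (≤-trans (rank≤base n α) (base≤bound n α))

  α<bound : ∀ n α → suc α ≤ bound n α
  α<bound n α = ≤-trans (<⇒≤ (α<rank n α)) (≤-trans (rank≤base n α) (base≤bound n α))

open Sizing

-- The search on a given instance.

module Correctness (I : Instance) where
  open import Data.Nat.Base using (_+_; _*_; _^_; _≤_; _<_)
  open Instance I
  open Encoding I public

  -- K combines F, which bounds the numbers depending on n and α, with the encoding length, which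
  -- bounds m and the bit length of each input entry.
  F B H K : ℕ
  F = bound n α
  B = base n α
  H = half n α
  K = F * encodingLength I

  instance
    B≢0 : NonZero B
    B≢0 = >-nonZero (≤-trans (s≤s z≤n) (2≤tower (rank n α)))

  open Search I B H F (code-bound n α) public
  open Verdict I B H F (code-bound n α) (base≡half+half n α) α (α<half n α) (final-bound n α) Q≤α A≤α public

  F≤K : F ≤ K
  F≤K = m≤m*n F (encodingLength I) ⦃ >-nonZero (≤-trans (s≤s z≤n) 2≤length) ⦄

  L≤K : encodingLength I ≤ K
  L≤K = m≤n*m (encodingLength I) F ⦃ >-nonZero (≤-trans (s≤s z≤n) (2≤tower B)) ⦄

  2≤K : 2 ≤ K
  2≤K = ≤-trans 2≤length L≤K

  ρ₀ : Env
  ρ₀ _ = 0ℤ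

  rep₀ : Rep stored ρ₀ home (initial (encoding I))
  rep₀ = rep (λ _ → refl) (λ _ → refl)

  private
    H≤K : H ≤ K
    H≤K = ≤-trans (≤-trans (m≤m+n H H) (≤-reflexive (sym (base≡half+half n α)))) (≤-trans (base≤bound n α) F≤K)

    module S = Stage {K} stored (div-pos B 2) stored-Q stored-A stored-b F≤K H≤K

    from-α : ∀ ρ → ρ vn ≡ + n → ρ vm ≡ + m → Bounds K stored ρ →
      Reaches K stored (Final K stored) (set vα αₜ ∷ sizing search) ρ
    from-α ρ n= m= Bd = reach Bd (from-sizing F≤K S.from-search (lineEnv (set vα αₜ) stored ρ) n= m= α=
      (bounds-set vα Bd α= (≤-trans (≤-trans (n≤1+n α) (α<bound n α)) F≤K)))
      where
      α= : ⟪ αₜ ⟫ stored ρ ≡ + α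
      α= = ⟪α⟫ {ρ} n= m=

    from-m : ∀ ρ → ρ vn ≡ + n → Bounds K stored ρ →
      Reaches K stored (Final K stored) (set vm (input (lit′ 1)) ∷ set vα αₜ ∷ sizing search) ρ
    from-m ρ n= Bd = reach Bd (from-α (lineEnv (set vm (input (lit′ 1))) stored ρ) n= refl
      (bounds-set {w = m} vm Bd refl (≤-trans m≤length L≤K)))

  prelude-reaches : Reaches K stored (Final K stored) prelude ρ₀
  prelude-reaches = reach bounds₀ (from-m (lineEnv (set vn (input (lit′ 0))) stored ρ₀) refl
    (bounds-set {w = n} vn bounds₀ refl (≤-trans (n≤bound n α) F≤K)))
    where
    bounds₀ : Bounds K stored ρ₀
    bounds₀ = bounds (λ a → ≤-trans (bits-stored a) L≤K) (λ _ → z≤n)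

-- Output, total running time and computability of f.

module Main where
  open import Data.Nat.Base using (_+_; _*_; _^_; _≤_; _<_)

  outputSetup : List Line
  outputSetup = set vk (var vG ⊟ lit′ 1) ∷ set vj (lit′ 0) ∷ []

  -- Compiled terms never write to nonnegative registers, so the output loop is written directly;
  -- coordinate j goes to register j + 1.
  emit : Tm big → Program
  emit t = whilePos R (home vn) ⊖ R (home vj)
    ⟨ code home top t ⨾ R (home vj) ⊕ lit 1ℤ ≔ R top ⨾ home vj ⇐ R (home vj) ⊕ lit 1ℤ ⟩

  -- Certificates come first: only in their absence is a best code optimal, and a missing best code
  -- a proof of infeasibility.
  epilogue main : Program
  epilogue = ifPos R (home vC) ⟨ lit 0ℤ ≔ lit 1ℤ ⟩⟨
    ifPos R (home vG) ⟨ linesCode outputSetup ⨾ emit xₜ ⨾ lit 0ℤ ≔ lit (+ 2) ⟩⟨ lit 0ℤ ≔ lit 0ℤ ⟩ ⟩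
  main = linesCode prelude ⨾ epilogue

  ≔ᵥ-twice : ∀ {X : Set} (f : Var → X) x v w y → ((f [ x ≔ᵥ v ]) [ x ≔ᵥ w ]) y ≡ (f [ x ≔ᵥ w ]) y
  ≔ᵥ-twice f x v w y with y Fin.≟ x
  ... | yes _ = refl
  ... | no y≢x with y Fin.≟ x
  ...   | yes e = contradiction e y≢x
  ...   | no  _ = refl

  -- The output overlaps the input, so `intact` covers only addresses above n, while `bits≤` also
  -- covers the registers already overwritten.
  record Emitted (K n : ℕ) (inp : Input) (ρ : Env) (x : Vector ℤ n) (i : ℕ) (σ : Memory) : Set where
    constructor emitted
    field
      homes  : ∀ y → σ -[1+ home y ] ≡ (ρ [ vj ≔ᵥ + i ]) y
      intact : ∀ a → n < a → σ (+ a) ≡ inp a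
      output : ∀ (j : Fin n) → toℕ j < i → σ (+ suc (toℕ j)) ≡ x j
      bits≤  : ∀ a → bits (σ (+ a)) ≤ K

  emitted-next : ∀ {K n inp ρ x i σ σ₁ σ₂ σ₃} (i<n : i < n) → bits (x (fromℕ< i<n)) ≤ K → Emitted K n inp ρ x i σ →
    Frame top σ σ₁ → Upd (+ i ℤ.+ 1ℤ) (x (fromℕ< i<n)) σ₁ σ₂ → Upd -[1+ home vj ] (+ i ℤ.+ 1ℤ) σ₂ σ₃ →
    Emitted K n inp ρ x (suc i) σ₃
  emitted-next {K} {n} {inp} {ρ} {x} {i} {σ} {σ₁} {σ₂} {σ₃} i<n x≤ (emitted homes intact output bits≤) Fr u u′ =
    emitted homes′ intact′ output′ bits≤′
    where
    here : σ₃ (+ suc i) ≡ x (fromℕ< i<n)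
    here = trans (Upd.off u′ (+ suc i) λ ()) (trans (cong (λ a → σ₂ (+ a)) (+-comm 1 i)) (Upd.at u))
    there : ∀ a → a ≢ suc i → σ₃ (+ a) ≡ σ (+ a)
    there a a≢ = trans (Upd.off u′ (+ a) λ ())
      (trans (Upd.off u (+ a) (λ e → a≢ (trans (ℤ.+-injective e) (+-comm i 1)))) (nonneg Fr a))
    homes₂ : Rep (λ a → σ₂ (+ a)) (ρ [ vj ≔ᵥ + i ]) home σ₂
    homes₂ = rep (λ _ → refl) (λ y → trans (Upd.off u -[1+ home y ] λ ()) (trans (low Fr (home<top y)) (homes y)))
    homes′ : ∀ y → σ₃ -[1+ home y ] ≡ (ρ [ vj ≔ᵥ + suc i ]) y
    homes′ y = trans (vars (rep-home vj u′ homes₂) y)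
      (trans (≔ᵥ-twice ρ vj (+ i) (+ i ℤ.+ 1ℤ) y) (cong (λ i → (ρ [ vj ≔ᵥ + i ]) y) (+-comm i 1)))
    intact′ : ∀ a → n < a → σ₃ (+ a) ≡ inp a
    intact′ a n<a = trans (there a λ e → ℕ.<⇒≱ n<a (subst (_≤ n) (sym e) i<n)) (intact a n<a)
    output′ : ∀ (j : Fin n) → toℕ j < suc i → σ₃ (+ suc (toℕ j)) ≡ x j
    output′ j j<1+i with toℕ j ℕ.≟ i
    ... | yes e = subst (λ j′ → σ₃ (+ suc (toℕ j)) ≡ x j′) (Fin.toℕ-injective (trans (Fin.toℕ-fromℕ< i<n) (sym e)))
            (trans (cong (λ a → σ₃ (+ suc a)) e) here)
    ... | no ≢i = trans (there _ (λ e → ≢i (ℕ.suc-injective e))) (output j (ℕ.≤∧≢⇒< (ℕ.s≤s⁻¹ j<1+i) ≢i))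
    bits≤′ : ∀ a → bits (σ₃ (+ a)) ≤ K
    bits≤′ a with a ℕ.≟ suc i
    ... | yes refl = subst (λ z → bits z ≤ K) (sym here) x≤
    ... | no a≢    = subst (λ z → bits z ≤ K) (sym (there a a≢)) (bits≤ a)

  private
    big-bits : ∀ {K c} z → Poly K c (mag big z) → Poly K c (bits z)
    big-bits z p = p

  opaque
    -- Later rounds evaluate t on a partly overwritten input. Hence the requirement that its value
    -- be the same for all inputs agreeing above n, and the larger base K ^ c′ for the bit lengths.
    emit-run : ∀ t → ∃[ c ] ∃[ c′ ] ∀ {K n inp ρ σ} {x : Vector ℤ n} → 2 ≤ K → n ≤ K → ρ vn ≡ + n → Bounds K inp ρ →
      (∀ inp′ → (∀ a → n < a → inp′ a ≡ inp a) → ∀ j i → toℕ j ≡ i → ⟪ t ⟫ inp′ (ρ [ vj ≔ᵥ + i ]) ≡ x j) →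
      Rep inp (ρ [ vj ≔ᵥ 0ℤ ]) home σ → Run (emit t) σ K c (Emitted (K ^ c′) n inp ρ x n)
    emit-run t = let c , V = value t ; _ , X = exec t home top home<top in
      _ , suc c , λ {K} {n} {inp} {ρ} {σ} {x} 2≤K n≤K n= Bd t= S →
      let i≤ : ∀ {i} → i ≤ n → Poly K _ (bits (+ i))
          i≤ {i} i≤n = poly-bits {z = + i} small 2≤K (poly-≤ (≤-trans i≤n n≤K) (poly-self 2≤K))
          Bdⱼ : ∀ {i} → i ≤ n → Bounds K inp (ρ [ vj ≔ᵥ + i ])
          Bdⱼ {i} i≤n = bounds-set {w = i} vj Bd refl (≤-trans i≤n n≤K)
          x≤ : ∀ {i} (i<n : i < n) → Poly K c (bits (x (fromℕ< i<n)))
          x≤ {i} i<n = big-bits (x (fromℕ< i<n)) (subst (λ z → Poly K c (mag big z))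
            (t= inp (λ _ _ → refl) (fromℕ< i<n) i (Fin.toℕ-fromℕ< i<n)) (V 2≤K (Bdⱼ (<⇒≤ i<n))))
      in
      run-while n (Emitted (K ^ suc c) n inp ρ x) (λ i → + n ℤ.- + i) 2≤K (poly-≤ n≤K (poly-self 2≤K)) (0<E-i {+ n}) (E-clamp≤0 (+ n))
        (λ i≤n v → ev-op sub 2≤K (ev-R (home vn) 2≤K (trans (Emitted.homes v vn) n=) (i≤ ≤-refl)) (ev-R (home vj) 2≤K (Emitted.homes v vj) (i≤ i≤n)))
        (λ {i} {σ} i<n v →
          let j   = fromℕ< i<n
              Sσ  = rep {λ a → σ (+ a)} (λ _ → refl) (Emitted.homes v)
              Bσ  = bounds (Emitted.bits≤ v) (λ y → ≤-trans (env≤ (Bdⱼ (<⇒≤ i<n)) y) (K≤^ 2≤K c))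
              i≤′ = i≤ (<⇒≤ i<n)
          in
          run-⨾ 2≤K (rebase (suc c) (X (2≤^ 2≤K c) Bσ Sσ)) λ (result Fr e) →
          let S₁  = rep-frame home<top Fr Sσ
              x≡  = trans e (t= (λ a → σ (+ a)) (Emitted.intact v) j i (Fin.toℕ-fromℕ< i<n))
          in
          run-⨾ 2≤K (run-≔ 2≤K (ev-op add 2≤K (ev-R (home vj) 2≤K (vars S₁ vj) i≤′) (ev-lit 1ℤ 2≤K)) (ev-R top 2≤K x≡ (x≤ i<n))) λ u →
          map-post (emitted-next i<n (holds (poly-wk 2≤K (n≤1+n c) (x≤ i<n))) v Fr u)
            (run-⇐ (home vj) 2≤K (ev-op add 2≤K (ev-R (home vj) 2≤K (trans (Upd.off u -[1+ home vj ] λ ()) (vars S₁ vj)) i≤′) (ev-lit 1ℤ 2≤K))))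
        (emitted (vars S) (λ a _ → inputs S a) (λ _ ())
          (λ a → subst (λ z → bits z ≤ K ^ suc c) (sym (inputs S a)) (≤-trans (inp≤ Bd a) (K≤^ 2≤K c))))

  selects-pos : ∀ {N} {X : Fin N → Set} {z} → 0ℤ ℤ.< z → Selects X z → ∃[ i ] z ≡ + suc (toℕ i) × X i
  selects-pos 0<z (nothingFound refl _) = contradiction 0<z (ℤ.<-irrefl refl)
  selects-pos 0<z (found i z= x)        = i , z= , x

  selects-neg : ∀ {N} {X : Fin N → Set} {z} → z ℤ.≤ 0ℤ → Selects X z → ∀ i → ¬ X i
  selects-neg z≤0 (nothingFound _ none) = none
  selects-neg (ℤ.+≤+ ()) (found i refl x)

  verdict : ∀ {K σ} v → 2 ≤ K → Run (lit 0ℤ ≔ lit v) σ K _ (Upd 0ℤ v σ)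
  verdict v 2≤K = run-≔ 2≤K (ev-lit 0ℤ 2≤K) (ev-lit v 2≤K)

  module Output (I : Instance) where
    open Instance I using (n; m; A; b)
    open Correctness I public

    -- The output overwrites registers 1, …, n only, and the coordinates of
    -- a candidate depend on A and b alone, which are stored after Q.
    globals-high : ∀ {inp inp′ ρ} → (∀ a → n < a → inp′ a ≡ inp a) → Globals inp ρ → Globals inp′ ρ
    globals-high {inp} {inp′} h G = record
      { n≡ = n≡ ; m≡ = m≡ ; B≡ = B≡ ; F≡ = F≡ ; H≡ = H≡ ; T≡ = T≡ ; N≡ = N≡
      ; A≡ = λ i j → trans (h _ (high _)) (A≡ i j) ; b≡ = λ i → trans (h _ (high _)) (b≡ i) }
      where
      open Globals G
      n≤n² : ∀ n → n ≤ n * n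
      n≤n² zero    = z≤n
      n≤n² (suc n) = m≤m*n (suc n) (suc n)
      high : ∀ a → n < 2 + (n * n + a)
      high a = s≤s (≤-trans (≤-trans (n≤n² n) (m≤m+n (n * n) a)) (n≤1+n _))

    output-correct : ∀ {k σ σ′} → (∀ (k : Fin (B ^ P)) → ¬ Cert (toℕ k)) → Optimum k →
      (∀ j → outputVector σ j ≡ x̂ (toℕ k) j) → Upd 0ℤ (+ 2) σ σ′ → CorrectOutput I σ′
    output-correct {k} {σ} {σ′} ¬cert opt v u = inj₂ (inj₂ (Upd.at u , (x̂ (toℕ k) , proj₁ opt) , optimum-bounded ¬cert {k} opt ,
      Feasible-cong out= (proj₁ optimal) , λ y fy → subst (ℤ._≤ objective I y) (sym (objective-cong out=)) (proj₂ optimal y fy)))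
      where
      optimal = optimum-sound ¬cert {k} opt
      out= : ∀ j → outputVector σ′ j ≡ x̂ (toℕ k) j
      out= j = trans (Upd.off u (+ suc (toℕ j)) λ ()) (v j)

    output-term : ∀ {ρ k} → Globals stored ρ → ρ vk ≡ + k → ∀ inp′ → (∀ a → n < a → inp′ a ≡ stored a) →
      ∀ j i → toℕ j ≡ i → ⟪ xₜ ⟫ inp′ (ρ [ vj ≔ᵥ + i ]) ≡ x̂ k j
    output-term G k= inp′ h j i e = ⟪x⟫ j (globals-high h (bindᵍ vj (+ i) G)) k= (cong +_ (sym e))

    n≤K : n ≤ K
    n≤K = ≤-trans (n≤bound n α) F≤K

    output-run : ∀ ρ {σ} k → Globals stored ρ → Bounds K stored ρ → ρ vk ≡ + k → Rep stored (ρ [ vj ≔ᵥ 0ℤ ]) home σ →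
      Run (emit xₜ) σ K _ (λ σ′ → ∀ j → outputVector σ′ j ≡ x̂ k j)
    output-run ρ {σ} k G Bd k= S = map-post (λ e j → Emitted.output e j (Fin.toℕ<n j))
      (proj₂ (proj₂ (emit-run xₜ)) {K} {n} {stored} {ρ} {σ} {x̂ k} 2≤K n≤K (Globals.n≡ G) Bd (output-term {ρ} {k} G k=) S)

    optimum-run : ∀ ρ {σ} (k : Fin (B ^ P)) → Globals stored ρ → Bounds K stored ρ →
      (∀ (k : Fin (B ^ P)) → ¬ Cert (toℕ k)) → ρ vG ≡ + suc (toℕ k) → Optimum k → Rep stored ρ home σ →
      Run (linesCode outputSetup ⨾ emit xₜ ⨾ lit 0ℤ ≔ lit (+ 2)) σ K _ (CorrectOutput I)
    optimum-run ρ k G Bd ¬cert G= opt S =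
      run-⨾ 2≤K (proj₂ (lines-run outputSetup) 2≤K (Bd , Bₖ , bounds-set {w = 0} vj Bₖ refl z≤n) S) λ S′ →
      run-⨾ 2≤K (output-run (ρ [ vk ≔ᵥ ⟪ var vG ⊟ lit′ 1 ⟫ stored ρ ]) (toℕ k) (bindᵍ vk (⟪ var vG ⊟ lit′ 1 ⟫ stored ρ) G) Bₖ k= S′) λ {σ₂} out= →
      map-post {P′ = CorrectOutput I} (λ {σ₃} → output-correct {k} {σ₂} {σ₃} ¬cert opt out=) (verdict (+ 2) 2≤K)
      where
      k= : ⟪ var vG ⊟ lit′ 1 ⟫ stored ρ ≡ + toℕ k
      k= = cong (ℤ._- 1ℤ) G=
      k≤K : toℕ k ≤ K
      k≤K = ≤-trans (n≤1+n (toℕ k)) (subst (λ z → ∣ z ∣ ≤ K) G= (env≤ Bd vG))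
      Bₖ = bounds-set vk Bd k= k≤K

    epilogue-run : ∀ ρ {σ} → Final K stored ρ → Rep stored ρ home σ → Run epilogue σ K _ (CorrectOutput I)
    epilogue-run ρ {σ} f S = run-if 2≤K (at vC)
      (λ 0<C → let _ , _ , c = selects-pos 0<C certs in
        map-post {P′ = CorrectOutput I} (λ u → inj₂ (inj₁ (Upd.at u , cert-sound c))) (verdict 1ℤ 2≤K))
      (λ C≤0 → let ¬cert = selects-neg C≤0 certs in run-if 2≤K (at vG)
        (λ 0<G → let k , G= , opt = selects-pos 0<G optima in optimum-run ρ k globals bounded ¬cert G= opt S)
        (λ G≤0 → map-post {P′ = CorrectOutput I} (λ u → inj₁ (Upd.at u , no-optimum ¬cert (selects-neg G≤0 optima))) (verdict 0ℤ 2≤K)))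
      where
      open Final f
      at : ∀ x → Ev K _ _ (R (home x)) σ (ρ x)
      at x = ev-R (home x) 2≤K (vars S x) (poly-bits {z = ρ x} small 2≤K (poly-≤ (env≤ bounded x) (poly-self 2≤K)))

    whole-run : Run main (initial (encoding I)) K _ (CorrectOutput I)
    whole-run = run-⨾ 2≤K (reaches-run prelude 2≤K prelude-reaches rep₀) λ (ρ , f , S) → epilogue-run ρ f S

  main-run : ∃[ c ] ∀ I → Run main (initial (encoding I)) (bound (Instance.n I) (maxCoefficient I) * encodingLength I) c (CorrectOutput I)
  main-run = _ , λ I → Output.whole-run I

  *-^ : ∀ a b c → (a * b) ^ c ≡ a ^ c * b ^ c
  *-^ a b zero    = refl
  *-^ a b (suc c) = trans (cong (a * b *_) (*-^ a b c)) (exchange a b (a ^ c) (b ^ c))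
    where
    exchange : ∀ a b x y → a * b * (x * y) ≡ a * x * (b * y)
    exchange = ℕ-Ring.solve-∀

  -- The product is unrolled, c being fixed; a loop capped by `vF` would cut off powers above F.
  powerₜ : ℕ → Tm small
  powerₜ zero    = lit′ 1
  powerₜ (suc c) = var vF ⊠ powerₜ c

  ⟪powerₜ⟫ : ∀ c inp ρ {F} → ρ vF ≡ + F → ⟪ powerₜ c ⟫ inp ρ ≡ + (F ^ c)
  ⟪powerₜ⟫ zero    inp ρ F= = refl
  ⟪powerₜ⟫ (suc c) inp ρ F= = ⇓-⊠ inp ρ (var vF) (powerₜ c) F= (⟪powerₜ⟫ c inp ρ F=)

  -- Relative to the base F ^ (c + 1) all values involved are small, so the compiled straight-line
  -- code and its analysis apply again.
  computable-power : ∀ c → Computable (λ n α → bound n α ^ c)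
  computable-power c = prog , correct
    where
    ls : List Line
    ls = set vn (input (lit′ 0)) ∷ set vα (input (lit′ 1)) ∷ sizing (set vG (powerₜ c) ∷ [])
    prog : Program
    prog = linesCode ls ⨾ lit 0ℤ ≔ R (home vG)
    correct : ∀ n α → ∃[ σ ] ∃[ t ] ⟨ prog , initial (+ n ∷ + α ∷ []) ⟩⇓⟨ σ , t ⟩ × σ 0ℤ ≡ + (bound n α ^ c)
    correct n α = let run h _ p = whole in _ , _ , h , p
      where
      F = bound n α
      K = F ^ suc c
      inp : Input
      inp a = initial (+ n ∷ + α ∷ []) (+ a)
      2≤F : 2 ≤ F
      2≤F = 2≤tower (base n α)
      instance
        F≢0 : NonZero F
        F≢0 = >-nonZero (≤-trans (s≤s z≤n) 2≤F)
      F≤K : F ≤ K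
      F≤K = K≤^ 2≤F c
      2≤K : 2 ≤ K
      2≤K = ≤-trans 2≤F F≤K
      n<F : n < F
      n<F = ≤-<-trans (≤-trans (n≤rank n α) (rank≤base n α)) (tower-< (base n α))
      α<F : α < F
      α<F = α<bound n α
      bounds₀ : Bounds K inp (λ _ → 0ℤ)
      bounds₀ = bounds (initial-All {P = λ z → bits z ≤ K} (≤-trans (s≤s z≤n) 2≤K)
        (≤-trans (≤-trans (bits≤1+mag small (+ n)) n<F) F≤K ∷ ≤-trans (≤-trans (bits≤1+mag small (+ α)) α<F) F≤K ∷ [])) (λ _ → z≤n)
      Goal : Env → Set
      Goal ρ = ρ vG ≡ + (F ^ c)
      fromG : ∀ ρ → ρ vn ≡ + n → ρ vm ≡ 0ℤ → ρ vB ≡ + base n α → ρ vF ≡ + F → Bounds K inp ρ → Reaches K inp Goal (set vG (powerₜ c) ∷ []) ρ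
      fromG ρ _ _ _ F= Bd = reach Bd (reaches Bd′ G=)
        where
        G= : ⟪ powerₜ c ⟫ inp ρ ≡ + (F ^ c)
        G= = ⟪powerₜ⟫ c inp ρ F=
        Bd′ = bounds-set vG Bd G= (m≤n*m (F ^ c) F)
      from-α : ∀ ρ → ρ vn ≡ + n → ρ vm ≡ 0ℤ → Bounds K inp ρ → Reaches K inp Goal (set vα (input (lit′ 1)) ∷ sizing (set vG (powerₜ c) ∷ [])) ρ
      from-α ρ n= m= Bd = reach Bd (from-sizing F≤K fromG (lineEnv (set vα (input (lit′ 1))) inp ρ) n= m= refl
        (bounds-set {w = α} vα Bd refl (≤-trans (<⇒≤ α<F) F≤K)))
      from-n : Reaches K inp Goal ls (λ _ → 0ℤ)
      from-n = reach bounds₀ (from-α (lineEnv (set vn (input (lit′ 0))) inp (λ _ → 0ℤ)) refl refl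
        (bounds-set {w = n} vn bounds₀ refl (≤-trans (<⇒≤ n<F) F≤K)))
      whole : Run prog (initial (+ n ∷ + α ∷ [])) K _ (λ σ → σ 0ℤ ≡ + (F ^ c))
      whole = run-⨾ 2≤K (reaches-run ls 2≤K from-n (rep (λ _ → refl) (λ _ → refl))) λ (_ , G= , S) →
        map-post Upd.at (run-≔ 2≤K (ev-lit 0ℤ 2≤K) (ev-R (home vG) 2≤K (trans (vars S vG) G=)
          (poly-bits {z = + (F ^ c)} small 2≤K (poly-≤ (m≤n*m (F ^ c) F) (poly-self 2≤K)))))

open Main

open import Data.Nat.Base using (_*_; _^_; _≤_)

theorem2 : Σ[ p ∈ Program ] Σ[ f ∈ (ℕ → ℕ → ℕ) ] Σ[ c ∈ ℕ ]
    Computable f ×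
    (∀ (I : Instance) → ∃[ σ ] ∃[ t ]
    ⟨ p , initial (encoding I) ⟩⇓⟨ σ , t ⟩ ×
    t ≤ f (Instance.n I) (maxCoefficient I) * encodingLength I ^ c ×
    CorrectOutput I σ)
theorem2 = package main-run
  where
  package : (∃[ c ] ∀ I → Run main (initial (encoding I)) (bound (Instance.n I) (maxCoefficient I) * encodingLength I) c (CorrectOutput I)) → _
  -- As (F L) ^ c = F ^ c · L ^ c, the exponent of the running time serves both for f and for the
  -- power of L.
  package (c , runs) = main , (λ n α → bound n α ^ c) , c , computable-power c , λ I →
    let run halts time≤ correct = runs I in
    _ , _ , halts ,
    ≤-trans (holds time≤) (≤-reflexive (*-^ (bound (Instance.n I) (maxCoefficient I)) (encodingLength I) c)) ,
    correct
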